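{- Let $p\ge5$ be a prime with Legendre symbol $\left(\frac{ -18}{p}\right)=-1$, and let $m\ge0$, $\alpha\ge0$, $n\ge0$ be integers. Then for every $i\in\{1,2,\dots,p-1\}$, $$\overline{S}_9^{\,16m+1}\big(24p^{2\alpha+2}n+(24i+11p)p^{2\alpha+1}\big)\equiv0\pmod{32}.$$
   Context: For $|q|<1$ and a positive integer $k$, write $f_k=\prod_{j\ge1}(1-q^{kj})$. For a positive integer $r$, $\overline{S}_9^{\,r}(n)$ (number of $9$-Schur overpartitions of $n$ with $r$-tuples) is defined by $\sum_{n\ge0}\overline{S}_9^{\,r}(n)q^n=\prod_{n\ge1}\frac{(1+q^{2n-1})^r(1-q^{9(2n-1)})^r}{(1+q^{9(2n-1)})^r(1-q^{2n-1})^r}=\frac{f_2^{3r}f_9^{2r}f_{36}^r}{f_1^{2r}f_4^rf_{18}^{3r}}$. -}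

module Defs where

open import Data.Bool using (Bool; true; false; if_then_else_)
open import Data.Nat as ℕ using (ℕ; zero; suc)
import Data.Nat.Divisibility as ℕD
open import Data.Integer as ℤ using (ℤ; +_; -[1+_]; ∣_∣)
open import Data.List using (List; upTo)
open import Data.Bool.ListAction using (any)
open import Relation.Nullary.Decidable using (⌊_⌋)

legendre : ℤ → ℕ → ℤ
legendre a p =
  if ⌊ p ℕD.∣? ∣ a ∣ ⌋ then + 0
  else if any (λ x → ⌊ p ℕD.∣? ∣ (+ x ℤ.* + x) ℤ.- a ∣ ⌋) (upTo p) then + 1
  else -[1+ 0 ]

Series : Set
Series = ℕ → ℤ

sumTo : ℕ → (ℕ → ℤ) → ℤ
sumTo zero    f = f 0
sumTo (suc n) f = sumTo n f ℤ.+ f (suc n)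

_⊛_ : Series → Series → Series
(a ⊛ b) n = sumTo n (λ i → a i ℤ.* b (n ℕ.∸ i))
infixl 7 _⊛_

oneS : Series
oneS zero    = + 1
oneS (suc _) = + 0

powS : Series → ℕ → Series
powS s zero    = oneS
powS s (suc r) = s ⊛ powS s r

oneMinusQ : ℕ → Series
oneMinusQ m zero = + 1
oneMinusQ m n@(suc _) = if ⌊ n ℕ.≟ m ⌋ then -[1+ 0 ] else + 0

invOneMinusQ : ℕ → Series
invOneMinusQ m n = if ⌊ m ℕD.∣? n ⌋ then + 1 else + 0

prodS : ℕ → (ℕ → Series) → Series
prodS zero    g = oneS
prodS (suc N) g = g (suc N) ⊛ prodS N g

-- Truncations of f_k = ∏_{j≥1} (1 - q^{kj}) and of 1/f_k to the factors j ≤ N.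
-- For k ≥ 1 these agree with f_k, 1/f_k in all coefficients of q^n with n ≤ N,
-- since the omitted factors are ≡ 1 mod q^{N+1}.
fTrunc : ℕ → ℕ → Series
fTrunc k N = prodS N (λ j → oneMinusQ (k ℕ.* j))

fInvTrunc : ℕ → ℕ → Series
fInvTrunc k N = prodS N (λ j → invOneMinusQ (k ℕ.* j))

S9bar : ℕ → ℕ → ℤ
S9bar r n =
  ( powS (fTrunc 2 n) (3 ℕ.* r)
  ⊛ powS (fTrunc 9 n) (2 ℕ.* r)
  ⊛ powS (fTrunc 36 n) r
  ⊛ powS (fInvTrunc 1 n) (2 ℕ.* r)
  ⊛ powS (fInvTrunc 4 n) r
  ⊛ powS (fInvTrunc 18 n) (3 ℕ.* r) ) n

{-# OPTIONS --safe #-}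
module Submission where

-- Write f_k for the Euler products and φ(q) = Σ_s q^(s²) over all integers s. Gauss' identity
-- φ(-q) = f₁²/f₂ gives f₂³/(f₁² f₄) = φ(q)/φ(-q²), so the generating function is the r-th power
-- of S = φ(q) φ(-q¹⁸) / (φ(-q²) φ(q⁹)). As (1 + 2u)^16 ≡ 1 mod 32, the exponent 16m + 1 may be
-- replaced by 1.
--
-- Split φ(q) = A + 2B with A = φ(q⁹), and φ(-q²) = A′ + 2(Be - Bo) with A′ = φ(-q¹⁸), where B
-- collects the q^(x²) with 3 ∤ x > 0, and Be, Bo the q^(2w²) with 3 ∤ w > 0, w even resp. odd.
-- Expanding S mod 32 as a geometric series and looking at exponents N ≡ 2 mod 3, N ≡ 3 mod 4, only
-- 16 B Be Bo contributes. Its coefficient at q^N is 16 times the number of solutions of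
-- N = x² + 2w² + 2z² with positive x, w, z prime to 3, w even and z odd.
--
-- For fixed z these are, up to sign and conjugation, elements x + w√-2 of ℤ[√-2] divisible by
-- exactly one of π = 1 + √-2 and π̄. Allowing both signs of w when 3 divides x and w does not
-- change the parity, and on the enlarged set α ↦ (π/π̄)ᾱ (up to sign) is an involution; it is
-- defined and free unless N = 9v² + 2z². Since (-18/p) = -1, every number of that shape contains
-- p to an even power, whereas p exactly divides N to an odd power.

open import Defs
open import Data.Nat using (ℕ; _+_; _*_; _^_; _≤_; _<_)
open import Data.Nat.Primality using (Prime)
open import Data.Integer using (+_; -[1+_]; -_)
open import Data.Integer.Divisibility using (_∣_)
open import Relation.Binary.PropositionalEquality using (_≡_)

open import Algebra.Bundles using (CommutativeRing; RawRing)
import Algebra.Properties.CommutativeSemiring.Exp as Exp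
import Algebra.Properties.Ring as RingProperties
import Algebra.Solver.Ring as RingSolver
open import Algebra.Solver.Ring.AlmostCommutativeRing
  using (fromCommutativeRing; _-Raw-AlmostCommutative⟶_)
open import Data.Bool using (Bool; true; false; _∨_)
open import Data.Bool.ListAction using (any)
import Data.Bool.Properties as 𝔹ₚ
open import Data.Empty using (⊥; ⊥-elim)
open import Data.Integer as ℤ using (ℤ; ∣_∣)
open import Data.Integer.Divisibility.Signed as ℤS using (divides)
import Data.Integer.Properties as ℤₚ
open import Data.Integer.Tactic.RingSolver using (solve-∀)
open import Data.List
  using (List; []; _∷_; _++_; map; length; filter; cartesianProduct; applyDownFrom; upTo)
open import Data.List.Membership.Propositional using (_∈_)
open import Data.List.Membership.Propositional.Properties
  using (∈-∃++; ∈-cartesianProduct⁺; ∈-filter⁺; ∈-filter⁻; ∈-applyDownFrom⁺; ∈-upTo⁺)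
open import Data.List.Relation.Binary.Permutation.Propositional using (_↭_; ↭-sym; ↭⇒↭ₛ)
open import Data.List.Relation.Binary.Permutation.Propositional.Properties
  using (shift; ↭-length; ∈-resp-↭)
import Data.List.Relation.Binary.Permutation.Setoid.Properties as ↭ₛ
open import Data.List.Relation.Unary.All as All using ([]; _∷_)
open import Data.List.Relation.Unary.AllPairs using ([]; _∷_)
open import Data.List.Relation.Unary.Any using (here; there)
open import Data.List.Relation.Unary.Unique.Propositional using (Unique)
import Data.List.Relation.Unary.Unique.Propositional.Properties as Uniqueₚ
open import Data.Maybe using (Maybe; just; nothing)
open import Data.Nat as ℕ using (zero; suc; z≤n; s≤s; NonZero)
open import Data.Nat.Coprimality using (Coprime; coprime-Bézout)
import Data.Nat.Divisibility as ℕD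
open import Data.Nat.DivMod as ℕM using (_%_)
open import Data.Nat.GCD using (module Bézout)
open import Data.Nat.Primality
  using (prime?; prime[2]; ¬prime[1]; euclidsLemma; prime⇒irreducible; prime⇒nonZero)
import Data.Nat.Properties as ℕₚ
open import Data.Nat.Tactic.RingSolver using () renaming (solve-∀ to ℕ-solve-∀)
open import Data.Product using (_×_; _,_; ∃; proj₂)
open import Data.Sum using (_⊎_; inj₁; inj₂; [_,_]′)
open import Function using (_∘_; id)
open import Level using (0ℓ)
open import Relation.Binary.PropositionalEquality as ≡
  using (_≢_; refl; sym; trans; cong; cong₂; subst; subst₂; module ≡-Reasoning)
import Relation.Binary.Reasoning.Setoid as SetoidReasoning
open import Relation.Nullary using (Dec; ¬_; ¬?; _×-dec_)
open import Relation.Nullary.Decidable using (yes; no; ⌊_⌋; from-yes)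

-- Power series under the Cauchy product

-- All identities are taken in (ℤ/32)[q]/(q^(N+1)), where N is the exponent of the theorem. As the
-- products in `S9bar` are cut at the index of the coefficient, Gauss' identity is needed between
-- finite products and finite theta sums; it comes from the functional equation (1 + u)F(ux) = (1 -
-- u)F(u) of the q-binomial series, with a boundary term. Modulo q^(N+1) a product may be prolonged
-- beyond N at no cost, which frees the length of the theta sums: those in q and -q² get length 3N,
-- so that their multiples of 3 form sums of length N in q⁹ and -q¹⁸.
--
-- Write the generating function as (1 + 2c)/(1 + 2b) with c = B/A and b = (Be - Bo)/A′. Modulo 3
-- the series b lives on the class 2 and c on the class 1, so cb^j lives on 1 + 2j, which for j ≤ 3
-- is the class 2 only at j = 2. Pure powers of b have even exponents. What is left is 8cb², whose
-- square terms avoid 3 mod 4 and whose cross term carries the factor 16.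
--
-- The shape 9v² + 2z² is the case w = 0: modulo 3 it forces x = 3v, and there the two signs of w
-- describe the same point.

infix 4 _≗_
_≗_ : Series → Series → Set
a ≗ b = ∀ n → a n ≡ b n

infixl 6 _⊞_
infix 8 ⊟_

_⊞_ : Series → Series → Series
(a ⊞ b) n = a n ℤ.+ b n

⊟_ : Series → Series
(⊟ a) n = ℤ.- a n

const : ℤ → Series
const c zero    = c
const c (suc _) = + 0

-- Structural recursion makes the tail of `mono (suc k)` compute to `mono k`, so that multiplication
-- by q is a shift without any comparison of exponents.
mono : ℕ → Series
mono zero    = oneS
mono (suc k) zero    = + 0
mono (suc k) (suc n) = mono k n

scale : ℤ → Series → Series
scale c a n = c ℤ.* a n

tail : Series → Series
tail a n = a (suc n)

sumTo-cong : ∀ n {f g} → (∀ i → f i ≡ g i) → sumTo n f ≡ sumTo n g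
sumTo-cong zero    h = h 0
sumTo-cong (suc n) h = cong₂ ℤ._+_ (sumTo-cong n h) (h (suc n))

sumTo-head : ∀ n f → sumTo (suc n) f ≡ f 0 ℤ.+ sumTo n (f ∘ suc)
sumTo-head zero    f = refl
sumTo-head (suc n) f =
  trans (cong (ℤ._+ f (2 ℕ.+ n)) (sumTo-head n f)) (ℤₚ.+-assoc (f 0) _ _)

-- Peeling off the constant term of the left factor turns the ring laws into inductions on the index
-- of the coefficient, in which the series vary. `⊛-suc′` peels the right factor, and commutativity
-- compares the two.
⊛-suc : ∀ a b n → (a ⊛ b) (suc n) ≡ a 0 ℤ.* b (suc n) ℤ.+ (tail a ⊛ b) n
⊛-suc a b n = sumTo-head n (λ i → a i ℤ.* b (suc n ℕ.∸ i))

⊛-suc′ : ∀ a b n → (a ⊛ b) (suc n) ≡ a (suc n) ℤ.* b 0 ℤ.+ (a ⊛ tail b) n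
⊛-suc′ a b zero    = ℤₚ.+-comm (a 0 ℤ.* b 1) (a 1 ℤ.* b 0)
⊛-suc′ a b (suc n) = begin
  (a ⊛ b) (2 ℕ.+ n)
    ≡⟨ ⊛-suc a b (suc n) ⟩
  a 0 ℤ.* b (2 ℕ.+ n) ℤ.+ (tail a ⊛ b) (suc n)
    ≡⟨ cong (λ z → a 0 ℤ.* b (2 ℕ.+ n) ℤ.+ z) (⊛-suc′ (tail a) b n) ⟩
  a 0 ℤ.* b (2 ℕ.+ n) ℤ.+ (a (2 ℕ.+ n) ℤ.* b 0 ℤ.+ (tail a ⊛ tail b) n)
    ≡⟨ swap (a 0 ℤ.* b (2 ℕ.+ n)) (a (2 ℕ.+ n) ℤ.* b 0) _ ⟩
  a (2 ℕ.+ n) ℤ.* b 0 ℤ.+ (a 0 ℤ.* b (2 ℕ.+ n) ℤ.+ (tail a ⊛ tail b) n)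
    ≡⟨ cong (λ z → a (2 ℕ.+ n) ℤ.* b 0 ℤ.+ z) (⊛-suc a (tail b) n) ⟨
  a (2 ℕ.+ n) ℤ.* b 0 ℤ.+ (a ⊛ tail b) (suc n) ∎
  where
  open ≡-Reasoning
  swap : ∀ x y z → x ℤ.+ (y ℤ.+ z) ≡ y ℤ.+ (x ℤ.+ z)
  swap = solve-∀

⊛-comm : ∀ a b → a ⊛ b ≗ b ⊛ a
⊛-comm a b zero    = ℤₚ.*-comm (a 0) (b 0)
⊛-comm a b (suc n) = begin
  (a ⊛ b) (suc n)                             ≡⟨ ⊛-suc a b n ⟩
  a 0 ℤ.* b (suc n) ℤ.+ (tail a ⊛ b) n
    ≡⟨ cong₂ ℤ._+_ (ℤₚ.*-comm (a 0) (b (suc n))) (⊛-comm (tail a) b n) ⟩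
  b (suc n) ℤ.* a 0 ℤ.+ (b ⊛ tail a) n        ≡⟨ ⊛-suc′ b a n ⟨
  (b ⊛ a) (suc n)                             ∎
  where open ≡-Reasoning

⊛-congʳ : ∀ {a b} c → a ≗ b → a ⊛ c ≗ b ⊛ c
⊛-congʳ c h n = sumTo-cong n (λ i → cong (ℤ._* c (n ℕ.∸ i)) (h i))

⊛-distribʳ : ∀ c a b → (a ⊞ b) ⊛ c ≗ (a ⊛ c) ⊞ (b ⊛ c)
⊛-distribʳ c a b zero    = ℤₚ.*-distribʳ-+ (c 0) (a 0) (b 0)
⊛-distribʳ c a b (suc n) = begin
  ((a ⊞ b) ⊛ c) (suc n)
    ≡⟨ ⊛-suc (a ⊞ b) c n ⟩
  (a 0 ℤ.+ b 0) ℤ.* c (suc n) ℤ.+ ((tail a ⊞ tail b) ⊛ c) n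
    ≡⟨ cong (λ z → (a 0 ℤ.+ b 0) ℤ.* c (suc n) ℤ.+ z) (⊛-distribʳ c (tail a) (tail b) n) ⟩
  (a 0 ℤ.+ b 0) ℤ.* c (suc n) ℤ.+ ((tail a ⊛ c) n ℤ.+ (tail b ⊛ c) n)
    ≡⟨ rearrange (a 0) (b 0) (c (suc n)) _ _ ⟩
  (a 0 ℤ.* c (suc n) ℤ.+ (tail a ⊛ c) n) ℤ.+ (b 0 ℤ.* c (suc n) ℤ.+ (tail b ⊛ c) n)
    ≡⟨ cong₂ ℤ._+_ (⊛-suc a c n) (⊛-suc b c n) ⟨
  ((a ⊛ c) ⊞ (b ⊛ c)) (suc n) ∎
  where
  open ≡-Reasoning
  rearrange : ∀ x y z u v →
    (x ℤ.+ y) ℤ.* z ℤ.+ (u ℤ.+ v) ≡ (x ℤ.* z ℤ.+ u) ℤ.+ (y ℤ.* z ℤ.+ v)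
  rearrange = solve-∀

⊛-scaleˡ : ∀ k a b → scale k a ⊛ b ≗ scale k (a ⊛ b)
⊛-scaleˡ k a b zero    = ℤₚ.*-assoc k (a 0) (b 0)
⊛-scaleˡ k a b (suc n) = begin
  (scale k a ⊛ b) (suc n)
    ≡⟨ ⊛-suc (scale k a) b n ⟩
  k ℤ.* a 0 ℤ.* b (suc n) ℤ.+ (scale k (tail a) ⊛ b) n
    ≡⟨ cong (λ z → k ℤ.* a 0 ℤ.* b (suc n) ℤ.+ z) (⊛-scaleˡ k (tail a) b n) ⟩
  k ℤ.* a 0 ℤ.* b (suc n) ℤ.+ k ℤ.* (tail a ⊛ b) n
    ≡⟨ factor k (a 0) (b (suc n)) _ ⟩
  k ℤ.* (a 0 ℤ.* b (suc n) ℤ.+ (tail a ⊛ b) n)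
    ≡⟨ cong (k ℤ.*_) (⊛-suc a b n) ⟨
  k ℤ.* (a ⊛ b) (suc n) ∎
  where
  open ≡-Reasoning
  factor : ∀ k x y z → k ℤ.* x ℤ.* y ℤ.+ k ℤ.* z ≡ k ℤ.* (x ℤ.* y ℤ.+ z)
  factor = solve-∀

⊛-assoc : ∀ a b c → (a ⊛ b) ⊛ c ≗ a ⊛ (b ⊛ c)
⊛-assoc a b c zero    = ℤₚ.*-assoc (a 0) (b 0) (c 0)
⊛-assoc a b c (suc n) = begin
  ((a ⊛ b) ⊛ c) (suc n)
    ≡⟨ ⊛-suc (a ⊛ b) c n ⟩
  a 0 ℤ.* b 0 ℤ.* c (suc n) ℤ.+ (tail (a ⊛ b) ⊛ c) n
    ≡⟨ cong (λ z → a 0 ℤ.* b 0 ℤ.* c (suc n) ℤ.+ z) (begin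
         (tail (a ⊛ b) ⊛ c) n
           ≡⟨ ⊛-congʳ c (⊛-suc a b) n ⟩
         ((scale (a 0) (tail b) ⊞ (tail a ⊛ b)) ⊛ c) n
           ≡⟨ ⊛-distribʳ c (scale (a 0) (tail b)) (tail a ⊛ b) n ⟩
         (scale (a 0) (tail b) ⊛ c) n ℤ.+ ((tail a ⊛ b) ⊛ c) n
           ≡⟨ cong₂ ℤ._+_ (⊛-scaleˡ (a 0) (tail b) c n) (⊛-assoc (tail a) b c n) ⟩
         a 0 ℤ.* (tail b ⊛ c) n ℤ.+ (tail a ⊛ (b ⊛ c)) n ∎) ⟩
  a 0 ℤ.* b 0 ℤ.* c (suc n) ℤ.+ (a 0 ℤ.* (tail b ⊛ c) n ℤ.+ (tail a ⊛ (b ⊛ c)) n)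
    ≡⟨ regroup (a 0) (b 0) (c (suc n)) _ _ ⟩
  a 0 ℤ.* (b 0 ℤ.* c (suc n) ℤ.+ (tail b ⊛ c) n) ℤ.+ (tail a ⊛ (b ⊛ c)) n
    ≡⟨ cong (λ z → a 0 ℤ.* z ℤ.+ (tail a ⊛ (b ⊛ c)) n) (⊛-suc b c n) ⟨
  a 0 ℤ.* (b ⊛ c) (suc n) ℤ.+ (tail a ⊛ (b ⊛ c)) n
    ≡⟨ ⊛-suc a (b ⊛ c) n ⟨
  (a ⊛ (b ⊛ c)) (suc n) ∎
  where
  open ≡-Reasoning
  regroup : ∀ x y z u v →
    x ℤ.* y ℤ.* z ℤ.+ (x ℤ.* u ℤ.+ v) ≡ x ℤ.* (y ℤ.* z ℤ.+ u) ℤ.+ v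
  regroup = solve-∀

const-0 : ∀ n → const (+ 0) n ≡ + 0
const-0 zero    = refl
const-0 (suc _) = refl

0⊛ : ∀ {z} a → z ≗ const (+ 0) → z ⊛ a ≗ const (+ 0)
0⊛ a h zero    = trans (cong (ℤ._* a 0) (h 0)) (ℤₚ.*-zeroˡ (a 0))
0⊛ {z} a h (suc n) = begin
  (z ⊛ a) (suc n)                         ≡⟨ ⊛-suc z a n ⟩
  z 0 ℤ.* a (suc n) ℤ.+ (tail z ⊛ a) n
    ≡⟨ cong₂ (λ u v → u ℤ.* a (suc n) ℤ.+ v) (h 0)
         (0⊛ {tail z} a (λ m → trans (h (suc m)) (sym (const-0 m))) n) ⟩
  + 0 ℤ.* a (suc n) ℤ.+ const (+ 0) n
    ≡⟨ cong₂ ℤ._+_ (ℤₚ.*-zeroˡ (a (suc n))) (const-0 n) ⟩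
  + 0 ∎
  where
  open ≡-Reasoning

const-⊛ : ∀ c a → const c ⊛ a ≗ scale c a
const-⊛ c a zero    = refl
const-⊛ c a (suc n) = begin
  (const c ⊛ a) (suc n)                        ≡⟨ ⊛-suc (const c) a n ⟩
  c ℤ.* a (suc n) ℤ.+ (tail (const c) ⊛ a) n
    ≡⟨ cong (λ z → c ℤ.* a (suc n) ℤ.+ z) (0⊛ {tail (const c)} a (λ { zero → refl ; (suc _) → refl }) n) ⟩
  c ℤ.* a (suc n) ℤ.+ const (+ 0) n
    ≡⟨ cong (λ z → c ℤ.* a (suc n) ℤ.+ z) (const-0 n) ⟩
  c ℤ.* a (suc n) ℤ.+ + 0                      ≡⟨ ℤₚ.+-identityʳ _ ⟩
  c ℤ.* a (suc n) ∎
  where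
  open ≡-Reasoning

oneS≗const : oneS ≗ const (+ 1)
oneS≗const zero    = refl
oneS≗const (suc _) = refl

1⊛ : ∀ a → const (+ 1) ⊛ a ≗ a
1⊛ a n = trans (const-⊛ (+ 1) a n) (ℤₚ.*-identityˡ (a n))

-- Congruence modulo 32 and q^(N+1)

infix 4 _≡₃₂_
_≡₃₂_ : ℤ → ℤ → Set
x ≡₃₂ y = + 32 ℤS.∣ x ℤ.- y

≡₃₂-reflexive : ∀ {x y} → x ≡ y → x ≡₃₂ y
≡₃₂-reflexive {x} refl = divides (+ 0) (ℤₚ.+-inverseʳ x)

≡₃₂-sym : ∀ {x y} → x ≡₃₂ y → y ≡₃₂ x
≡₃₂-sym {x} {y} (divides k h) = divides (ℤ.- k) (begin
  y ℤ.- x             ≡⟨ flip x y ⟩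
  ℤ.- (x ℤ.- y)       ≡⟨ cong ℤ.-_ h ⟩
  ℤ.- (k ℤ.* + 32)    ≡⟨ ℤₚ.neg-distribˡ-* k (+ 32) ⟩
  ℤ.- k ℤ.* + 32      ∎)
  where
  open ≡-Reasoning
  flip : ∀ x y → y ℤ.- x ≡ ℤ.- (x ℤ.- y)
  flip = solve-∀

≡₃₂-trans : ∀ {x y z} → x ≡₃₂ y → y ≡₃₂ z → x ≡₃₂ z
≡₃₂-trans {x} {y} {z} p q =
  subst (+ 32 ℤS.∣_) (telescope x y z) (ℤS.∣m∣n⇒∣m+n p q)
  where
  telescope : ∀ x y z → (x ℤ.- y) ℤ.+ (y ℤ.- z) ≡ x ℤ.- z
  telescope = solve-∀

≡₃₂-+ : ∀ {x x′ y y′} → x ≡₃₂ x′ → y ≡₃₂ y′ → x ℤ.+ y ≡₃₂ x′ ℤ.+ y′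
≡₃₂-+ {x} {x′} {y} {y′} p q =
  subst (+ 32 ℤS.∣_) (regroup x x′ y y′) (ℤS.∣m∣n⇒∣m+n p q)
  where
  regroup : ∀ x x′ y y′ → (x ℤ.- x′) ℤ.+ (y ℤ.- y′) ≡ (x ℤ.+ y) ℤ.- (x′ ℤ.+ y′)
  regroup = solve-∀

≡₃₂-* : ∀ {x x′ y y′} → x ≡₃₂ x′ → y ≡₃₂ y′ → x ℤ.* y ≡₃₂ x′ ℤ.* y′
≡₃₂-* {x} {x′} {y} {y′} p q =
  subst (+ 32 ℤS.∣_) (regroup x x′ y y′)
    (ℤS.∣m∣n⇒∣m+n (ℤS.∣m⇒∣m*n y p) (ℤS.∣n⇒∣m*n x′ q))
  where
  regroup : ∀ x x′ y y′ →
    (x ℤ.- x′) ℤ.* y ℤ.+ x′ ℤ.* (y ℤ.- y′) ≡ x ℤ.* y ℤ.- x′ ℤ.* y′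
  regroup = solve-∀

≡₃₂-neg : ∀ {x y} → x ≡₃₂ y → ℤ.- x ≡₃₂ ℤ.- y
≡₃₂-neg {x} {y} p = subst (+ 32 ℤS.∣_) (flip x y) (≡₃₂-sym {x} {y} p)
  where
  flip : ∀ x y → y ℤ.- x ≡ (ℤ.- x) ℤ.- (ℤ.- y)
  flip = solve-∀

sumTo-≡₃₂ : ∀ n {f g} → (∀ i → i ℕ.≤ n → f i ≡₃₂ g i) → sumTo n f ≡₃₂ sumTo n g
sumTo-≡₃₂ zero    h = h 0 z≤n
sumTo-≡₃₂ (suc n) {f} {g} h = ≡₃₂-+ {sumTo n f} {sumTo n g}
  (sumTo-≡₃₂ n (λ i i≤n → h i (ℕₚ.m≤n⇒m≤1+n i≤n))) (h (suc n) ℕₚ.≤-refl)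

-- The ring operations are opaque so that conversion checking never unfolds Cauchy products.

infixl 6 _⊕_ _⊖_
infixl 7 _⊙_
infix 8 ⊝_

opaque
  _⊕_ _⊙_ : Series → Series → Series
  _⊕_ = _⊞_
  _⊙_ = _⊛_

  ⊝_ : Series → Series
  ⊝_ = ⊟_

_⊖_ : Series → Series → Series
a ⊖ b = a ⊕ ⊝ b

opaque
  unfolding _⊕_ _⊙_ ⊝_

  ⊕-def : ∀ a b → a ⊕ b ≗ a ⊞ b
  ⊕-def a b n = refl

  ⊙-def : ∀ a b → a ⊙ b ≗ a ⊛ b
  ⊙-def a b n = refl

  ⊝-def : ∀ a → ⊝ a ≗ ⊟ a
  ⊝-def a n = refl

  ⊕-assoc : ∀ a b c → (a ⊕ b) ⊕ c ≗ a ⊕ (b ⊕ c)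
  ⊕-assoc a b c n = ℤₚ.+-assoc (a n) (b n) (c n)

  ⊕-comm : ∀ a b → a ⊕ b ≗ b ⊕ a
  ⊕-comm a b n = ℤₚ.+-comm (a n) (b n)

  ⊕-identityˡ : ∀ a → const (+ 0) ⊕ a ≗ a
  ⊕-identityˡ a zero    = ℤₚ.+-identityˡ (a 0)
  ⊕-identityˡ a (suc n) = ℤₚ.+-identityˡ (a (suc n))

  ⊝-inverseˡ : ∀ a → ⊝ a ⊕ a ≗ const (+ 0)
  ⊝-inverseˡ a zero    = ℤₚ.+-inverseˡ (a 0)
  ⊝-inverseˡ a (suc n) = ℤₚ.+-inverseˡ (a (suc n))

  ⊙-assoc : ∀ a b c → (a ⊙ b) ⊙ c ≗ a ⊙ (b ⊙ c)
  ⊙-assoc = ⊛-assoc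

  ⊙-comm : ∀ a b → a ⊙ b ≗ b ⊙ a
  ⊙-comm = ⊛-comm

  ⊙-identityˡ : ∀ a → const (+ 1) ⊙ a ≗ a
  ⊙-identityˡ = 1⊛

  ⊙-distribʳ-⊕ : ∀ c a b → (a ⊕ b) ⊙ c ≗ (a ⊙ c) ⊕ (b ⊙ c)
  ⊙-distribʳ-⊕ = ⊛-distribʳ

  const-⊕ : ∀ x y → const (x ℤ.+ y) ≗ const x ⊕ const y
  const-⊕ x y zero    = refl
  const-⊕ x y (suc _) = refl

  const-⊙ : ∀ x y → const (x ℤ.* y) ≗ const x ⊙ const y
  const-⊙ x y zero    = refl
  const-⊙ x y (suc n) = sym (trans (const-⊛ x (const y) (suc n)) (ℤₚ.*-zeroʳ x))

  const-⊝ : ∀ x → const (ℤ.- x) ≗ ⊝ const x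
  const-⊝ x zero    = refl
  const-⊝ x (suc _) = refl

module Truncated (N : ℕ) where

  infix 4 _≈_
  -- A record rather than a bare function type, so that unification can read both series off the
  -- type of a proof.
  record _≈_ (a b : Series) : Set where
    constructor mk
    field coeff : ∀ n → n ℕ.≤ N → a n ≡₃₂ b n
  open _≈_ public

  ≗⇒≈ : ∀ {a b} → a ≗ b → a ≈ b
  ≗⇒≈ h = mk λ n _ → ≡₃₂-reflexive (h n)

  opaque
    unfolding _⊕_ _⊙_ ⊝_

    ⊕-cong : ∀ {a a′ b b′} → a ≈ a′ → b ≈ b′ → a ⊕ b ≈ a′ ⊕ b′
    ⊕-cong {a} {a′} {b} {b′} p q =
      mk λ n n≤N → ≡₃₂-+ {a n} {a′ n} {b n} {b′ n} (coeff p n n≤N) (coeff q n n≤N)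

    ⊝-cong : ∀ {a b} → a ≈ b → ⊝ a ≈ ⊝ b
    ⊝-cong {a} {b} p = mk λ n n≤N → ≡₃₂-neg {a n} {b n} (coeff p n n≤N)

    ⊙-cong : ∀ {a a′ b b′} → a ≈ a′ → b ≈ b′ → a ⊙ b ≈ a′ ⊙ b′
    ⊙-cong {a} {a′} {b} {b′} p q = mk λ n n≤N → sumTo-≡₃₂ n λ i i≤n →
      ≡₃₂-* {a i} {a′ i} {b (n ℕ.∸ i)} {b′ (n ℕ.∸ i)}
        (coeff p i (ℕₚ.≤-trans i≤n n≤N))
        (coeff q (n ℕ.∸ i) (ℕₚ.≤-trans (ℕₚ.m∸n≤m n i) n≤N))

  ≈-refl : ∀ {a} → a ≈ a
  ≈-refl = ≗⇒≈ λ _ → refl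

  ≈-sym : ∀ {a b} → a ≈ b → b ≈ a
  ≈-sym {a} {b} p = mk λ n n≤N → ≡₃₂-sym {a n} {b n} (coeff p n n≤N)

  ≈-trans : ∀ {a b c} → a ≈ b → b ≈ c → a ≈ c
  ≈-trans {a} {b} {c} p q = mk λ n n≤N →
    ≡₃₂-trans {a n} {b n} {c n} (coeff p n n≤N) (coeff q n n≤N)

  seriesRing : CommutativeRing 0ℓ 0ℓ
  seriesRing = record
    { Carrier = Series
    ; _≈_ = _≈_
    ; _+_ = _⊕_
    ; _*_ = _⊙_
    ; -_ = ⊝_
    ; 0# = const (+ 0)
    ; 1# = const (+ 1)
    ; isCommutativeRing = record
      { isRing = record
        { +-isAbelianGroup = record
          { isGroup = record
            { isMonoid = record
              { isSemigroup = record
                { isMagma = record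
                  { isEquivalence = record { refl = ≈-refl ; sym = ≈-sym ; trans = ≈-trans }
                  ; ∙-cong = ⊕-cong
                  }
                ; assoc = λ a b c → ≗⇒≈ (⊕-assoc a b c)
                }
              ; identity = (λ a → ≗⇒≈ (⊕-identityˡ a)) ,
                  λ a → ≈-trans (≗⇒≈ (⊕-comm a (const (+ 0)))) (≗⇒≈ (⊕-identityˡ a))
              }
            ; inverse = (λ a → ≗⇒≈ (⊝-inverseˡ a)) ,
                λ a → ≈-trans (≗⇒≈ (⊕-comm a (⊝ a))) (≗⇒≈ (⊝-inverseˡ a))
            ; ⁻¹-cong = ⊝-cong
            }
          ; comm = λ a b → ≗⇒≈ (⊕-comm a b)
          }
        ; *-cong = ⊙-cong
        ; *-assoc = λ a b c → ≗⇒≈ (⊙-assoc a b c)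
        ; *-identity = (λ a → ≗⇒≈ (⊙-identityˡ a)) ,
            λ a → ≈-trans (≗⇒≈ (⊙-comm a (const (+ 1)))) (≗⇒≈ (⊙-identityˡ a))
        ; distrib =
            (λ c a b → ≈-trans (≗⇒≈ (⊙-comm c (a ⊕ b)))
              (≈-trans (≗⇒≈ (⊙-distribʳ-⊕ c a b))
                (⊕-cong (≗⇒≈ (⊙-comm a c)) (≗⇒≈ (⊙-comm b c))))) ,
            λ c a b → ≗⇒≈ (⊙-distribʳ-⊕ c a b)
        }
      ; *-comm = λ a b → ≗⇒≈ (⊙-comm a b)
      }
    }

  private
    ℤ-raw : RawRing 0ℓ 0ℓ
    ℤ-raw = CommutativeRing.rawRing ℤₚ.+-*-commutativeRing

    constHom : ℤ-raw -Raw-AlmostCommutative⟶ fromCommutativeRing seriesRing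
    constHom = record
      { ⟦_⟧ = const
      ; +-homo = λ x y → ≗⇒≈ (const-⊕ x y)
      ; *-homo = λ x y → ≗⇒≈ (const-⊙ x y)
      ; -‿homo = λ x → ≗⇒≈ (const-⊝ x)
      ; 0-homo = ≈-refl
      ; 1-homo = ≈-refl
      }

    const-≟ : ∀ x y → Maybe (const x ≈ const y)
    const-≟ x y with x ℤ.≟ y
    ... | yes refl = just ≈-refl
    ... | no  _    = nothing

  module Solver = RingSolver ℤ-raw (fromCommutativeRing seriesRing) constHom const-≟

  open CommutativeRing seriesRing using (zeroˡ; +-identityʳ)

  -- The solver compares coefficients as integers. An identity valid only modulo 32 is therefore
  -- brought to the shape a + 32b by the solver and finished here.
  ⊕-32⊙ : ∀ a b → a ⊕ const (+ 32) ⊙ b ≈ a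
  ⊕-32⊙ a b = ≈-trans (⊕-cong ≈-refl (≈-trans (⊙-cong 32≈0 ≈-refl) (zeroˡ b))) (+-identityʳ a)
    where
    32≈0 : const (+ 32) ≈ const (+ 0)
    32≈0 = mk λ { zero _ → divides (+ 1) refl ; (suc _) _ → ≡₃₂-reflexive {+ 0} refl }

-- Theta series and Gauss' identity

-- Descending from `n` to 1, so that a sum over `range (suc n)` unfolds to its newest term plus the
-- sum over `range n`.
range : ℕ → List ℕ
range = applyDownFrom suc

∑ : ∀ {a} {A : Set a} → List A → (A → Series) → Series
∑ []      f = const (+ 0)
∑ (x ∷ L) f = f x ⊕ ∑ L f

𝟙 𝟚 : Series
𝟙 = const (+ 1)
𝟚 = const (+ 2)

module Theta (N : ℕ) where
  open Truncated N
  open CommutativeRing seriesRing using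
    (reflexive; setoid; commutativeSemiring; *-identityˡ; *-identityʳ)
  open Exp commutativeSemiring renaming (_^_ to _↑_)
  open SetoidReasoning setoid
  open Solver

  ⊙-congˡ : ∀ a {b c} → b ≈ c → a ⊙ b ≈ a ⊙ c
  ⊙-congˡ a = ⊙-cong (≈-refl {a})

  ⊙-congʳ : ∀ a {b c} → b ≈ c → b ⊙ a ≈ c ⊙ a
  ⊙-congʳ a h = ⊙-cong h (≈-refl {a})

  1↑ : ∀ n → 𝟙 ↑ n ≈ 𝟙
  1↑ zero    = ≈-refl
  1↑ (suc n) = ≈-trans (*-identityˡ _) (1↑ n)

  ⊝1↑ : ∀ n → (⊝ 𝟙) ↑ n ≈ 𝟙 ⊎ (⊝ 𝟙) ↑ n ≈ ⊝ 𝟙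
  ⊝1↑ zero = inj₁ ≈-refl
  ⊝1↑ (suc n) with ⊝1↑ n
  ... | inj₁ h = inj₂ (≈-trans (⊙-congˡ (⊝ 𝟙) h) (*-identityʳ _))
  ... | inj₂ h = inj₁ (≈-trans (⊙-congˡ (⊝ 𝟙) h)
                   (solve 0 ((:- con (+ 1)) :* (:- con (+ 1)) := con (+ 1)) ≈-refl))

  ⊝1↑n↑n : ∀ n → ((⊝ 𝟙) ↑ n) ↑ n ≈ (⊝ 𝟙) ↑ n
  ⊝1↑n↑n n with ⊝1↑ n
  ... | inj₁ h = ≈-trans (^-congˡ n h) (≈-trans (1↑ n) (≈-sym h))
  ... | inj₂ h = ^-congˡ n h

  ⊝↑ : ∀ x n → (⊝ x) ↑ n ≈ (⊝ 𝟙) ↑ n ⊙ x ↑ n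
  ⊝↑ x n = ≈-trans (^-congˡ n (solve 1 (λ x → :- x := (:- con (+ 1)) :* x) ≈-refl x))
                 (^-distrib-* (⊝ 𝟙) x n)

  -- n² and n have the same parity, so the sign (-1)^n may be read as (-1)^(n²). In `H≈Dθ` this
  -- turns the top power of u = -x^n into a term of the theta sum.
  ⊝↑-square : ∀ x n → (⊝ (x ↑ n)) ↑ n ≈ (⊝ x) ↑ (n ℕ.* n)
  ⊝↑-square x n = begin
    (⊝ (x ↑ n)) ↑ n                    ≈⟨ ⊝↑ (x ↑ n) n ⟩
    (⊝ 𝟙) ↑ n ⊙ (x ↑ n) ↑ n           ≈⟨ ⊙-congʳ ((x ↑ n) ↑ n) (⊝1↑n↑n n) ⟨
    ((⊝ 𝟙) ↑ n) ↑ n ⊙ (x ↑ n) ↑ n     ≈⟨ ^-distrib-* _ _ n ⟨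
    ((⊝ 𝟙) ↑ n ⊙ x ↑ n) ↑ n           ≈⟨ ^-congˡ n (⊝↑ x n) ⟨
    ((⊝ x) ↑ n) ↑ n                    ≈⟨ ^-assocʳ (⊝ x) n n ⟩
    (⊝ x) ↑ (n ℕ.* n)                  ∎

  θ : ℕ → Series → Series
  θ n y = 𝟙 ⊕ 𝟚 ⊙ ∑ (range n) (λ s → y ↑ (s ℕ.* s))

  E : Series → ℕ → Series
  E x zero    = 𝟙
  E x (suc n) = (𝟙 ⊖ x ↑ suc n) ⊙ E x n

  D : Series → ℕ → Series
  D x zero    = 𝟙
  D x (suc n) = (𝟙 ⊕ x ↑ suc n) ⊙ D x n

  -- H x u n = Σ_{s≤n} C x s · ∏_{s<i≤n} (1 - x^i) · u^s. Its value at u = -x^(n+1) is the finite form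
  -- of Gauss' identity: only s = 0 survives modulo x^(n+1).
  C : Series → ℕ → Series
  C x zero    = 𝟙
  C x (suc n) = (𝟙 ⊕ x ↑ n) ⊙ C x n

  C≈2D : ∀ x n → C x (suc n) ≈ 𝟚 ⊙ D x n
  C≈2D x zero    = solve 0
    ((con (+ 1) :+ con (+ 1)) :* con (+ 1) := con (+ 2) :* con (+ 1)) ≈-refl
  C≈2D x (suc n) = ≈-trans (⊙-congˡ (𝟙 ⊕ x ↑ suc n) (C≈2D x n))
    (solve 2 (λ X d → (con (+ 1) :+ X) :* (con (+ 2) :* d)
                    := con (+ 2) :* ((con (+ 1) :+ X) :* d)) ≈-refl (x ↑ suc n) (D x n))

  H : Series → Series → ℕ → Series
  H x u zero    = 𝟙
  H x u (suc k) = (𝟙 ⊖ x ↑ suc k) ⊙ H x u k ⊕ C x (suc k) ⊙ u ↑ suc k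

  H-cong : ∀ x {u v} → u ≈ v → ∀ k → H x u k ≈ H x v k
  H-cong x h zero    = ≈-refl
  H-cong x h (suc k) =
    ⊕-cong (⊙-congˡ (𝟙 ⊖ x ↑ suc k) (H-cong x h k)) (⊙-congˡ (C x (suc k)) (^-congˡ (suc k) h))

  -- Telescoping in s, with u kept free so that the induction on k goes through.
  H-shift : ∀ x u k →
    (𝟙 ⊕ u) ⊙ H x (u ⊙ x) k ≈ (𝟙 ⊖ u) ⊙ H x u k ⊕ C x (suc k) ⊙ u ↑ suc k
  H-shift x u zero = solve 1
    (λ u → (con (+ 1) :+ u) :* con (+ 1) :=
       (con (+ 1) :- u) :* con (+ 1) :+ ((con (+ 1) :+ con (+ 1)) :* con (+ 1)) :* (u :* con (+ 1)))
    ≈-refl u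
  H-shift x u (suc k) = begin
    (𝟙 ⊕ u) ⊙ ((𝟙 ⊖ X) ⊙ h′ ⊕ c ⊙ (u ⊙ x) ↑ suc k)
      ≈⟨ ⊙-congˡ (𝟙 ⊕ u) (⊕-cong (≈-refl {(𝟙 ⊖ X) ⊙ h′}) (⊙-congˡ c (^-distrib-* u x (suc k)))) ⟩
    (𝟙 ⊕ u) ⊙ ((𝟙 ⊖ X) ⊙ h′ ⊕ c ⊙ (U ⊙ X))
      ≈⟨ solve 5 (λ u X h′ c U →
           (con (+ 1) :+ u) :* ((con (+ 1) :- X) :* h′ :+ c :* (U :* X)) :=
           (con (+ 1) :- X) :* ((con (+ 1) :+ u) :* h′) :+ (con (+ 1) :+ u) :* (c :* (U :* X)))
         ≈-refl u X h′ c U ⟩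
    (𝟙 ⊖ X) ⊙ ((𝟙 ⊕ u) ⊙ h′) ⊕ (𝟙 ⊕ u) ⊙ (c ⊙ (U ⊙ X))
      ≈⟨ ⊕-cong (⊙-congˡ (𝟙 ⊖ X) (H-shift x u k)) (≈-refl {(𝟙 ⊕ u) ⊙ (c ⊙ (U ⊙ X))}) ⟩
    (𝟙 ⊖ X) ⊙ ((𝟙 ⊖ u) ⊙ h ⊕ c ⊙ U) ⊕ (𝟙 ⊕ u) ⊙ (c ⊙ (U ⊙ X))
      ≈⟨ solve 5 (λ u X h c U →
           (con (+ 1) :- X) :* ((con (+ 1) :- u) :* h :+ c :* U) :+ (con (+ 1) :+ u) :* (c :* (U :* X)) :=
           (con (+ 1) :- u) :* ((con (+ 1) :- X) :* h :+ c :* U) :+ ((con (+ 1) :+ X) :* c) :* (u :* U))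
         ≈-refl u X h c U ⟩
    (𝟙 ⊖ u) ⊙ ((𝟙 ⊖ X) ⊙ h ⊕ c ⊙ U) ⊕ ((𝟙 ⊕ X) ⊙ c) ⊙ (u ⊙ U) ∎
    where
    X U c h h′ : Series
    X = x ↑ suc k
    U = u ↑ suc k
    c = C x (suc k)
    h = H x u k
    h′ = H x (u ⊙ x) k

  -- In the induction step the outer factor 1 - x^(n+1) is 1 + u for u = -x^(n+1), which is what
  -- `H-shift` needs to bring the argument ux back to u. The two boundary terms add up to the new
  -- theta term because `C x (suc n)` is twice `D x n`.
  H≈Dθ : ∀ x n → H x (⊝ (x ↑ suc n)) n ≈ D x n ⊙ θ n (⊝ x)
  H≈Dθ x zero = solve 0
    (con (+ 1) := con (+ 1) :* (con (+ 1) :+ con (+ 2) :* con (+ 0))) ≈-refl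
  H≈Dθ x (suc n) = begin
    (𝟙 ⊖ X) ⊙ H x (⊝ (x ⊙ X)) n ⊕ c ⊙ (⊝ (x ⊙ X)) ↑ suc n
      ≈⟨ ⊕-cong (⊙-congˡ (𝟙 ⊖ X) (H-cong x v≈ n))
                (⊙-congˡ c (≈-trans (^-congˡ (suc n) v≈) (^-distrib-* u x (suc n)))) ⟩
    (𝟙 ⊕ u) ⊙ H x (u ⊙ x) n ⊕ c ⊙ (U ⊙ X)
      ≈⟨ ⊕-cong (H-shift x u n) (≈-refl {c ⊙ (U ⊙ X)}) ⟩
    ((𝟙 ⊖ u) ⊙ H x u n ⊕ c ⊙ U) ⊕ c ⊙ (U ⊙ X)
      ≈⟨ ⊕-cong (⊕-cong (⊙-congˡ (𝟙 ⊖ u) (H≈Dθ x n)) (⊙-cong (C≈2D x n) (⊝↑-square x (suc n))))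
                (⊙-cong (C≈2D x n) (⊙-congʳ X (⊝↑-square x (suc n)))) ⟩
    ((𝟙 ⊖ u) ⊙ (d ⊙ (𝟙 ⊕ 𝟚 ⊙ S)) ⊕ (𝟚 ⊙ d) ⊙ Q) ⊕ (𝟚 ⊙ d) ⊙ (Q ⊙ X)
      ≈⟨ solve 4 (λ X d S Q →
           ((con (+ 1) :- (:- X)) :* (d :* (con (+ 1) :+ con (+ 2) :* S)) :+ (con (+ 2) :* d) :* Q)
             :+ (con (+ 2) :* d) :* (Q :* X) :=
           ((con (+ 1) :+ X) :* d) :* (con (+ 1) :+ con (+ 2) :* (Q :+ S)))
         ≈-refl X d S Q ⟩
    ((𝟙 ⊕ X) ⊙ d) ⊙ (𝟙 ⊕ 𝟚 ⊙ (Q ⊕ S)) ∎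
    where
    X u U c d S Q : Series
    X = x ↑ suc n
    u = ⊝ X
    U = u ↑ suc n
    c = C x (suc n)
    d = D x n
    S = ∑ (range n) (λ s → (⊝ x) ↑ (s ℕ.* s))
    Q = (⊝ x) ↑ (suc n ℕ.* suc n)
    v≈ : ⊝ (x ⊙ X) ≈ u ⊙ x
    v≈ = solve 2 (λ x X → :- (x :* X) := (:- X) :* x) ≈-refl x X

  H₀≈E : ∀ x k → H x (const (+ 0)) k ≈ E x k
  H₀≈E x zero    = ≈-refl
  H₀≈E x (suc k) = ≈-trans
    (⊕-cong (⊙-congˡ (𝟙 ⊖ x ↑ suc k) (H₀≈E x k)) (≈-refl {C x (suc k) ⊙ const (+ 0) ↑ suc k}))
    (solve 3 (λ a c z → a :+ c :* (con (+ 0) :* z) := a) ≈-refl _ (C x (suc k)) (const (+ 0) ↑ k))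

  -- Plays the part of "no constant term": x is nilpotent of order N + 1. Phrased through powers, it
  -- passes directly to -x and to multiples of x.
  record Small (x : Series) : Set where
    constructor mkSmall
    field vanish : ∀ k → x ↑ (suc N ℕ.+ k) ≈ const (+ 0)
  open Small public

  -- This is φ(-x) = ∏ (1 - xⁱ)/(1 + xⁱ) with the denominator cleared. The length is `N + k` rather
  -- than N because the dissection modulo 3 will ask for theta sums of length 3N.
  gauss : ∀ {x} → Small x → ∀ k → E x (N ℕ.+ k) ≈ D x (N ℕ.+ k) ⊙ θ (N ℕ.+ k) (⊝ x)
  gauss {x} small k = begin
    E x (N ℕ.+ k)                               ≈⟨ H₀≈E x (N ℕ.+ k) ⟨
    H x (const (+ 0)) (N ℕ.+ k)                 ≈⟨ H-cong x u≈0 (N ℕ.+ k) ⟨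
    H x (⊝ (x ↑ suc (N ℕ.+ k))) (N ℕ.+ k)       ≈⟨ H≈Dθ x (N ℕ.+ k) ⟩
    D x (N ℕ.+ k) ⊙ θ (N ℕ.+ k) (⊝ x)           ∎
    where
    u≈0 : ⊝ (x ↑ suc (N ℕ.+ k)) ≈ const (+ 0)
    u≈0 = ≈-trans (⊝-cong (vanish small k)) (solve 0 (:- con (+ 0) := con (+ 0)) ≈-refl)

  E-stable : ∀ {x} → Small x → ∀ k → E x (N ℕ.+ k) ≈ E x N
  E-stable {x} small zero    = reflexive (cong (E x) (ℕₚ.+-identityʳ N))
  E-stable {x} small (suc k) = begin
    E x (N ℕ.+ suc k)                          ≡⟨ cong (E x) (ℕₚ.+-suc N k) ⟩
    (𝟙 ⊖ x ↑ suc (N ℕ.+ k)) ⊙ E x (N ℕ.+ k)    ≈⟨ ⊙-cong (⊕-cong (≈-refl {𝟙}) (⊝-cong (vanish small k))) (E-stable small k) ⟩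
    (𝟙 ⊖ const (+ 0)) ⊙ E x N                  ≈⟨ solve 1 (λ e → (con (+ 1) :- con (+ 0)) :* e := e) ≈-refl (E x N) ⟩
    E x N                                      ∎

  E⊙D : ∀ x n → E x n ⊙ D x n ≈ E (x ⊙ x) n
  E⊙D x zero    = *-identityˡ 𝟙
  E⊙D x (suc n) = begin
    ((𝟙 ⊖ X) ⊙ E x n) ⊙ ((𝟙 ⊕ X) ⊙ D x n)
      ≈⟨ solve 3 (λ X e d → ((con (+ 1) :- X) :* e) :* ((con (+ 1) :+ X) :* d) :=
                   (con (+ 1) :- X :* X) :* (e :* d)) ≈-refl X (E x n) (D x n) ⟩
    (𝟙 ⊖ X ⊙ X) ⊙ (E x n ⊙ D x n)
      ≈⟨ ⊙-cong (⊕-cong (≈-refl {𝟙}) (⊝-cong (≈-sym (^-distrib-* x x (suc n))))) (E⊙D x n) ⟩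
    (𝟙 ⊖ (x ⊙ x) ↑ suc n) ⊙ E (x ⊙ x) n ∎
    where
    X : Series
    X = x ↑ suc n

  -- O x n = ∏_{j<n} (1 - x^(2j+1))
  O : Series → ℕ → Series
  O x zero    = 𝟙
  O x (suc n) = (𝟙 ⊖ x ↑ suc (2 ℕ.* n)) ⊙ O x n

  E-even-odd : ∀ x n → E x (2 ℕ.* n) ≈ E (x ⊙ x) n ⊙ O x n
  E-even-odd x zero    = ≈-sym (*-identityˡ 𝟙)
  E-even-odd x (suc n) = begin
    E x (2 ℕ.* suc n)
      ≡⟨ cong (E x) (ℕₚ.*-suc 2 n) ⟩
    (𝟙 ⊖ x ↑ (2 ℕ.+ 2 ℕ.* n)) ⊙ ((𝟙 ⊖ x ↑ suc (2 ℕ.* n)) ⊙ E x (2 ℕ.* n))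
      ≈⟨ ⊙-cong (⊕-cong (≈-refl {𝟙}) (⊝-cong x^2n+2))
           (⊙-congˡ (𝟙 ⊖ x ↑ suc (2 ℕ.* n)) (E-even-odd x n)) ⟩
    (𝟙 ⊖ (x ⊙ x) ↑ suc n) ⊙ ((𝟙 ⊖ x ↑ suc (2 ℕ.* n)) ⊙ (E (x ⊙ x) n ⊙ O x n))
      ≈⟨ solve 4 (λ a b e o → a :* (b :* (e :* o)) := (a :* e) :* (b :* o)) ≈-refl
           (𝟙 ⊖ (x ⊙ x) ↑ suc n) (𝟙 ⊖ x ↑ suc (2 ℕ.* n)) (E (x ⊙ x) n) (O x n) ⟩
    E (x ⊙ x) (suc n) ⊙ O x (suc n) ∎
    where
    x^2n+2 : x ↑ (2 ℕ.+ 2 ℕ.* n) ≈ (x ⊙ x) ↑ suc n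
    x^2n+2 = begin
      x ↑ (2 ℕ.+ 2 ℕ.* n)  ≡⟨ cong (x ↑_) (sym (ℕₚ.*-suc 2 n)) ⟩
      x ↑ (2 ℕ.* suc n)    ≈⟨ ^-assocʳ x 2 (suc n) ⟨
      (x ↑ 2) ↑ suc n      ≈⟨ ^-congˡ (suc n) (⊙-congˡ x (*-identityʳ x)) ⟩
      (x ⊙ x) ↑ suc n      ∎

  ⊝↑-odd : ∀ x n → (⊝ x) ↑ suc (2 ℕ.* n) ≈ ⊝ (x ↑ suc (2 ℕ.* n))
  ⊝↑-odd x n = begin
    ⊝ x ⊙ (⊝ x) ↑ (2 ℕ.* n)  ≈⟨ ⊙-congˡ (⊝ x) (^-assocʳ (⊝ x) 2 n) ⟨
    ⊝ x ⊙ ((⊝ x) ↑ 2) ↑ n    ≈⟨ ⊙-congˡ (⊝ x) (^-congˡ n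
                                   (solve 1 (λ x → (:- x) :* ((:- x) :* con (+ 1)) := x :* (x :* con (+ 1))) ≈-refl x)) ⟩
    ⊝ x ⊙ (x ↑ 2) ↑ n        ≈⟨ ⊙-congˡ (⊝ x) (^-assocʳ x 2 n) ⟩
    ⊝ x ⊙ x ↑ (2 ℕ.* n)      ≈⟨ solve 2 (λ x y → (:- x) :* y := :- (x :* y)) ≈-refl x (x ↑ (2 ℕ.* n)) ⟩
    ⊝ (x ↑ suc (2 ℕ.* n))    ∎

  O⊙O⊝ : ∀ x n → O x n ⊙ O (⊝ x) n ≈ O (x ⊙ x) n
  O⊙O⊝ x zero    = *-identityˡ 𝟙
  O⊙O⊝ x (suc n) = begin
    ((𝟙 ⊖ X) ⊙ O x n) ⊙ ((𝟙 ⊖ (⊝ x) ↑ suc (2 ℕ.* n)) ⊙ O (⊝ x) n)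
      ≈⟨ ⊙-congˡ ((𝟙 ⊖ X) ⊙ O x n)
           (⊙-congʳ (O (⊝ x) n) (⊕-cong (≈-refl {𝟙}) (⊝-cong (⊝↑-odd x n)))) ⟩
    ((𝟙 ⊖ X) ⊙ O x n) ⊙ ((𝟙 ⊖ ⊝ X) ⊙ O (⊝ x) n)
      ≈⟨ solve 3 (λ X o o′ → ((con (+ 1) :- X) :* o) :* ((con (+ 1) :- (:- X)) :* o′) :=
                   (con (+ 1) :- X :* X) :* (o :* o′)) ≈-refl X (O x n) (O (⊝ x) n) ⟩
    (𝟙 ⊖ X ⊙ X) ⊙ (O x n ⊙ O (⊝ x) n)
      ≈⟨ ⊙-cong (⊕-cong (≈-refl {𝟙}) (⊝-cong (≈-sym (^-distrib-* x x (suc (2 ℕ.* n)))))) (O⊙O⊝ x n) ⟩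
    (𝟙 ⊖ (x ⊙ x) ↑ suc (2 ℕ.* n)) ⊙ O (x ⊙ x) n ∎
    where
    X : Series
    X = x ↑ suc (2 ℕ.* n)

-- Monomials and the inverse of 1 - q^m

mono-suc-⊛ : ∀ i b n → (mono (suc i) ⊛ b) (suc n) ≡ (mono i ⊛ b) n
mono-suc-⊛ i b n = trans (⊛-suc (mono (suc i)) b n)
  (trans (cong (ℤ._+ (mono i ⊛ b) n) (ℤₚ.*-zeroˡ (b (suc n)))) (ℤₚ.+-identityˡ _))

mono-⊛-< : ∀ i b {n} → n ℕ.< i → (mono i ⊛ b) n ≡ + 0
mono-⊛-< (suc i) b {zero}  _         = ℤₚ.*-zeroˡ (b 0)
mono-⊛-< (suc i) b {suc n} (s≤s n<i) = trans (mono-suc-⊛ i b n) (mono-⊛-< i b n<i)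

mono-⊛-+ : ∀ i b n → (mono i ⊛ b) (i ℕ.+ n) ≡ b n
mono-⊛-+ zero    b n = trans (⊛-congʳ b oneS≗const n) (1⊛ b n)
mono-⊛-+ (suc i) b n = trans (mono-suc-⊛ i b (i ℕ.+ n)) (mono-⊛-+ i b n)

mono-⊛-mono : ∀ i j → mono i ⊛ mono j ≗ mono (i ℕ.+ j)
mono-⊛-mono zero    j n       = trans (⊛-congʳ (mono j) oneS≗const n) (1⊛ (mono j) n)
mono-⊛-mono (suc i) j zero    = ℤₚ.*-zeroˡ (mono j 0)
mono-⊛-mono (suc i) j (suc n) = trans (mono-suc-⊛ i (mono j) n) (mono-⊛-mono i j n)

mono-+ : ∀ i j → mono i ⊙ mono j ≗ mono (i ℕ.+ j)
mono-+ i j n = trans (⊙-def (mono i) (mono j) n) (mono-⊛-mono i j n)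

mono-same : ∀ i → mono i i ≡ + 1
mono-same zero    = refl
mono-same (suc i) = mono-same i

mono-diff : ∀ i n → n ≢ i → mono i n ≡ + 0
mono-diff zero    zero    n≢i = ⊥-elim (n≢i refl)
mono-diff zero    (suc n) n≢i = refl
mono-diff (suc i) zero    n≢i = refl
mono-diff (suc i) (suc n) n≢i = mono-diff i n (n≢i ∘ cong suc)

oneMinusQ≗ : ∀ m → oneMinusQ (suc m) ≗ 𝟙 ⊖ mono (suc m)
oneMinusQ≗ m n = trans (lemma n)
  (trans (cong (λ z → 𝟙 n ℤ.+ z) (sym (⊝-def (mono (suc m)) n)))
           (sym (⊕-def 𝟙 (⊝ mono (suc m)) n)))
  where
  lemma : ∀ n → oneMinusQ (suc m) n ≡ 𝟙 n ℤ.+ ℤ.- mono (suc m) n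
  lemma zero = refl
  lemma (suc n) with suc n ℕ.≟ suc m
  ... | yes refl = cong (λ z → + 0 ℤ.+ ℤ.- z) (sym (mono-same m))
  ... | no  n≢m    = cong (λ z → + 0 ℤ.+ ℤ.- z) (sym (mono-diff (suc m) (suc n) n≢m))

invOneMinusQ-periodic : ∀ m n → invOneMinusQ m (m ℕ.+ n) ≡ invOneMinusQ m n
invOneMinusQ-periodic m n with m ℕD.∣? (m ℕ.+ n) | m ℕD.∣? n
... | yes _ | yes _ = refl
... | no  _ | no  _ = refl
... | yes p | no ¬q = ⊥-elim (¬q (ℕD.∣m+n∣m⇒∣n p ℕD.∣-refl))
... | no ¬p | yes q = ⊥-elim (¬p (ℕD.∣m∣n⇒∣m+n ℕD.∣-refl q))

invOneMinusQ-< : ∀ m {n} → n ℕ.< m → invOneMinusQ m n ≡ const (+ 1) n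
invOneMinusQ-< m {zero} _ with m ℕD.∣? 0
... | yes _ = refl
... | no ¬p = ⊥-elim (¬p (m ℕD.∣0))
invOneMinusQ-< m {suc n} n<m with m ℕD.∣? suc n
... | yes p = ⊥-elim (ℕD.>⇒∤ n<m p)
... | no _  = refl

-- With M = m + 1, the coefficients of 1/(1 - q^M) have period M and begin with 1, 0, ..., 0.
-- Subtracting their shift by M leaves only the constant term.
oneMinusQ-inverse : ∀ m → (𝟙 ⊖ mono (suc m)) ⊙ invOneMinusQ (suc m) ≗ 𝟙
oneMinusQ-inverse m n = begin
  ((𝟙 ⊖ mono M) ⊙ g) n
    ≡⟨ ⊙-distribʳ-⊕ g 𝟙 (⊝ mono M) n ⟩
  ((𝟙 ⊙ g) ⊕ ((⊝ mono M) ⊙ g)) n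
    ≡⟨ ⊕-def (𝟙 ⊙ g) ((⊝ mono M) ⊙ g) n ⟩
  (𝟙 ⊙ g) n ℤ.+ ((⊝ mono M) ⊙ g) n
    ≡⟨ cong₂ ℤ._+_ (⊙-identityˡ g n) ⊝-⊙ ⟩
  g n ℤ.- (mono M ⊛ g) n
    ≡⟨ telescopes ⟩
  𝟙 n ∎
  where
  open ≡-Reasoning
  M = suc m
  g = invOneMinusQ M
  ⊝-⊙ : ((⊝ mono M) ⊙ g) n ≡ ℤ.- (mono M ⊛ g) n
  ⊝-⊙ = trans (⊙-def (⊝ mono M) g n)
    (trans (⊛-congʳ g (λ i → trans (⊝-def (mono M) i) (sym (ℤₚ.-1*i≡-i (mono M i)))) n)
      (trans (⊛-scaleˡ (ℤ.- + 1) (mono M) g n) (ℤₚ.-1*i≡-i _)))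
  telescopes : g n ℤ.- (mono M ⊛ g) n ≡ 𝟙 n
  telescopes with n ℕ.<? M
  ... | yes n<M = trans (cong₂ (λ u v → u ℤ.- v) (invOneMinusQ-< M n<M) (mono-⊛-< M g n<M))
                          (ℤₚ.+-identityʳ _)
  ... | no  n≮M with ℕₚ.m+[n∸m]≡n (ℕₚ.≮⇒≥ n≮M)
  ...   | eq rewrite sym eq =
    trans (cong₂ (λ u v → u ℤ.- v) (invOneMinusQ-periodic M (n ℕ.∸ M)) (mono-⊛-+ M g (n ℕ.∸ M)))
            (ℤₚ.+-inverseʳ (g (n ℕ.∸ M)))

-- The quotient φ(x)/φ(-x²) as an Euler product

module ThetaQuotient (N : ℕ) where
  open Truncated N
  open Theta N
  open CommutativeRing seriesRing using
    (setoid; ring; commutativeSemiring; *-assoc; *-identityˡ)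
  open Exp commutativeSemiring renaming (_^_ to _↑_)
  open RingProperties ring using (-‿involutive)
  open SetoidReasoning setoid
  open Solver

  mono-↑ : ∀ k j → mono k ↑ j ≈ mono (k ℕ.* j)
  mono-↑ k zero    = ≗⇒≈ λ n → trans (sym (oneS≗const n)) (cong (λ z → mono z n) (sym (ℕₚ.*-zeroʳ k)))
  mono-↑ k (suc j) = begin
    mono k ⊙ mono k ↑ j         ≈⟨ ⊙-congˡ (mono k) (mono-↑ k j) ⟩
    mono k ⊙ mono (k ℕ.* j)     ≈⟨ ≗⇒≈ (mono-+ k (k ℕ.* j)) ⟩
    mono (k ℕ.+ k ℕ.* j)        ≡⟨ cong mono (sym (ℕₚ.*-suc k j)) ⟩
    mono (k ℕ.* suc j)          ∎

  mono-small : ∀ k → Small (mono (suc k))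
  vanish (mono-small k) j = ≈-trans (mono-↑ (suc k) (suc N ℕ.+ j)) (mk λ n n≤N → ≡₃₂-reflexive
    (trans (mono-diff _ n (λ eq → ℕₚ.<-irrefl eq (ℕₚ.<-≤-trans (s≤s n≤N)
        (ℕₚ.≤-trans (ℕₚ.m≤m+n (suc N) j) (ℕₚ.m≤m+n _ (k ℕ.* (suc N ℕ.+ j)))))))
      (sym (const-0 n))))

  ⊝-small : ∀ {x} → Small x → Small (⊝ x)
  vanish (⊝-small {x} small) k = ≈-trans (⊝↑ x (suc N ℕ.+ k))
    (≈-trans (⊙-congˡ ((⊝ 𝟙) ↑ (suc N ℕ.+ k)) (vanish small k))
      (solve 1 (λ c → c :* con (+ 0) := con (+ 0)) ≈-refl ((⊝ 𝟙) ↑ (suc N ℕ.+ k))))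

  ⊙-small : ∀ {x} y → Small x → Small (x ⊙ y)
  vanish (⊙-small {x} y small) k = ≈-trans (^-distrib-* x y (suc N ℕ.+ k))
    (≈-trans (⊙-congʳ (y ↑ (suc N ℕ.+ k)) (vanish small k))
      (solve 1 (λ c → con (+ 0) :* c := con (+ 0)) ≈-refl (y ↑ (suc N ℕ.+ k))))

  E-cong : ∀ {x y} → x ≈ y → ∀ n → E x n ≈ E y n
  E-cong h zero    = ≈-refl
  E-cong h (suc n) = ⊙-cong (⊕-cong (≈-refl {𝟙}) (⊝-cong (^-congˡ (suc n) h))) (E-cong h n)

  ∑-cong : ∀ {A : Set} (L : List A) {f g} → (∀ s → f s ≈ g s) → ∑ L f ≈ ∑ L g
  ∑-cong []      h = ≈-refl
  ∑-cong (s ∷ L) h = ⊕-cong (h s) (∑-cong L h)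

  θ-cong : ∀ n {x y} → x ≈ y → θ n x ≈ θ n y
  θ-cong n h = ⊕-cong (≈-refl {𝟙}) (⊙-congˡ 𝟚 (∑-cong (range n) λ s → ^-congˡ (s ℕ.* s) h))

  -- Multiplying `gauss` by ∏ (1 - xⁱ) merges it with ∏ (1 + xⁱ) and yields φ(-x) = f₁²/f₂. The
  -- products are cut back to N while the theta sum keeps its free length.
  gauss² : ∀ {x} → Small x → ∀ k → E x N ⊙ E x N ≈ E (x ⊙ x) N ⊙ θ (N ℕ.+ k) (⊝ x)
  gauss² {x} small k = begin
    E x N ⊙ E x N
      ≈⟨ ⊙-cong (E-stable small k) (E-stable small k) ⟨
    E x n ⊙ E x n
      ≈⟨ ⊙-congˡ (E x n) (gauss small k) ⟩
    E x n ⊙ (D x n ⊙ θ n (⊝ x))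
      ≈⟨ *-assoc (E x n) (D x n) (θ n (⊝ x)) ⟨
    (E x n ⊙ D x n) ⊙ θ n (⊝ x)
      ≈⟨ ⊙-congʳ (θ n (⊝ x)) (≈-trans (E⊙D x n) (E-stable (⊙-small x small) k)) ⟩
    E (x ⊙ x) N ⊙ θ n (⊝ x) ∎
    where
    n : ℕ
    n = N ℕ.+ k

  E≈E²⊙O : ∀ {x} → Small x → E x N ≈ E (x ⊙ x) N ⊙ O x N
  E≈E²⊙O {x} small = ≈-trans (≈-sym (E-stable small (N ℕ.+ 0))) (E-even-odd x N)

  ⊝⊙⊝ : ∀ x → (⊝ x) ⊙ (⊝ x) ≈ x ⊙ x
  ⊝⊙⊝ x = solve 1 (λ x → (:- x) :* (:- x) := x :* x) ≈-refl x

  -- The classical f₁(-x) = f₂³/(f₁ f₄). Even factors are common to x and -x, and odd factors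
  -- combine by (1 - xʲ)(1 + xʲ) = 1 - x²ʲ into the odd part of the product in x².
  E⊙E⊝⊙E⁴ : ∀ {x} → Small x → let x² = x ⊙ x in
    (E x N ⊙ E (⊝ x) N) ⊙ E (x² ⊙ x²) N ≈ (E x² N ⊙ E x² N) ⊙ E x² N
  E⊙E⊝⊙E⁴ {x} small = begin
    (E x N ⊙ E (⊝ x) N) ⊙ e₄
      ≈⟨ ⊙-congʳ e₄ (⊙-cong (E≈E²⊙O small)
           (≈-trans (E≈E²⊙O (⊝-small small)) (⊙-congʳ (O (⊝ x) N) (E-cong (⊝⊙⊝ x) N)))) ⟩
    ((e₂ ⊙ O x N) ⊙ (e₂ ⊙ O (⊝ x) N)) ⊙ e₄
      ≈⟨ solve 4 (λ e o o′ e₄ → ((e :* o) :* (e :* o′)) :* e₄ := (e :* e) :* (e₄ :* (o :* o′)))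
           ≈-refl e₂ (O x N) (O (⊝ x) N) e₄ ⟩
    (e₂ ⊙ e₂) ⊙ (e₄ ⊙ (O x N ⊙ O (⊝ x) N))
      ≈⟨ ⊙-congˡ (e₂ ⊙ e₂) (≈-trans (⊙-congˡ e₄ (O⊙O⊝ x N)) (≈-sym (E≈E²⊙O (⊙-small x small)))) ⟩
    (e₂ ⊙ e₂) ⊙ e₂ ∎
    where
    e₂ e₄ : Series
    e₂ = E (x ⊙ x) N
    e₄ = E ((x ⊙ x) ⊙ (x ⊙ x)) N

  -- Gauss at x² and at -x gives φ(-x²) = f₂²/f₄ and φ(x) = f₁(-x)²/f₂. By `E⊙E⊝⊙E⁴` both sides
  -- equal f₂⁵/(f₁² f₄²). The inverses are arbitrary so that the truncated `fInvTrunc` can be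
  -- inserted.
  theta-quotient : ∀ {x} → Small x → ∀ k {i₁ i₂ i₄} → let x² = x ⊙ x in
    i₁ ⊙ E x N ≈ 𝟙 → i₂ ⊙ E x² N ≈ 𝟙 → i₄ ⊙ E (x² ⊙ x²) N ≈ 𝟙 →
    ((E x² N ↑ 3 ⊙ i₁ ↑ 2) ⊙ i₄) ⊙ θ (N ℕ.+ k) (⊝ x²) ≈ θ (N ℕ.+ k) x
  theta-quotient {x} small k {i₁} {i₂} {i₄} inv₁ inv₂ inv₄ = begin
    ((e₂ ↑ 3 ⊙ i₁ ↑ 2) ⊙ i₄) ⊙ θ′
      ≈⟨ solve 2 (λ a b → a :* b := con (+ 1) :* (con (+ 1) :* (a :* b))) ≈-refl
           ((e₂ ↑ 3 ⊙ i₁ ↑ 2) ⊙ i₄) θ′ ⟩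
    𝟙 ⊙ (𝟙 ⊙ (((e₂ ↑ 3 ⊙ i₁ ↑ 2) ⊙ i₄) ⊙ θ′))
      ≈⟨ ⊙-cong inv₂ (⊙-congʳ (((e₂ ↑ 3 ⊙ i₁ ↑ 2) ⊙ i₄) ⊙ θ′) inv₄) ⟨
    (i₂ ⊙ e₂) ⊙ ((i₄ ⊙ e₄) ⊙ (((e₂ ↑ 3 ⊙ i₁ ↑ 2) ⊙ i₄) ⊙ θ′))
      ≈⟨ solve 6 (λ i₁ i₂ i₄ e₂ e₄ t →
           (i₂ :* e₂) :* ((i₄ :* e₄) :* (((e₂ :^ 3 :* i₁ :^ 2) :* i₄) :* t)) :=
           ((((i₂ :* e₂) :* e₂ :^ 3) :* i₁ :^ 2) :* i₄ :^ 2) :* (e₄ :* t)) ≈-refl i₁ i₂ i₄ e₂ e₄ θ′ ⟩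
    ((((i₂ ⊙ e₂) ⊙ e₂ ↑ 3) ⊙ i₁ ↑ 2) ⊙ i₄ ↑ 2) ⊙ (e₄ ⊙ θ′)
      ≈⟨ ⊙-congˡ ((((i₂ ⊙ e₂) ⊙ e₂ ↑ 3) ⊙ i₁ ↑ 2) ⊙ i₄ ↑ 2) (gauss² (⊙-small x small) k) ⟨
    ((((i₂ ⊙ e₂) ⊙ e₂ ↑ 3) ⊙ i₁ ↑ 2) ⊙ i₄ ↑ 2) ⊙ (e₂ ⊙ e₂)
      ≈⟨ solve 4 (λ i₁ i₂ i₄ e₂ →
           ((((i₂ :* e₂) :* e₂ :^ 3) :* i₁ :^ 2) :* i₄ :^ 2) :* (e₂ :* e₂) :=
           ((i₂ :* i₁ :^ 2) :* i₄ :^ 2) :* (((e₂ :* e₂) :* e₂) :^ 2)) ≈-refl i₁ i₂ i₄ e₂ ⟩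
    ((i₂ ⊙ i₁ ↑ 2) ⊙ i₄ ↑ 2) ⊙ ((e₂ ⊙ e₂) ⊙ e₂) ↑ 2
      ≈⟨ ⊙-congˡ ((i₂ ⊙ i₁ ↑ 2) ⊙ i₄ ↑ 2) (^-congˡ 2 (E⊙E⊝⊙E⁴ small)) ⟨
    ((i₂ ⊙ i₁ ↑ 2) ⊙ i₄ ↑ 2) ⊙ ((e₁ ⊙ ē) ⊙ e₄) ↑ 2
      ≈⟨ solve 6 (λ i₁ i₂ i₄ e₁ ē e₄ →
           ((i₂ :* i₁ :^ 2) :* i₄ :^ 2) :* ((e₁ :* ē) :* e₄) :^ 2 :=
           (i₂ :* ((i₁ :* e₁) :^ 2 :* (i₄ :* e₄) :^ 2)) :* (ē :* ē)) ≈-refl i₁ i₂ i₄ e₁ ē e₄ ⟩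
    (i₂ ⊙ ((i₁ ⊙ e₁) ↑ 2 ⊙ (i₄ ⊙ e₄) ↑ 2)) ⊙ (ē ⊙ ē)
      ≈⟨ ⊙-cong (⊙-congˡ i₂ (⊙-cong (^-congˡ 2 inv₁) (^-congˡ 2 inv₄))) ē² ⟩
    (i₂ ⊙ (𝟙 ↑ 2 ⊙ 𝟙 ↑ 2)) ⊙ (e₂ ⊙ θ₁)
      ≈⟨ solve 3 (λ i e t → (i :* (con (+ 1) :^ 2 :* con (+ 1) :^ 2)) :* (e :* t) :=
                             (i :* e) :* t) ≈-refl i₂ e₂ θ₁ ⟩
    (i₂ ⊙ e₂) ⊙ θ₁
      ≈⟨ ≈-trans (⊙-congʳ θ₁ inv₂) (*-identityˡ θ₁) ⟩
    θ₁ ∎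
    where
    e₁ ē e₂ e₄ θ₁ θ′ : Series
    e₁ = E x N
    ē  = E (⊝ x) N
    e₂ = E (x ⊙ x) N
    e₄ = E ((x ⊙ x) ⊙ (x ⊙ x)) N
    θ₁ = θ (N ℕ.+ k) x
    θ′ = θ (N ℕ.+ k) (⊝ (x ⊙ x))
    ē² : ē ⊙ ē ≈ e₂ ⊙ θ₁
    ē² = ≈-trans (gauss² (⊝-small small) k)
      (⊙-cong (E-cong (⊝⊙⊝ x) N) (θ-cong (N ℕ.+ k) (-‿involutive x)))

-- Reduction to a quotient of theta series

ind : ∀ {P : Set} → Dec P → ℤ
ind (yes _) = + 1
ind (no _)  = + 0

ind-yes : ∀ {P : Set} (P? : Dec P) → P → ind P? ≡ + 1
ind-yes (yes _) _ = refl
ind-yes (no ¬p) p = ⊥-elim (¬p p)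

ind-no : ∀ {P : Set} (P? : Dec P) → ¬ P → ind P? ≡ + 0
ind-no (yes p) ¬p = ⊥-elim (¬p p)
ind-no (no _)  _  = refl

_∤?_ : ∀ d n → Dec (¬ d ℕD.∣ n)
d ∤? n = ¬? (d ℕD.∣? n)

module Reduction (N : ℕ) where
  open Truncated N
  open Theta N
  open ThetaQuotient N
  open CommutativeRing seriesRing using
    (reflexive; setoid; commutativeSemiring; *-assoc; *-comm; *-identityˡ; *-identityʳ)
  open Exp commutativeSemiring renaming (_^_ to _↑_)
  open SetoidReasoning setoid
  open Solver

  ⊛⇒⊙ : ∀ {a a′ b b′} → a ≈ a′ → b ≈ b′ → a ⊛ b ≈ a′ ⊙ b′
  ⊛⇒⊙ {a} {b = b} p q = ≈-trans (≗⇒≈ (λ n → sym (⊙-def a b n))) (⊙-cong p q)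

  powS≈↑ : ∀ s r → powS s r ≈ s ↑ r
  powS≈↑ s zero    = ≗⇒≈ oneS≗const
  powS≈↑ s (suc r) = ⊛⇒⊙ (≈-refl {s}) (powS≈↑ s r)

  fTrunc≈E : ∀ k n → fTrunc (suc k) n ≈ E (mono (suc k)) n
  fTrunc≈E k zero    = ≗⇒≈ oneS≗const
  fTrunc≈E k (suc n) = ⊛⇒⊙
    (≈-trans (≗⇒≈ (oneMinusQ≗ (n ℕ.+ k ℕ.* suc n)))
           (⊕-cong (≈-refl {𝟙}) (⊝-cong (≈-sym (mono-↑ (suc k) (suc n))))))
    (fTrunc≈E k n)

  fInvTrunc⊙E : ∀ k n → fInvTrunc (suc k) n ⊙ E (mono (suc k)) n ≈ 𝟙
  fInvTrunc⊙E k zero    = ≈-trans (⊙-congʳ 𝟙 (≗⇒≈ oneS≗const)) (*-identityˡ 𝟙)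
  fInvTrunc⊙E k (suc n) = begin
    (g ⊛ G) ⊙ ((𝟙 ⊖ x ↑ suc n) ⊙ E x n)
      ≈⟨ ⊙-congʳ ((𝟙 ⊖ x ↑ suc n) ⊙ E x n) (⊛⇒⊙ (≈-refl {g}) (≈-refl {G})) ⟩
    (g ⊙ G) ⊙ ((𝟙 ⊖ x ↑ suc n) ⊙ E x n)
      ≈⟨ solve 4 (λ g G a e → (g :* G) :* (a :* e) := (a :* g) :* (G :* e)) ≈-refl
           g G (𝟙 ⊖ x ↑ suc n) (E x n) ⟩
    ((𝟙 ⊖ x ↑ suc n) ⊙ g) ⊙ (G ⊙ E x n)
      ≈⟨ ⊙-cong (≈-trans (⊙-congʳ g (⊕-cong (≈-refl {𝟙}) (⊝-cong (mono-↑ (suc k) (suc n)))))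
                        (≗⇒≈ (oneMinusQ-inverse (n ℕ.+ k ℕ.* suc n))))
                (fInvTrunc⊙E k n) ⟩
    𝟙 ⊙ 𝟙
      ≈⟨ *-identityˡ 𝟙 ⟩
    𝟙 ∎
    where
    x g G : Series
    x = mono (suc k)
    g = invOneMinusQ (suc k ℕ.* suc n)
    G = fInvTrunc (suc k) n

  -- Each squaring doubles the modulus at which the power is 1: from 2 through 4, 8 and 16 to 32.
  -- Besides reducing the exponent 16m + 1, this makes the 15th power of a theta series its inverse,
  -- which is how theta series are divided by below.
  θ↑16 : ∀ n y → θ n y ↑ 16 ≈ 𝟙
  θ↑16 n y = begin
    (𝟙 ⊕ 𝟚 ⊙ u) ↑ 16
      ≈⟨ ^-assocʳ (𝟙 ⊕ 𝟚 ⊙ u) 2 8 ⟨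
    ((𝟙 ⊕ 𝟚 ⊙ u) ↑ 2) ↑ 8
      ≈⟨ ^-congˡ 8 (solve 1 (λ u → (con (+ 1) :+ con (+ 2) :* u) :^ 2 :=
           con (+ 1) :+ con (+ 4) :* (u :+ u :* u)) ≈-refl u) ⟩
    (𝟙 ⊕ const (+ 4) ⊙ v) ↑ 8
      ≈⟨ ^-assocʳ (𝟙 ⊕ const (+ 4) ⊙ v) 2 4 ⟨
    ((𝟙 ⊕ const (+ 4) ⊙ v) ↑ 2) ↑ 4
      ≈⟨ ^-congˡ 4 (solve 1 (λ v → (con (+ 1) :+ con (+ 4) :* v) :^ 2 :=
           con (+ 1) :+ con (+ 8) :* (v :+ con (+ 2) :* (v :* v))) ≈-refl v) ⟩
    (𝟙 ⊕ const (+ 8) ⊙ w) ↑ 4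
      ≈⟨ ^-assocʳ (𝟙 ⊕ const (+ 8) ⊙ w) 2 2 ⟨
    ((𝟙 ⊕ const (+ 8) ⊙ w) ↑ 2) ↑ 2
      ≈⟨ ^-congˡ 2 (≈-trans (solve 1 (λ w → (con (+ 1) :+ con (+ 8) :* w) :^ 2 :=
           (con (+ 1) :+ con (+ 16) :* w) :+ con (+ 32) :* (con (+ 2) :* (w :* w))) ≈-refl w)
           (⊕-32⊙ (𝟙 ⊕ const (+ 16) ⊙ w) (𝟚 ⊙ (w ⊙ w)))) ⟩
    (𝟙 ⊕ const (+ 16) ⊙ w) ↑ 2
      ≈⟨ ≈-trans (solve 1 (λ w → (con (+ 1) :+ con (+ 16) :* w) :^ 2 :=
           con (+ 1) :+ con (+ 32) :* (w :+ con (+ 8) :* (w :* w))) ≈-refl w)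
           (⊕-32⊙ 𝟙 (w ⊕ const (+ 8) ⊙ (w ⊙ w))) ⟩
    𝟙 ∎
    where
    u v w : Series
    u = ∑ (range n) (λ s → y ↑ (s ℕ.* s))
    v = u ⊕ u ⊙ u
    w = v ⊕ 𝟚 ⊙ (v ⊙ v)

  root-of-unity-⊙ : ∀ {x y} → x ↑ 16 ≈ 𝟙 → y ↑ 16 ≈ 𝟙 → (x ⊙ y) ↑ 16 ≈ 𝟙
  root-of-unity-⊙ {x} {y} p q =
    ≈-trans (^-distrib-* x y 16) (≈-trans (⊙-cong p q) (*-identityˡ 𝟙))

  root-of-unity-÷ : ∀ {x y z} → z ⊙ y ≈ x → x ↑ 16 ≈ 𝟙 → y ↑ 16 ≈ 𝟙 → z ↑ 16 ≈ 𝟙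
  root-of-unity-÷ {x} {y} {z} h p q = begin
    z ↑ 16           ≈⟨ *-identityʳ (z ↑ 16) ⟨
    z ↑ 16 ⊙ 𝟙       ≈⟨ ⊙-congˡ (z ↑ 16) q ⟨
    z ↑ 16 ⊙ y ↑ 16  ≈⟨ ^-distrib-* z y 16 ⟨
    (z ⊙ y) ↑ 16     ≈⟨ ^-congˡ 16 h ⟩
    x ↑ 16           ≈⟨ p ⟩
    𝟙                ∎

  private
    F I : ℕ → Series
    F k = fTrunc k N
    I k = fInvTrunc k N

  quotient : Series
  quotient = ((((F 2 ↑ 3 ⊙ F 9 ↑ 2) ⊙ F 36) ⊙ I 1 ↑ 2) ⊙ I 4) ⊙ I 18 ↑ 3

  generating-function : ∀ r → S9bar r N ≡₃₂ (quotient ↑ r) N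
  generating-function r = coeff eq N ℕₚ.≤-refl
    where
    power : ∀ s k → powS s (k ℕ.* r) ≈ (s ↑ k) ↑ r
    power s k = ≈-trans (powS≈↑ s (k ℕ.* r)) (≈-sym (^-assocʳ s k r))
    _⟨⊛⟩_ : ∀ {a b x y} → a ≈ x ↑ r → b ≈ y ↑ r → a ⊛ b ≈ (x ⊙ y) ↑ r
    _⟨⊛⟩_ {x = x} {y} p q = ≈-trans (⊛⇒⊙ p q) (≈-sym (^-distrib-* x y r))
    infixl 7 _⟨⊛⟩_
    eq : powS (F 2) (3 ℕ.* r) ⊛ powS (F 9) (2 ℕ.* r) ⊛ powS (F 36) r
         ⊛ powS (I 1) (2 ℕ.* r) ⊛ powS (I 4) r ⊛ powS (I 18) (3 ℕ.* r) ≈ quotient ↑ r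
    eq = power (F 2) 3 ⟨⊛⟩ power (F 9) 2 ⟨⊛⟩ powS≈↑ (F 36) r
         ⟨⊛⟩ power (I 1) 2 ⟨⊛⟩ powS≈↑ (I 4) r ⟨⊛⟩ power (I 18) 3

  theta-quotient-mono : ∀ k l →
    ((F (2 ℕ.* suc k) ↑ 3 ⊙ I (suc k) ↑ 2) ⊙ I (4 ℕ.* suc k))
      ⊙ θ (N ℕ.+ l) (⊝ mono (2 ℕ.* suc k)) ≈ θ (N ℕ.+ l) (mono (suc k))
  theta-quotient-mono k l = begin
    ((F (2 ℕ.* suc k) ↑ 3 ⊙ I (suc k) ↑ 2) ⊙ I (4 ℕ.* suc k)) ⊙ θ n (⊝ mono (2 ℕ.* suc k))
      ≈⟨ ⊙-cong (⊙-congʳ (I (4 ℕ.* suc k)) (⊙-congʳ (I (suc k) ↑ 2) (^-congˡ 3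
           (≈-trans (fTrunc≈E _ N) (E-cong x²≈ N))))) (θ-cong n (⊝-cong x²≈)) ⟩
    ((E x² N ↑ 3 ⊙ I (suc k) ↑ 2) ⊙ I (4 ℕ.* suc k)) ⊙ θ n (⊝ x²)
      ≈⟨ theta-quotient (mono-small k) l (fInvTrunc⊙E k N)
           (≈-trans (⊙-congˡ (I (2 ℕ.* suc k)) (E-cong (≈-sym x²≈) N)) (fInvTrunc⊙E _ N))
           (≈-trans (⊙-congˡ (I (4 ℕ.* suc k)) (E-cong (≈-sym x⁴≈) N)) (fInvTrunc⊙E _ N)) ⟩
    θ n x ∎
    where
    n : ℕ
    n = N ℕ.+ l
    x x² : Series
    x = mono (suc k)
    x² = x ⊙ x
    double : ∀ m → m ℕ.+ m ≡ 2 ℕ.* m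
    double m = cong (m ℕ.+_) (sym (ℕₚ.+-identityʳ m))
    x²≈ : mono (2 ℕ.* suc k) ≈ x²
    x²≈ = ≈-sym (≈-trans (≗⇒≈ (mono-+ (suc k) (suc k))) (reflexive (cong mono (double (suc k)))))
    x⁴≈ : mono (4 ℕ.* suc k) ≈ x² ⊙ x²
    x⁴≈ = ≈-sym (begin
      x² ⊙ x²                                     ≈⟨ ⊙-cong x²≈ x²≈ ⟨
      mono (2 ℕ.* suc k) ⊙ mono (2 ℕ.* suc k)     ≈⟨ ≗⇒≈ (mono-+ (2 ℕ.* suc k) (2 ℕ.* suc k)) ⟩
      mono (2 ℕ.* suc k ℕ.+ 2 ℕ.* suc k)          ≡⟨ cong mono (double (2 ℕ.* suc k)) ⟩
      mono (2 ℕ.* (2 ℕ.* suc k))                  ≡⟨ cong mono (sym (ℕₚ.*-assoc 2 2 (suc k))) ⟩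
      mono (4 ℕ.* suc k)                          ∎)

  E⊙fInvTrunc : ∀ k → F (suc k) ⊙ I (suc k) ≈ 𝟙
  E⊙fInvTrunc k = ≈-trans (⊙-congʳ (I (suc k)) (fTrunc≈E k N))
    (≈-trans (*-comm (E (mono (suc k)) N) (I (suc k))) (fInvTrunc⊙E k N))

  -- The lengths differ because of the dissection: it will be applied with l = 2N to the sums in q
  -- and -q², and it splits off sums of length N in q⁹ and -q¹⁸, which have to match the ones here.
  quotient-theta : ∀ l →
    quotient ⊙ (θ (N ℕ.+ l) (⊝ mono 2) ⊙ θ (N ℕ.+ 0) (mono 9))
      ≈ θ (N ℕ.+ l) (mono 1) ⊙ θ (N ℕ.+ 0) (⊝ mono 18)
  quotient-theta l = begin
    quotient ⊙ (t₂ ⊙ t₉)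
      ≈⟨ ⊙-congˡ quotient (⊙-congˡ t₂ (theta-quotient-mono 8 0)) ⟨
    quotient ⊙ (t₂ ⊙ (T₉ ⊙ t₁₈))
      ≈⟨ ⊙-congʳ (t₂ ⊙ (T₉ ⊙ t₁₈)) (solve 6 (λ f₂ f₉ f₃₆ i₁ i₄ i₁₈ →
           ((((f₂ :* f₉) :* f₃₆) :* i₁) :* i₄) :* i₁₈ :=
           ((f₂ :* i₁) :* i₄) :* ((f₉ :* i₁₈) :* f₃₆)) ≈-refl
           (F 2 ↑ 3) (F 9 ↑ 2) (F 36) (I 1 ↑ 2) (I 4) (I 18 ↑ 3)) ⟩
    (T₁ ⊙ U) ⊙ (t₂ ⊙ (T₉ ⊙ t₁₈))
      ≈⟨ solve 5 (λ a b t c u → (a :* b) :* (t :* (c :* u)) := (a :* t) :* ((b :* c) :* u)) ≈-refl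
           T₁ U t₂ T₉ t₁₈ ⟩
    (T₁ ⊙ t₂) ⊙ ((U ⊙ T₉) ⊙ t₁₈)
      ≈⟨ ⊙-cong (theta-quotient-mono 0 l) (⊙-congʳ t₁₈ U⊙T₉≈1) ⟩
    t₁ ⊙ (𝟙 ⊙ t₁₈)
      ≈⟨ ⊙-congˡ t₁ (*-identityˡ t₁₈) ⟩
    t₁ ⊙ t₁₈ ∎
    where
    t₁ t₂ t₉ t₁₈ : Series
    t₁ = θ (N ℕ.+ l) (mono 1)
    t₂ = θ (N ℕ.+ l) (⊝ mono 2)
    t₉ = θ (N ℕ.+ 0) (mono 9)
    t₁₈ = θ (N ℕ.+ 0) (⊝ mono 18)
    T₁ T₉ U : Series
    T₁ = (F 2 ↑ 3 ⊙ I 1 ↑ 2) ⊙ I 4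
    T₉ = (F 18 ↑ 3 ⊙ I 9 ↑ 2) ⊙ I 36
    U = (F 9 ↑ 2 ⊙ I 18 ↑ 3) ⊙ F 36
    U⊙T₉≈1 : U ⊙ T₉ ≈ 𝟙
    U⊙T₉≈1 = begin
      U ⊙ T₉
        ≈⟨ solve 6 (λ f₉ i₁₈ f₃₆ f₁₈ i₉ i₃₆ →
             ((f₉ :* i₁₈) :* f₃₆) :* ((f₁₈ :* i₉) :* i₃₆) :=
             ((f₉ :* i₉) :* (f₁₈ :* i₁₈)) :* (f₃₆ :* i₃₆)) ≈-refl
             (F 9 ↑ 2) (I 18 ↑ 3) (F 36) (F 18 ↑ 3) (I 9 ↑ 2) (I 36) ⟩
      ((F 9 ↑ 2 ⊙ I 9 ↑ 2) ⊙ (F 18 ↑ 3 ⊙ I 18 ↑ 3)) ⊙ (F 36 ⊙ I 36)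
        ≈⟨ ⊙-cong (⊙-cong (cancel 8 2) (cancel 17 3)) (E⊙fInvTrunc 35) ⟩
      (𝟙 ⊙ 𝟙) ⊙ 𝟙
        ≈⟨ ≈-trans (*-identityʳ (𝟙 ⊙ 𝟙)) (*-identityˡ 𝟙) ⟩
      𝟙 ∎
      where
      cancel : ∀ k j → F (suc k) ↑ j ⊙ I (suc k) ↑ j ≈ 𝟙
      cancel k j = ≈-trans (≈-sym (^-distrib-* (F (suc k)) (I (suc k)) j))
                         (≈-trans (^-congˡ j (E⊙fInvTrunc k)) (1↑ j))

  quotient↑16 : quotient ↑ 16 ≈ 𝟙
  quotient↑16 = root-of-unity-÷ (quotient-theta 0)
    (root-of-unity-⊙ (θ↑16 (N ℕ.+ 0) (mono 1)) (θ↑16 (N ℕ.+ 0) (⊝ mono 18)))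
    (root-of-unity-⊙ (θ↑16 (N ℕ.+ 0) (⊝ mono 2)) (θ↑16 (N ℕ.+ 0) (mono 9)))

  S9bar≡quotient : ∀ m → S9bar (16 ℕ.* m ℕ.+ 1) N ≡₃₂ quotient N
  S9bar≡quotient m = ≡₃₂-trans {S9bar (16 ℕ.* m ℕ.+ 1) N} {(quotient ↑ (16 ℕ.* m ℕ.+ 1)) N} {quotient N}
    (generating-function (16 ℕ.* m ℕ.+ 1)) (coeff (begin
      quotient ↑ (16 ℕ.* m ℕ.+ 1)           ≈⟨ ^-homo-* quotient (16 ℕ.* m) 1 ⟩
      quotient ↑ (16 ℕ.* m) ⊙ quotient ↑ 1  ≈⟨ ⊙-cong (≈-trans (≈-sym (^-assocʳ quotient 16 m))
                                                  (≈-trans (^-congˡ m quotient↑16) (1↑ m)))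
                                                (*-identityʳ quotient) ⟩
      𝟙 ⊙ quotient                          ≈⟨ *-identityˡ quotient ⟩
      quotient                              ∎) N ℕₚ.≤-refl)

-- Residue classes supporting a series, and the dissection modulo 3

-- Reducing `r` as well allows unreduced classes: a product supported on 1 + 6 modulo 3 keeps that
-- class until `refl` identifies it with 1.
Res : ∀ m .{{_ : NonZero m}} → ℕ → ℕ → Set
Res m r n = n % m ≡ r % m

Res-+ : ∀ m .{{_ : NonZero m}} {r s} i j → Res m r i → Res m s j → Res m (r ℕ.+ s) (i ℕ.+ j)
Res-+ m {r} {s} i j p q = trans (ℕM.%-distribˡ-+ i j m)
  (trans (cong₂ (λ u v → (u ℕ.+ v) % m) p q) (sym (ℕM.%-distribˡ-+ r s m)))

Res-* : ∀ m .{{_ : NonZero m}} {r s} i j → Res m r i → Res m s j → Res m (r ℕ.* s) (i ℕ.* j)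
Res-* m {r} {s} i j p q = trans (ℕM.%-distribˡ-* i j m)
  (trans (cong₂ (λ u v → (u ℕ.* v) % m) p q) (sym (ℕM.%-distribˡ-* r s m)))

square-mod3 : ∀ s → ¬ 3 ℕD.∣ s → Res 3 1 (s ℕ.* s)
square-mod3 s 3∤s with s % 3 in eq | ℕM.m%n<n s 3
... | 0 | _ = ⊥-elim (3∤s (ℕD.m%n≡0⇒n∣m s 3 eq))
... | 1 | _ = Res-* 3 {1} {1} s s eq eq
... | 2 | _ = Res-* 3 {2} {2} s s eq eq
... | suc (suc (suc _)) | s≤s (s≤s (s≤s ()))

Square4 : ℕ → Set
Square4 n = Res 4 0 n ⊎ Res 4 1 n

square-mod4 : ∀ s → Square4 (s ℕ.* s)
square-mod4 s with s % 4 in eq | ℕM.m%n<n s 4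
... | 0 | _ = inj₁ (Res-* 4 {0} {0} s s eq eq)
... | 1 | _ = inj₂ (Res-* 4 {1} {1} s s eq eq)
... | 2 | _ = inj₁ (Res-* 4 {2} {2} s s eq eq)
... | 3 | _ = inj₂ (Res-* 4 {3} {3} s s eq eq)
... | suc (suc (suc (suc _))) | s≤s (s≤s (s≤s (s≤s ())))

odd-form : ∀ s → ¬ 2 ℕD.∣ s → s ≡ suc (s ℕ./ 2 ℕ.* 2)
odd-form s 2∤s with s % 2 in eq | ℕM.m%n<n s 2 | ℕM.m≡m%n+[m/n]*n s 2
... | 0 | _ | _ = ⊥-elim (2∤s (ℕD.m%n≡0⇒n∣m s 2 eq))
... | 1 | _ | h = h
... | suc (suc _) | s≤s (s≤s ()) | _

module Support (N : ℕ) where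
  open Truncated N
  open Theta N
  open CommutativeRing seriesRing using (commutativeSemiring)
  open Exp commutativeSemiring renaming (_^_ to _↑_)
  open Solver

  -- A disjunction instead of an implication from the failure of P: the case analysis in `supp-⊙`
  -- then goes through for predicates without a decision procedure.
  record Supp (P : ℕ → Set) (a : Series) : Set where
    constructor mkSupp
    field supp : ∀ n → n ℕ.≤ N → a n ≡₃₂ + 0 ⊎ P n
  open Supp public

  supp-≈ : ∀ {P a b} → a ≈ b → Supp P a → Supp P b
  supp (supp-≈ {P} {a} {b} h p) n n≤N with supp p n n≤N
  ... | inj₁ z  = inj₁ (≡₃₂-trans {b n} {a n} {+ 0} (coeff (≈-sym h) n n≤N) z)
  ... | inj₂ Pn = inj₂ Pn

  supp-⊆ : ∀ {P Q : ℕ → Set} {a} → (∀ n → P n → Q n) → Supp P a → Supp Q a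
  supp (supp-⊆ h p) n n≤N with supp p n n≤N
  ... | inj₁ z  = inj₁ z
  ... | inj₂ Pn = inj₂ (h n Pn)

  supp-⊕ : ∀ {P a b} → Supp P a → Supp P b → Supp P (a ⊕ b)
  supp (supp-⊕ {P} {a} {b} p q) n n≤N with supp p n n≤N | supp q n n≤N
  ... | inj₂ Pn | _       = inj₂ Pn
  ... | inj₁ _  | inj₂ Pn = inj₂ Pn
  ... | inj₁ u  | inj₁ v  = inj₁ (subst (_≡₃₂ + 0) (sym (⊕-def a b n))
                              (≡₃₂-+ {a n} {+ 0} {b n} {+ 0} u v))

  supp-⊙ : ∀ {P Q R : ℕ → Set} {a b} → (∀ i j → P i → Q j → R (i ℕ.+ j)) →
           Supp P a → Supp Q b → Supp R (a ⊙ b)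
  supp (supp-⊙ {P} {Q} {R} {a} {b} h p q) n n≤N
    with partial n ℕₚ.≤-refl
    where
    term : ∀ i → i ℕ.≤ n → a i ℤ.* b (n ℕ.∸ i) ≡₃₂ + 0 ⊎ R n
    term i i≤n with supp p i (ℕₚ.≤-trans i≤n n≤N)
                  | supp q (n ℕ.∸ i) (ℕₚ.≤-trans (ℕₚ.m∸n≤m n i) n≤N)
    ... | inj₁ z  | _       = inj₁ (subst (a i ℤ.* b (n ℕ.∸ i) ≡₃₂_) (ℤₚ.*-zeroˡ (b (n ℕ.∸ i)))
                                (≡₃₂-* {a i} {+ 0} {b (n ℕ.∸ i)} z (≡₃₂-reflexive {b (n ℕ.∸ i)} refl)))
    ... | inj₂ _  | inj₁ z  = inj₁ (subst (a i ℤ.* b (n ℕ.∸ i) ≡₃₂_) (ℤₚ.*-zeroʳ (a i))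
                                (≡₃₂-* {a i} {a i} {b (n ℕ.∸ i)} {+ 0} (≡₃₂-reflexive {a i} refl) z))
    ... | inj₂ Pi | inj₂ Qj = inj₂ (subst R (ℕₚ.m+[n∸m]≡n i≤n) (h i (n ℕ.∸ i) Pi Qj))
    partial : ∀ m → m ℕ.≤ n → sumTo m (λ i → a i ℤ.* b (n ℕ.∸ i)) ≡₃₂ + 0 ⊎ R n
    partial zero    m≤n = term 0 m≤n
    partial (suc m) m<n with partial m (ℕₚ.<⇒≤ m<n) | term (suc m) m<n
    ... | inj₂ Rn | _       = inj₂ Rn
    ... | inj₁ _  | inj₂ Rn = inj₂ Rn
    ... | inj₁ u  | inj₁ v  = inj₁ (≡₃₂-+ {sumTo m (λ i → a i ℤ.* b (n ℕ.∸ i))} {+ 0}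
                                          {a (suc m) ℤ.* b (n ℕ.∸ suc m)} {+ 0} u v)
  ... | inj₁ z  = inj₁ (subst (_≡₃₂ + 0) (sym (⊙-def a b n)) z)
  ... | inj₂ Rn = inj₂ Rn

  -- Support in exactly {0}, and not in a residue class, makes multiplication by constants preserve
  -- every support, since 0 + j computes to j.
  supp-const : ∀ c → Supp (_≡ 0) (const c)
  supp (supp-const c) zero    _ = inj₂ refl
  supp (supp-const c) (suc n) _ = inj₁ (≡₃₂-reflexive {+ 0} refl)

  supp-const-⊙ : ∀ {P a} c → Supp P a → Supp P (const c ⊙ a)
  supp-const-⊙ {P} c p = supp-⊙ (λ { i j refl Pj → Pj }) (supp-const c) p

  supp-⊝ : ∀ {P a} → Supp P a → Supp P (⊝ a)
  supp-⊝ {P} {a} p = supp-≈ (solve 1 (λ a → con (-[1+ 0 ]) :* a := :- a) ≈-refl a)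
                            (supp-const-⊙ -[1+ 0 ] p)

  supp-mono : ∀ k → Supp (_≡ k) (mono k)
  supp (supp-mono k) n _ with n ℕ.≟ k
  ... | yes eq = inj₂ eq
  ... | no neq = inj₁ (≡₃₂-reflexive (mono-diff k n neq))

  supp-∑ : ∀ {A : Set} {P} (L : List A) {f} → (∀ s → Supp P (f s)) → Supp P (∑ L f)
  supp-∑ []      h = mkSupp λ n _ → inj₁ (≡₃₂-reflexive (const-0 n))
  supp-∑ (x ∷ L) h = supp-⊕ (h x) (supp-∑ L h)

  supp-ind : ∀ {P : ℕ → Set} {A : Set} (A? : Dec A) {a} →
             (A → Supp P a) → Supp P (const (ind A?) ⊙ a)
  supp-ind (yes p) h = supp-const-⊙ (+ 1) (h p)
  supp-ind (no _) {a} h = supp-≈ (solve 1 (λ a → con (+ 0) := con (+ 0) :* a) ≈-refl a)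
    (mkSupp λ n _ → inj₁ (≡₃₂-reflexive (const-0 n)))

  supp-res-𝟙 : ∀ m .{{_ : NonZero m}} → Supp (Res m 0) 𝟙
  supp-res-𝟙 m = supp-⊆ (λ { n refl → refl }) (supp-const (+ 1))

  supp-res-⊙ : ∀ m .{{_ : NonZero m}} r s {a b} →
    Supp (Res m r) a → Supp (Res m s) b → Supp (Res m (r ℕ.+ s)) (a ⊙ b)
  supp-res-⊙ m r s = supp-⊙ λ i j → Res-+ m {r} {s} i j

  supp-res-↑ : ∀ m .{{_ : NonZero m}} r {a} k →
    Supp (Res m r) a → Supp (Res m (k ℕ.* r)) (a ↑ k)
  supp-res-↑ m r zero    p = supp-res-𝟙 m
  supp-res-↑ m r (suc k) p = supp-res-⊙ m r (k ℕ.* r) p (supp-res-↑ m r k p)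

  supp-res-mono : ∀ m .{{_ : NonZero m}} k → Supp (Res m k) (mono k)
  supp-res-mono m k = supp-⊆ (λ { n refl → refl }) (supp-mono k)

  supp-res : ∀ m .{{_ : NonZero m}} r s {a} → Res m s r → Supp (Res m r) a → Supp (Res m s) a
  supp-res m r s eq = supp-⊆ λ n p → trans p eq

  supp-𝟙⊕𝟚 : ∀ m .{{_ : NonZero m}} {a} → Supp (Res m 0) a → Supp (Res m 0) (𝟙 ⊕ 𝟚 ⊙ a)
  supp-𝟙⊕𝟚 m p = supp-⊕ (supp-res-𝟙 m) (supp-const-⊙ (+ 2) p)

  supp-θ : ∀ m .{{_ : NonZero m}} n {y} → Supp (Res m 0) y → Supp (Res m 0) (θ n y)
  supp-θ m n p = supp-𝟙⊕𝟚 m (supp-∑ (range n) λ s →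
    supp-res m (s ℕ.* s ℕ.* 0) 0 (cong (_% m) (ℕₚ.*-zeroʳ (s ℕ.* s))) (supp-res-↑ m 0 (s ℕ.* s) p))

module Dissection (N : ℕ) where
  open Truncated N
  open Theta N
  open ThetaQuotient N
  open Support N
  open CommutativeRing seriesRing using
    (reflexive; setoid; commutativeSemiring; *-comm)
  open Exp commutativeSemiring renaming (_^_ to _↑_)
  open SetoidReasoning setoid
  open Solver

  ω : ℕ → Series → Series
  ω n y = ∑ (range n) λ s → const (ind (3 ∤? s)) ⊙ y ↑ (s ℕ.* s)

  ∑-multiples-of-3 : ∀ n f → ∑ (range (n ℕ.* 3)) f ≈
    ∑ (range n) (λ s → f (s ℕ.* 3)) ⊕ ∑ (range (n ℕ.* 3)) (λ s → const (ind (3 ∤? s)) ⊙ f s)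
  ∑-multiples-of-3 zero    f = solve 0 (con (+ 0) := con (+ 0) :+ con (+ 0)) ≈-refl
  ∑-multiples-of-3 (suc n) f = begin
    f (3 ℕ.+ k) ⊕ (f (2 ℕ.+ k) ⊕ (f (1 ℕ.+ k) ⊕ ∑ (range k) f))
      ≈⟨ ⊕-cong ≈-refl (⊕-cong ≈-refl (⊕-cong ≈-refl (∑-multiples-of-3 n f))) ⟩
    f (3 ℕ.+ k) ⊕ (f (2 ℕ.+ k) ⊕ (f (1 ℕ.+ k) ⊕ (S ⊕ T)))
      ≈⟨ solve 5 (λ a b c s t → a :+ (b :+ (c :+ (s :+ t))) :=
           (a :+ s) :+ (con (+ 0) :* a :+ (con (+ 1) :* b :+ (con (+ 1) :* c :+ t)))) ≈-refl
           (f (3 ℕ.+ k)) (f (2 ℕ.+ k)) (f (1 ℕ.+ k)) S T ⟩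
    (f (3 ℕ.+ k) ⊕ S) ⊕
      (const (+ 0) ⊙ f (3 ℕ.+ k) ⊕ (const (+ 1) ⊙ f (2 ℕ.+ k) ⊕ (const (+ 1) ⊙ f (1 ℕ.+ k) ⊕ T)))
      ≡⟨ cong₂ (λ u vw → (f (3 ℕ.+ k) ⊕ S) ⊕ (const u ⊙ f (3 ℕ.+ k) ⊕ vw)) (sym w₃)
           (cong₂ (λ v w → const v ⊙ f (2 ℕ.+ k) ⊕ (const w ⊙ f (1 ℕ.+ k) ⊕ T)) (sym w₂) (sym w₁)) ⟩
    (f (3 ℕ.+ k) ⊕ S) ⊕ ∑ (range (3 ℕ.+ k)) (λ s → const (ind (3 ∤? s)) ⊙ f s) ∎
    where
    k : ℕ
    k = n ℕ.* 3
    S T : Series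
    S = ∑ (range n) (λ s → f (s ℕ.* 3))
    T = ∑ (range k) (λ s → const (ind (3 ∤? s)) ⊙ f s)
    3∣k : 3 ℕD.∣ k
    3∣k = ℕD.n∣m*n n
    remainder : ∀ r → 3 ℕD.∣ r ℕ.+ k → 3 ℕD.∣ r
    remainder r h = ℕD.∣m+n∣m⇒∣n (subst (3 ℕD.∣_) (ℕₚ.+-comm r k) h) 3∣k
    w₃ : ind (3 ∤? (3 ℕ.+ k)) ≡ + 0
    w₃ = ind-no (3 ∤? (3 ℕ.+ k)) λ 3∤ → 3∤ (ℕD.∣m∣n⇒∣m+n ℕD.∣-refl 3∣k)
    w₂ : ind (3 ∤? (2 ℕ.+ k)) ≡ + 1
    w₂ = ind-yes (3 ∤? (2 ℕ.+ k)) λ h → ℕD.>⇒∤ (s≤s (s≤s (s≤s z≤n))) (remainder _ h)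
    w₁ : ind (3 ∤? (1 ℕ.+ k)) ≡ + 1
    w₁ = ind-yes (3 ∤? (1 ℕ.+ k)) λ h → ℕD.>⇒∤ (s≤s (s≤s z≤n)) (remainder _ h)

  θ-dissect : ∀ n y → θ (n ℕ.* 3) y ≈ θ n (y ↑ 9) ⊕ 𝟚 ⊙ ω (n ℕ.* 3) y
  θ-dissect n y = begin
    𝟙 ⊕ 𝟚 ⊙ ∑ (range (n ℕ.* 3)) (λ s → y ↑ (s ℕ.* s))
      ≈⟨ ⊕-cong (≈-refl {𝟙}) (⊙-congˡ 𝟚 (∑-multiples-of-3 n (λ s → y ↑ (s ℕ.* s)))) ⟩
    𝟙 ⊕ 𝟚 ⊙ (∑ (range n) (λ s → y ↑ (s ℕ.* 3 ℕ.* (s ℕ.* 3))) ⊕ ω (n ℕ.* 3) y)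
      ≈⟨ ⊕-cong (≈-refl {𝟙}) (⊙-congˡ 𝟚 (⊕-cong (∑-cong (range n) nine) ≈-refl)) ⟩
    𝟙 ⊕ 𝟚 ⊙ (∑ (range n) (λ s → (y ↑ 9) ↑ (s ℕ.* s)) ⊕ ω (n ℕ.* 3) y)
      ≈⟨ solve 2 (λ s t → con (+ 1) :+ con (+ 2) :* (s :+ t) :=
           (con (+ 1) :+ con (+ 2) :* s) :+ con (+ 2) :* t) ≈-refl
           (∑ (range n) (λ s → (y ↑ 9) ↑ (s ℕ.* s))) (ω (n ℕ.* 3) y) ⟩
    θ n (y ↑ 9) ⊕ 𝟚 ⊙ ω (n ℕ.* 3) y ∎
    where
    9s² : ∀ s → s ℕ.* 3 ℕ.* (s ℕ.* 3) ≡ 9 ℕ.* (s ℕ.* s)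
    9s² = ℕ-solve-∀
    nine : ∀ s → y ↑ (s ℕ.* 3 ℕ.* (s ℕ.* 3)) ≈ (y ↑ 9) ↑ (s ℕ.* s)
    nine s = ≈-trans (reflexive (cong (y ↑_) (9s² s))) (≈-sym (^-assocʳ y 9 (s ℕ.* s)))

  even-squares odd-squares : ℕ → Series
  even-squares n = ∑ (range n) λ s →
    const (ind (3 ∤? s ×-dec 2 ℕD.∣? s)) ⊙ mono (2 ℕ.* (s ℕ.* s))
  odd-squares n = ∑ (range n) λ s →
    const (ind (3 ∤? s ×-dec 2 ∤? s)) ⊙ mono (2 ℕ.* (s ℕ.* s))

  -- s² has the parity of s, so (-q²)^(s²) is q^(2s²) with the sign (-1)^s.
  ω-parity : ∀ n → ω n (⊝ mono 2) ≈ even-squares n ⊖ odd-squares n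
  ω-parity n = go (range n)
    where
    f e o : ℕ → Series
    f s = const (ind (3 ∤? s)) ⊙ (⊝ mono 2) ↑ (s ℕ.* s)
    e s = const (ind (3 ∤? s ×-dec 2 ℕD.∣? s)) ⊙ mono (2 ℕ.* (s ℕ.* s))
    o s = const (ind (3 ∤? s ×-dec 2 ∤? s)) ⊙ mono (2 ℕ.* (s ℕ.* s))
    power : ∀ s → (⊝ mono 2) ↑ (s ℕ.* s) ≈ (⊝ 𝟙) ↑ s ⊙ mono (2 ℕ.* (s ℕ.* s))
    power s = ≈-trans (⊝↑ (mono 2) (s ℕ.* s))
      (⊙-cong (≈-trans (≈-sym (^-assocʳ (⊝ 𝟙) s s)) (⊝1↑n↑n s)) (mono-↑ 2 (s ℕ.* s)))
    ⊝1↑-even : ∀ k → (⊝ 𝟙) ↑ (k ℕ.* 2) ≈ 𝟙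
    ⊝1↑-even k = ≈-trans (reflexive (cong ((⊝ 𝟙) ↑_) (ℕₚ.*-comm k 2)))
      (≈-trans (≈-sym (^-assocʳ (⊝ 𝟙) 2 k))
        (≈-trans (^-congˡ k (solve 0 ((:- con (+ 1)) :^ 2 := con (+ 1)) ≈-refl)) (1↑ k)))
    term : ∀ s → f s ≈ e s ⊖ o s
    term s with 3 ℕD.∣? s | 2 ℕD.∣? s
    ... | yes _ | yes _ = solve 2 (λ x y → con (+ 0) :* x := con (+ 0) :* y :- con (+ 0) :* y) ≈-refl
                            ((⊝ mono 2) ↑ (s ℕ.* s)) (mono (2 ℕ.* (s ℕ.* s)))
    ... | yes _ | no _  = solve 2 (λ x y → con (+ 0) :* x := con (+ 0) :* y :- con (+ 0) :* y) ≈-refl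
                            ((⊝ mono 2) ↑ (s ℕ.* s)) (mono (2 ℕ.* (s ℕ.* s)))
    ... | no _ | yes (ℕD.divides k eq) = ≈-trans
      (⊙-congˡ (const (+ 1)) (≈-trans (power s) (⊙-congʳ (mono (2 ℕ.* (s ℕ.* s)))
        (≈-trans (reflexive (cong ((⊝ 𝟙) ↑_) eq)) (⊝1↑-even k)))))
      (solve 1 (λ x → con (+ 1) :* (con (+ 1) :* x) := con (+ 1) :* x :- con (+ 0) :* x) ≈-refl
        (mono (2 ℕ.* (s ℕ.* s))))
    ... | no _ | no 2∤s = ≈-trans
      (⊙-congˡ (const (+ 1)) (≈-trans (power s) (⊙-congʳ (mono (2 ℕ.* (s ℕ.* s)))
        (≈-trans (reflexive (cong ((⊝ 𝟙) ↑_) (odd-form s 2∤s)))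
          (⊙-congˡ (⊝ 𝟙) (⊝1↑-even (s ℕ./ 2)))))))
      (solve 1 (λ x → con (+ 1) :* (((:- con (+ 1)) :* con (+ 1)) :* x) :=
                       con (+ 0) :* x :- con (+ 1) :* x) ≈-refl (mono (2 ℕ.* (s ℕ.* s))))
    go : ∀ L → ∑ L f ≈ ∑ L e ⊖ ∑ L o
    go []      = solve 0 (con (+ 0) := con (+ 0) :- con (+ 0)) ≈-refl
    go (s ∷ L) = ≈-trans (⊕-cong (term s) (go L))
      (solve 4 (λ a b c d → (a :- b) :+ (c :- d) := (a :+ c) :- (b :+ d)) ≈-refl
        (e s) (o s) (∑ L e) (∑ L o))

  A A′ Θ₁ Θ₂ B Be Bo : Series
  A  = θ (N ℕ.+ 0) (mono 9)
  A′ = θ (N ℕ.+ 0) (⊝ mono 18)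
  Θ₁ = θ (N ℕ.+ N ℕ.* 2) (mono 1)
  Θ₂ = θ (N ℕ.+ N ℕ.* 2) (⊝ mono 2)
  B  = ω (N ℕ.* 3) (mono 1)
  Be = even-squares (N ℕ.* 3)
  Bo = odd-squares (N ℕ.* 3)

  θ-dissect′ : ∀ y {z} → y ↑ 9 ≈ z →
    θ (N ℕ.+ N ℕ.* 2) y ≈ θ (N ℕ.+ 0) z ⊕ 𝟚 ⊙ ω (N ℕ.* 3) y
  θ-dissect′ y {z} h = begin
    θ (N ℕ.+ N ℕ.* 2) y
      ≡⟨ cong (λ n → θ n y) (sym (ℕₚ.*-suc N 2)) ⟩
    θ (N ℕ.* 3) y
      ≈⟨ θ-dissect N y ⟩
    θ N (y ↑ 9) ⊕ 𝟚 ⊙ ω (N ℕ.* 3) y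
      ≈⟨ ⊕-cong (≈-trans (θ-cong N h) (reflexive (cong (λ n → θ n z) (sym (ℕₚ.+-identityʳ N))))) ≈-refl ⟩
    θ (N ℕ.+ 0) z ⊕ 𝟚 ⊙ ω (N ℕ.* 3) y ∎

  Θ₁-dissect : Θ₁ ≈ A ⊕ 𝟚 ⊙ B
  Θ₁-dissect = θ-dissect′ (mono 1) (mono-↑ 1 9)

  Θ₂-dissect : Θ₂ ≈ A′ ⊕ 𝟚 ⊙ (Be ⊖ Bo)
  Θ₂-dissect = ≈-trans
    (θ-dissect′ (⊝ mono 2) (≈-trans (⊝↑ (mono 2) 9)
      (≈-trans (⊙-congˡ ((⊝ 𝟙) ↑ 9) (mono-↑ 2 9))
        (solve 1 (λ x → (:- con (+ 1)) :^ 9 :* x := :- x) ≈-refl (mono 18)))))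
    (⊕-cong ≈-refl (⊙-congˡ 𝟚 (ω-parity (N ℕ.* 3))))

-- Extraction of the coefficient modulo 32

sumℤ : ∀ {A : Set} → List A → (A → ℤ) → ℤ
sumℤ []      f = + 0
sumℤ (x ∷ L) f = f x ℤ.+ sumℤ L f

sumℤ-cong : ∀ {A : Set} (L : List A) {f g} → (∀ s → f s ≡ g s) → sumℤ L f ≡ sumℤ L g
sumℤ-cong []      h = refl
sumℤ-cong (s ∷ L) h = cong₂ ℤ._+_ (h s) (sumℤ-cong L h)

weight : ℕ → ℕ → ℕ → ℤ
weight x w z =
  ind (3 ∤? x) ℤ.* (ind (3 ∤? w ×-dec 2 ℕD.∣? w) ℤ.* ind (3 ∤? z ×-dec 2 ∤? z))

form : ℕ → ℕ → ℕ → ℕ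
form x w z = x ℕ.* x ℕ.+ (2 ℕ.* (w ℕ.* w) ℕ.+ 2 ℕ.* (z ℕ.* z))

-- The bound 3N is inherited from the dissected theta sums. Triples whose form exceeds N are
-- discarded by `mono`.
representations : ℕ → ℤ
representations N = sumℤ R λ x → sumℤ R λ w → sumℤ R λ z → weight x w z ℤ.* mono (form x w z) N
  where
  R : List ℕ
  R = range (N ℕ.* 3)

even-square-mod4 : ∀ s → 2 ℕD.∣ s → Res 4 0 (2 ℕ.* (s ℕ.* s))
even-square-mod4 s (ℕD.divides k refl) =
  trans (cong (_% 4) (identity k)) (ℕM.[m+kn]%n≡m%n 0 (2 ℕ.* (k ℕ.* k)) 4)
  where
  identity : ∀ k → 2 ℕ.* (k ℕ.* 2 ℕ.* (k ℕ.* 2)) ≡ 0 ℕ.+ 2 ℕ.* (k ℕ.* k) ℕ.* 4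
  identity = ℕ-solve-∀

odd-square-mod4 : ∀ s → ¬ 2 ℕD.∣ s → Res 4 2 (2 ℕ.* (s ℕ.* s))
odd-square-mod4 s 2∤s =
  trans (cong (λ t → 2 ℕ.* (t ℕ.* t) % 4) (odd-form s 2∤s))
    (trans (cong (_% 4) (identity h)) (ℕM.[m+kn]%n≡m%n 2 (2 ℕ.* (h ℕ.* h ℕ.+ h)) 4))
  where
  h : ℕ
  h = s ℕ./ 2
  identity : ∀ h → 2 ℕ.* (suc (h ℕ.* 2) ℕ.* suc (h ℕ.* 2)) ≡ 2 ℕ.+ 2 ℕ.* (h ℕ.* h ℕ.+ h) ℕ.* 4
  identity = ℕ-solve-∀

module Extraction (N : ℕ) where
  open Truncated N
  open Theta N
  open ThetaQuotient N
  open Reduction N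
  open Support N
  open Dissection N
  open CommutativeRing seriesRing using
    (reflexive; setoid; commutativeSemiring; *-comm; *-identityˡ; *-identityʳ)
  open Exp commutativeSemiring renaming (_^_ to _↑_)
  open SetoidReasoning setoid
  open Solver

  -- By `θ↑16` the 15th powers `a` and `a′` are 1/A and 1/A′, so that b = Δ/A′ and c = B/A.
  Δ a a′ b c : Series
  Δ  = Be ⊖ Bo
  a  = A ↑ 15
  a′ = A′ ↑ 15
  b  = a′ ⊙ Δ
  c  = a ⊙ B

  -- With X₀ = 1/(1 + 2b), the summands of (1 + 2c)/(1 + 2b) are grouped by the residue classes
  -- supporting them: X₀ lives on even exponents, X₁ and X₂ on 1 and 0 mod 3, X₃ misses 3 mod 4.
  X₀ X₁ X₂ X₃ X₄ : Series
  X₀ = 𝟙 ⊕ (const (ℤ.- + 2) ⊙ b ⊕ (const (+ 4) ⊙ (b ⊙ b) ⊕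
       (const (ℤ.- + 8) ⊙ (b ⊙ (b ⊙ b)) ⊕ const (+ 16) ⊙ (b ⊙ (b ⊙ (b ⊙ b))))))
  X₁ = const (+ 2) ⊙ c ⊕ const (+ 16) ⊙ (c ⊙ (b ⊙ (b ⊙ b)))
  X₂ = const (ℤ.- + 4) ⊙ (c ⊙ b)
  X₃ = const (+ 8) ⊙ ((A ⊙ B) ⊙ (Be ⊙ Be ⊕ Bo ⊙ Bo))
  X₄ = const (+ 16) ⊙ (B ⊙ (Be ⊙ Bo))

  A⊙a : A ⊙ a ≈ 𝟙
  A⊙a = θ↑16 (N ℕ.+ 0) (mono 9)

  A′⊙a′ : A′ ⊙ a′ ≈ 𝟙
  A′⊙a′ = θ↑16 (N ℕ.+ 0) (⊝ mono 18)

  quotient≈ : quotient ≈ (𝟙 ⊕ 𝟚 ⊙ c) ⊙ X₀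
  quotient≈ = begin
    quotient
      ≈⟨ solve 1 (λ q → q := q :* (con (+ 1) :* con (+ 1))) ≈-refl quotient ⟩
    quotient ⊙ (𝟙 ⊙ 𝟙)
      ≈⟨ ⊙-congˡ quotient (⊙-cong A⊙a (≈-trans (⊙-congʳ X₀ (⊕-cong A′⊙a′ ≈-refl)) geometric)) ⟨
    -- The inserted unit contains A(A′ + 2Δ), the denominator on the left of `quotient-theta` after
    -- dissection, together with its inverse a a′ X₀.
    quotient ⊙ ((A ⊙ a) ⊙ ((A′ ⊙ a′ ⊕ 𝟚 ⊙ (a′ ⊙ Δ)) ⊙ X₀))
      ≈⟨ solve 7 (λ q A a A′ a′ Δ X →
           q :* ((A :* a) :* ((A′ :* a′ :+ con (+ 2) :* (a′ :* Δ)) :* X)) :=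
           (q :* ((A′ :+ con (+ 2) :* Δ) :* A)) :* ((a :* a′) :* X)) ≈-refl quotient A a A′ a′ Δ X₀ ⟩
    (quotient ⊙ ((A′ ⊕ 𝟚 ⊙ Δ) ⊙ A)) ⊙ ((a ⊙ a′) ⊙ X₀)
      ≈⟨ ⊙-congʳ ((a ⊙ a′) ⊙ X₀) (⊙-congˡ quotient (⊙-congʳ A Θ₂-dissect)) ⟨
    (quotient ⊙ (Θ₂ ⊙ A)) ⊙ ((a ⊙ a′) ⊙ X₀)
      ≈⟨ ⊙-congʳ ((a ⊙ a′) ⊙ X₀) (≈-trans (quotient-theta (N ℕ.* 2)) (⊙-congʳ A′ Θ₁-dissect)) ⟩
    ((A ⊕ 𝟚 ⊙ B) ⊙ A′) ⊙ ((a ⊙ a′) ⊙ X₀)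
      ≈⟨ solve 6 (λ A B A′ a a′ X →
           ((A :+ con (+ 2) :* B) :* A′) :* ((a :* a′) :* X) :=
           (A :* a :+ con (+ 2) :* (a :* B)) :* ((A′ :* a′) :* X)) ≈-refl A B A′ a a′ X₀ ⟩
    (A ⊙ a ⊕ 𝟚 ⊙ c) ⊙ ((A′ ⊙ a′) ⊙ X₀)
      ≈⟨ ⊙-cong (⊕-cong A⊙a ≈-refl) (≈-trans (⊙-congʳ X₀ A′⊙a′) (*-identityˡ X₀)) ⟩
    (𝟙 ⊕ 𝟚 ⊙ c) ⊙ X₀ ∎
    where
    -- The geometric series stops after the fourth power because the remainder (2b)⁵ = 32b⁵ vanishes
    -- modulo 32.
    geometric : (𝟙 ⊕ 𝟚 ⊙ b) ⊙ X₀ ≈ 𝟙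
    geometric = ≈-trans (solve 1 (λ b → (con (+ 1) :+ con (+ 2) :* b) :*
      (con (+ 1) :+ (con (ℤ.- + 2) :* b :+ (con (+ 4) :* (b :* b) :+
        (con (ℤ.- + 8) :* (b :* (b :* b)) :+ con (+ 16) :* (b :* (b :* (b :* b)))))))
      := con (+ 1) :+ con (+ 32) :* (b :* (b :* (b :* (b :* b))))) ≈-refl b)
      (⊕-32⊙ 𝟙 (b ⊙ (b ⊙ (b ⊙ (b ⊙ b)))))

  -- (1 + 2u)² ≡ 1 modulo 4, so squares of theta series disappear under the factor 8.
  8A² : ∀ n y → const (+ 8) ⊙ (θ n y ⊙ θ n y) ≈ const (+ 8)
  8A² n y = ≈-trans
    (solve 1 (λ u → con (+ 8) :* ((con (+ 1) :+ con (+ 2) :* u) :* (con (+ 1) :+ con (+ 2) :* u))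
                    := con (+ 8) :+ con (+ 32) :* (u :+ u :* u)) ≈-refl u)
    (⊕-32⊙ (const (+ 8)) (u ⊕ u ⊙ u))
    where
    u : Series
    u = ∑ (range n) (λ s → y ↑ (s ℕ.* s))

  -- Under the factor 8, a′² becomes 1 and 1/A becomes A. The latter matters because A is supported
  -- on squares, as `X₃-mod4` requires, whereas a = A^15 is a long product of such series. The cross
  -- term of Δ² enters with -16AB Be Bo; modulo 32 neither its sign nor the factor A = 1 + 2u
  -- affects it.
  8cb² : const (+ 8) ⊙ (c ⊙ (b ⊙ b)) ≈ X₃ ⊕ X₄
  8cb² = begin
    const (+ 8) ⊙ ((a ⊙ B) ⊙ ((a′ ⊙ Δ) ⊙ (a′ ⊙ Δ)))
      ≈⟨ solve 5 (λ e a B a′ Δ → e :* ((a :* B) :* ((a′ :* Δ) :* (a′ :* Δ))) :=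
           ((e :* (a′ :* a′)) :* a) :* (B :* (Δ :* Δ))) ≈-refl (const (+ 8)) a B a′ Δ ⟩
    ((const (+ 8) ⊙ (a′ ⊙ a′)) ⊙ a) ⊙ (B ⊙ (Δ ⊙ Δ))
      ≈⟨ ⊙-congʳ (B ⊙ (Δ ⊙ Δ)) (≈-trans (⊙-congʳ a 8a′²) 8a) ⟩
    (const (+ 8) ⊙ A) ⊙ (B ⊙ (Δ ⊙ Δ))
      ≈⟨ ≈-trans (solve 4 (λ u B p q →
           (con (+ 8) :* (con (+ 1) :+ con (+ 2) :* u)) :* (B :* ((p :- q) :* (p :- q))) :=
           con (+ 8) :* (((con (+ 1) :+ con (+ 2) :* u) :* B) :* (p :* p :+ q :* q)) :+
             con (+ 16) :* (B :* (p :* q)) :+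
             con (+ 32) :* (:- ((con (+ 1) :+ u) :* (B :* (p :* q))))) ≈-refl u B Be Bo)
           (⊕-32⊙ (X₃ ⊕ X₄) (⊝ ((𝟙 ⊕ u) ⊙ (B ⊙ (Be ⊙ Bo))))) ⟩
    X₃ ⊕ X₄ ∎
    where
    u : Series
    u = ∑ (range (N ℕ.+ 0)) (λ s → mono 9 ↑ (s ℕ.* s))
    8a : const (+ 8) ⊙ a ≈ const (+ 8) ⊙ A
    8a = begin
      const (+ 8) ⊙ a                  ≈⟨ ⊙-congʳ a (8A² (N ℕ.+ 0) (mono 9)) ⟨
      (const (+ 8) ⊙ (A ⊙ A)) ⊙ a      ≈⟨ solve 3 (λ e A a → (e :* (A :* A)) :* a := (e :* A) :* (A :* a))
                                            ≈-refl (const (+ 8)) A a ⟩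
      (const (+ 8) ⊙ A) ⊙ (A ⊙ a)      ≈⟨ ≈-trans (⊙-congˡ (const (+ 8) ⊙ A) A⊙a) (*-identityʳ (const (+ 8) ⊙ A)) ⟩
      const (+ 8) ⊙ A                  ∎
    8a′² : const (+ 8) ⊙ (a′ ⊙ a′) ≈ const (+ 8)
    8a′² = begin
      const (+ 8) ⊙ (a′ ⊙ a′)
        ≈⟨ ⊙-congʳ (a′ ⊙ a′) (8A² (N ℕ.+ 0) (⊝ mono 18)) ⟨
      (const (+ 8) ⊙ (A′ ⊙ A′)) ⊙ (a′ ⊙ a′)
        ≈⟨ solve 3 (λ e A a → (e :* (A :* A)) :* (a :* a) := e :* ((A :* a) :* (A :* a)))
             ≈-refl (const (+ 8)) A′ a′ ⟩
      const (+ 8) ⊙ ((A′ ⊙ a′) ⊙ (A′ ⊙ a′))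
        ≈⟨ ⊙-congˡ (const (+ 8)) (≈-trans (⊙-cong A′⊙a′ A′⊙a′) (*-identityˡ 𝟙)) ⟩
      const (+ 8) ⊙ 𝟙
        ≈⟨ *-identityʳ (const (+ 8)) ⟩
      const (+ 8) ∎

  expansion : quotient ≈ X₀ ⊕ (X₁ ⊕ (X₂ ⊕ (X₃ ⊕ X₄)))
  expansion = ≈-trans quotient≈ (≈-trans (≈-trans
    (solve 2 (λ b c → (con (+ 1) :+ con (+ 2) :* c) :*
        (con (+ 1) :+ (con (ℤ.- + 2) :* b :+ (con (+ 4) :* (b :* b) :+
          (con (ℤ.- + 8) :* (b :* (b :* b)) :+ con (+ 16) :* (b :* (b :* (b :* b)))))))
      := (con (+ 1) :+ (con (ℤ.- + 2) :* b :+ (con (+ 4) :* (b :* b) :+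
          (con (ℤ.- + 8) :* (b :* (b :* b)) :+ con (+ 16) :* (b :* (b :* (b :* b))))))) :+
        ((con (+ 2) :* c :+ con (+ 16) :* (c :* (b :* (b :* b)))) :+
        (con (ℤ.- + 4) :* (c :* b) :+ con (+ 8) :* (c :* (b :* b))))
        -- The product 2c · (-8b³) = -16cb³ is recorded in `X₁` as +16cb³; the difference is a
        -- multiple of 32.
        :+ con (+ 32) :* (c :* (b :* (b :* (b :* b))) :- c :* (b :* (b :* b)))) ≈-refl b c)
    (⊕-32⊙ (X₀ ⊕ (X₁ ⊕ (X₂ ⊕ const (+ 8) ⊙ (c ⊙ (b ⊙ b))))) _))
    (⊕-cong ≈-refl (⊕-cong ≈-refl (⊕-cong ≈-refl 8cb²))))

  mono9 : ∀ k → Supp (Res 3 0) (mono (3 ℕ.* k))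
  mono9 k = supp-res 3 (3 ℕ.* k) 0 (trans (cong (_% 3) (ℕₚ.*-comm 3 k)) (ℕM.m*n%n≡0 k 3)) (supp-res-mono 3 (3 ℕ.* k))

  a-mod3 : Supp (Res 3 0) a
  a-mod3 = supp-res-↑ 3 0 15 (supp-θ 3 (N ℕ.+ 0) (mono9 3))

  a′-mod3 : Supp (Res 3 0) a′
  a′-mod3 = supp-res-↑ 3 0 15 (supp-θ 3 (N ℕ.+ 0) (supp-⊝ (mono9 6)))

  a′-even : Supp (Res 2 0) a′
  a′-even = supp-res-↑ 2 0 15 (supp-θ 2 (N ℕ.+ 0) (supp-⊝ (supp-res 2 18 0 refl (supp-res-mono 2 18))))

  supp-Δ : ∀ {P} → (∀ s → ¬ 3 ℕD.∣ s → Supp P (mono (2 ℕ.* (s ℕ.* s)))) → Supp P Δ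
  supp-Δ h = supp-⊕
    (supp-∑ (range (N ℕ.* 3)) λ s → supp-ind (3 ∤? s ×-dec 2 ℕD.∣? s) λ { (3∤s , _) → h s 3∤s })
    (supp-⊝ (supp-∑ (range (N ℕ.* 3)) λ s → supp-ind (3 ∤? s ×-dec 2 ∤? s) λ { (3∤s , _) → h s 3∤s }))

  b-even : Supp (Res 2 0) b
  b-even = supp-res-⊙ 2 0 0 a′-even (supp-Δ λ s _ →
    supp-res 2 (2 ℕ.* (s ℕ.* s)) 0 (trans (cong (_% 2) (ℕₚ.*-comm 2 (s ℕ.* s))) (ℕM.m*n%n≡0 (s ℕ.* s) 2))
      (supp-res-mono 2 (2 ℕ.* (s ℕ.* s))))

  b-mod3 : Supp (Res 3 2) b
  b-mod3 = supp-res-⊙ 3 0 2 a′-mod3 (supp-Δ λ s 3∤s →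
    supp-res 3 (2 ℕ.* (s ℕ.* s)) 2 (Res-* 3 {2} {1} 2 (s ℕ.* s) refl (square-mod3 s 3∤s))
      (supp-res-mono 3 (2 ℕ.* (s ℕ.* s))))

  supp-mono1↑ : ∀ k → Supp (_≡ k) (mono 1 ↑ k)
  supp-mono1↑ k = supp-≈ (≈-sym (≈-trans (mono-↑ 1 k) (reflexive (cong mono (ℕₚ.*-identityˡ k))))) (supp-mono k)

  c-mod3 : Supp (Res 3 1) c
  c-mod3 = supp-res-⊙ 3 0 1 a-mod3 (supp-∑ (range (N ℕ.* 3)) λ s → supp-ind (3 ∤? s) λ 3∤s →
    supp-⊆ (λ { n refl → square-mod3 s 3∤s }) (supp-mono1↑ (s ℕ.* s)))

  B-square : Supp Square4 B
  B-square = supp-∑ (range (N ℕ.* 3)) λ s → supp-const-⊙ (ind (3 ∤? s))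
    (supp-⊆ (λ { n refl → square-mod4 s }) (supp-mono1↑ (s ℕ.* s)))

  A-square : Supp Square4 A
  A-square = supp-⊕ (supp-⊆ (λ { n refl → inj₁ refl }) (supp-const (+ 1)))
    (supp-const-⊙ (+ 2) (supp-∑ (range (N ℕ.+ 0)) λ s →
      supp-⊆ (λ { n refl → subst Square4 (identity s) (square-mod4 (3 ℕ.* s)) })
        (supp-≈ (≈-sym (mono-↑ 9 (s ℕ.* s))) (supp-mono (9 ℕ.* (s ℕ.* s))))))
    where
    identity : ∀ s → 3 ℕ.* s ℕ.* (3 ℕ.* s) ≡ 9 ℕ.* (s ℕ.* s)
    identity = ℕ-solve-∀

  even-odd-squares : Supp (Res 4 0) (Be ⊙ Be ⊕ Bo ⊙ Bo)
  even-odd-squares = supp-⊕ (supp-res-⊙ 4 0 0 Be-mod4 Be-mod4) (supp-res 4 4 0 refl (supp-res-⊙ 4 2 2 Bo-mod4 Bo-mod4))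
    where
    Be-mod4 : Supp (Res 4 0) Be
    Be-mod4 = supp-∑ (range (N ℕ.* 3)) λ s → supp-ind (3 ∤? s ×-dec 2 ℕD.∣? s) λ { (_ , 2∣s) →
      supp-res 4 (2 ℕ.* (s ℕ.* s)) 0 (even-square-mod4 s 2∣s) (supp-res-mono 4 (2 ℕ.* (s ℕ.* s))) }
    Bo-mod4 : Supp (Res 4 2) Bo
    Bo-mod4 = supp-∑ (range (N ℕ.* 3)) λ s → supp-ind (3 ∤? s ×-dec 2 ∤? s) λ { (_ , 2∤s) →
      supp-res 4 (2 ℕ.* (s ℕ.* s)) 2 (odd-square-mod4 s 2∤s) (supp-res-mono 4 (2 ℕ.* (s ℕ.* s))) }

  Not3Mod4 : ℕ → Set
  Not3Mod4 n = ¬ Res 4 3 n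

  X₀-even : Supp (Res 2 0) X₀
  X₀-even = supp-⊕ (supp-res-𝟙 2) (supp-⊕ (supp-const-⊙ (ℤ.- + 2) b-even)
    (supp-⊕ (supp-const-⊙ (+ 4) b²) (supp-⊕ (supp-const-⊙ (ℤ.- + 8) b³)
      (supp-const-⊙ (+ 16) (supp-res-⊙ 2 0 0 b-even b³)))))
    where
    b² : Supp (Res 2 0) (b ⊙ b)
    b² = supp-res-⊙ 2 0 0 b-even b-even
    b³ : Supp (Res 2 0) (b ⊙ (b ⊙ b))
    b³ = supp-res-⊙ 2 0 0 b-even b²

  X₁-mod3 : Supp (Res 3 1) X₁
  X₁-mod3 = supp-⊕ (supp-const-⊙ (+ 2) c-mod3) (supp-const-⊙ (+ 16)
    (supp-res 3 7 1 refl (supp-res-⊙ 3 1 6 c-mod3 (supp-res-⊙ 3 2 4 b-mod3 (supp-res-⊙ 3 2 2 b-mod3 b-mod3)))))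

  X₂-mod3 : Supp (Res 3 0) X₂
  X₂-mod3 = supp-const-⊙ (ℤ.- + 4) (supp-res 3 3 0 refl (supp-res-⊙ 3 1 2 c-mod3 b-mod3))

  -- AB lives on sums of two squares, which are never 3 modulo 4. The squares of `Be` and `Bo` live
  -- on 0 + 0 and 2 + 2 modulo 4 and do not change the class.
  X₃-mod4 : Supp Not3Mod4 X₃
  X₃-mod4 = supp-const-⊙ (+ 8) (supp-⊙ add (supp-⊙ (λ i j → sum-of-squares {i} {j}) A-square B-square) even-odd-squares)
    where
    absurd : ∀ n r → Res 4 r n → r % 4 ≢ 3 → Not3Mod4 n
    absurd n r p r≢3 q = r≢3 (trans (sym p) q)
    sum-of-squares : ∀ {i j} → Square4 i → Square4 j → Not3Mod4 (i ℕ.+ j)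
    sum-of-squares {i} {j} (inj₁ p) (inj₁ q) = absurd (i ℕ.+ j) 0 (Res-+ 4 {0} {0} i j p q) λ ()
    sum-of-squares {i} {j} (inj₁ p) (inj₂ q) = absurd (i ℕ.+ j) 1 (Res-+ 4 {0} {1} i j p q) λ ()
    sum-of-squares {i} {j} (inj₂ p) (inj₁ q) = absurd (i ℕ.+ j) 1 (Res-+ 4 {1} {0} i j p q) λ ()
    sum-of-squares {i} {j} (inj₂ p) (inj₂ q) = absurd (i ℕ.+ j) 2 (Res-+ 4 {1} {1} i j p q) λ ()
    add : ∀ i j → Not3Mod4 i → Res 4 0 j → Not3Mod4 (i ℕ.+ j)
    add i j p q r = p (trans (sym (begin-mod)) r)
      where
      begin-mod : (i ℕ.+ j) % 4 ≡ i % 4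
      begin-mod = trans (Res-+ 4 {i} {0} i j refl q) (cong (_% 4) (ℕₚ.+-identityʳ i))

  vanish-at : ∀ {P a} → Supp P a → ¬ P N → a N ≡₃₂ + 0
  vanish-at p ¬PN with supp p N ℕₚ.≤-refl
  ... | inj₁ z  = z
  ... | inj₂ PN = ⊥-elim (¬PN PN)

  drop : ∀ {P a b} → Supp P a → ¬ P N → (a ⊕ b) N ≡₃₂ b N
  drop {P} {a} {b} p ¬PN = subst₂ _≡₃₂_ (sym (⊕-def a b N)) (ℤₚ.+-identityˡ (b N))
    (≡₃₂-+ {a N} {+ 0} {b N} {b N} (vanish-at p ¬PN) (≡₃₂-reflexive {b N} refl))

  quotient-coefficient : Res 2 1 N → Res 3 2 N → Res 4 3 N → quotient N ≡₃₂ X₄ N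
  quotient-coefficient N₂ N₃ N₄ =
    ≡₃₂-trans {quotient N} {(X₀ ⊕ (X₁ ⊕ (X₂ ⊕ (X₃ ⊕ X₄)))) N} {X₄ N} (coeff expansion N ℕₚ.≤-refl)
    (≡₃₂-trans {(X₀ ⊕ (X₁ ⊕ (X₂ ⊕ (X₃ ⊕ X₄)))) N} {(X₁ ⊕ (X₂ ⊕ (X₃ ⊕ X₄))) N} {X₄ N}
      (drop X₀-even λ h → 1≢0 (trans (sym N₂) h))
    (≡₃₂-trans {(X₁ ⊕ (X₂ ⊕ (X₃ ⊕ X₄))) N} {(X₂ ⊕ (X₃ ⊕ X₄)) N} {X₄ N}
      (drop X₁-mod3 λ h → 2≢1 (trans (sym N₃) h))
    (≡₃₂-trans {(X₂ ⊕ (X₃ ⊕ X₄)) N} {(X₃ ⊕ X₄) N} {X₄ N}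
      (drop X₂-mod3 λ h → 2≢0 (trans (sym N₃) h))
      (drop X₃-mod4 λ h → h N₄))))
    where
    1≢0 : 1 ≢ 0
    1≢0 ()
    2≢0 : 2 ≢ 0
    2≢0 ()
    2≢1 : 2 ≢ 1
    2≢1 ()

  ∑-⊙ : ∀ {A : Set} (L : List A) f g → ∑ L f ⊙ g ≈ ∑ L (λ s → f s ⊙ g)
  ∑-⊙ []      f g = solve 1 (λ g → con (+ 0) :* g := con (+ 0)) ≈-refl g
  ∑-⊙ (s ∷ L) f g = ≈-trans (solve 3 (λ a b g → (a :+ b) :* g := a :* g :+ b :* g) ≈-refl (f s) (∑ L f) g)
                          (⊕-cong ≈-refl (∑-⊙ L f g))

  ⊙-∑ : ∀ {A : Set} (L : List A) f g → g ⊙ ∑ L f ≈ ∑ L (λ s → g ⊙ f s)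
  ⊙-∑ L f g = ≈-trans (*-comm g (∑ L f)) (≈-trans (∑-⊙ L f g) (∑-cong L λ s → *-comm (f s) g))

  ∑-coeff : ∀ {A : Set} (L : List A) f n → ∑ L f n ≡ sumℤ L (λ s → f s n)
  ∑-coeff []      f n = const-0 n
  ∑-coeff (s ∷ L) f n = trans (⊕-def (f s) (∑ L f) n) (cong (λ t → f s n ℤ.+ t) (∑-coeff L f n))

  const-⊙-coeff : ∀ k a n → (const k ⊙ a) n ≡ k ℤ.* a n
  const-⊙-coeff k a n = trans (⊙-def (const k) a n) (const-⊛ k a n)

  X₄-coefficient : X₄ N ≡₃₂ + 16 ℤ.* representations N
  X₄-coefficient = subst (_≡₃₂ + 16 ℤ.* representations N) (sym (const-⊙-coeff (+ 16) (B ⊙ (Be ⊙ Bo)) N))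
    (≡₃₂-* {+ 16} {+ 16} {(B ⊙ (Be ⊙ Bo)) N} {representations N} (≡₃₂-reflexive {+ 16} refl)
      (subst ((B ⊙ (Be ⊙ Bo)) N ≡₃₂_) counted (coeff multiplied-out N ℕₚ.≤-refl)))
    where
    R : List ℕ
    R = range (N ℕ.* 3)
    triple : ℕ → ℕ → ℕ → Series
    triple x w z = const (weight x w z) ⊙ mono (form x w z)
    pB pe po : ℕ → Series
    pB x = const (ind (3 ∤? x)) ⊙ mono 1 ↑ (x ℕ.* x)
    pe w = const (ind (3 ∤? w ×-dec 2 ℕD.∣? w)) ⊙ mono (2 ℕ.* (w ℕ.* w))
    po z = const (ind (3 ∤? z ×-dec 2 ∤? z)) ⊙ mono (2 ℕ.* (z ℕ.* z))
    monomial : ∀ x w z → pB x ⊙ (pe w ⊙ po z) ≈ triple x w z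
    monomial x w z = begin
      (const u ⊙ mono 1 ↑ (x ℕ.* x)) ⊙ ((const v ⊙ mono j) ⊙ (const t ⊙ mono k))
        ≈⟨ solve 6 (λ u v t m n l → (u :* m) :* ((v :* n) :* (t :* l)) := (u :* (v :* t)) :* (m :* (n :* l)))
             ≈-refl (const u) (const v) (const t) (mono 1 ↑ (x ℕ.* x)) (mono j) (mono k) ⟩
      (const u ⊙ (const v ⊙ const t)) ⊙ (mono 1 ↑ (x ℕ.* x) ⊙ (mono j ⊙ mono k))
        ≈⟨ ⊙-cong (≈-trans (⊙-congˡ (const u) (≗⇒≈ (λ n → sym (const-⊙ v t n)))) (≗⇒≈ (λ n → sym (const-⊙ u (v ℤ.* t) n))))
             (≈-trans (⊙-cong (≈-trans (mono-↑ 1 (x ℕ.* x)) (reflexive (cong mono (ℕₚ.*-identityˡ (x ℕ.* x)))))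
                            (≗⇒≈ (mono-+ j k)))
                    (≗⇒≈ (mono-+ (x ℕ.* x) (j ℕ.+ k)))) ⟩
      triple x w z ∎
      where
      u v t : ℤ
      u = ind (3 ∤? x)
      v = ind (3 ∤? w ×-dec 2 ℕD.∣? w)
      t = ind (3 ∤? z ×-dec 2 ∤? z)
      j k : ℕ
      j = 2 ℕ.* (w ℕ.* w)
      k = 2 ℕ.* (z ℕ.* z)
    multiplied-out : B ⊙ (Be ⊙ Bo) ≈ ∑ R λ x → ∑ R λ w → ∑ R λ z → triple x w z
    multiplied-out = ≈-trans (∑-⊙ R pB (Be ⊙ Bo)) (∑-cong R λ x →
      ≈-trans (⊙-congˡ (pB x) (≈-trans (∑-⊙ R pe Bo) (∑-cong R λ w → ⊙-∑ R po (pe w))))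
      (≈-trans (⊙-∑ R (λ w → ∑ R λ z → pe w ⊙ po z) (pB x)) (∑-cong R λ w →
      ≈-trans (⊙-∑ R (λ z → pe w ⊙ po z) (pB x)) (∑-cong R λ z → monomial x w z))))
    counted : (∑ R λ x → ∑ R λ w → ∑ R λ z → triple x w z) N ≡ representations N
    counted = trans (∑-coeff R _ N) (sumℤ-cong R λ x →
      trans (∑-coeff R _ N) (sumℤ-cong R λ w →
      trans (∑-coeff R _ N) (sumℤ-cong R λ z → const-⊙-coeff (weight x w z) (mono (form x w z)) N)))

  S9bar-divisible : ∀ m → Res 2 1 N → Res 3 2 N → Res 4 3 N →
    + 2 ℤS.∣ representations N → + 32 ℤS.∣ S9bar (16 ℕ.* m ℕ.+ 1) N
  S9bar-divisible m N₂ N₃ N₄ (divides k eq) =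
    subst (+ 32 ℤS.∣_) (ℤₚ.+-identityʳ _)
      (≡₃₂-trans {S9bar (16 ℕ.* m ℕ.+ 1) N} {quotient N} {+ 0} (S9bar≡quotient m)
      (≡₃₂-trans {quotient N} {X₄ N} {+ 0} (quotient-coefficient N₂ N₃ N₄)
      (≡₃₂-trans {X₄ N} {+ 16 ℤ.* representations N} {+ 0} X₄-coefficient
        (divides k (trans (ℤₚ.+-identityʳ _) (trans (cong (+ 16 ℤ.*_) eq) (regroup k)))))))
    where
    regroup : ∀ k → + 16 ℤ.* (k ℤ.* + 2) ≡ k ℤ.* + 32
    regroup = solve-∀

-- Parity of the number of representations

module _ {A : Set} (f : A → A) where

  private
    -- The head x and its partner f x are removed together. The bound `n` carries the recursion,
    -- since f x is taken out of the middle and what remains is not a sublist in the structural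
    -- sense.
    involution-even-length′ : ∀ n (L : List A) → length L ℕ.≤ n → Unique L →
      (∀ {x} → x ∈ L → f x ∈ L) → (∀ {x} → x ∈ L → f (f x) ≡ x) → (∀ {x} → x ∈ L → f x ≢ x) →
      2 ℕD.∣ length L
    involution-even-length′ _ [] _ _ _ _ _ = 2 ℕD.∣0
    involution-even-length′ (suc n) (x ∷ L) (s≤s L≤n) (x∉L ∷ uniq) closed invol free
      with closed (here refl)
    ... | here fx≡x = ⊥-elim (free (here refl) fx≡x)
    ... | there fx∈L with ∈-∃++ fx∈L
    ... | ys , zs , refl =
      subst (2 ℕD.∣_) (cong suc (sym (↭-length perm)))
        (ℕD.∣m∣n⇒∣m+n (ℕD.∣-refl {2})
          (involution-even-length′ n (ys ++ zs)
            (ℕₚ.≤-trans (ℕₚ.n≤1+n _) (ℕₚ.≤-trans (ℕₚ.≤-reflexive (sym (↭-length perm))) L≤n))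
            (tail-unique uniq′) closed′ (λ y∈ → invol (embed y∈)) (λ y∈ → free (embed y∈))))
      where
      perm : ys ++ f x ∷ zs ↭ f x ∷ ys ++ zs
      perm = shift (f x) ys zs
      uniq′ : Unique (f x ∷ ys ++ zs)
      uniq′ = ↭ₛ.Unique-resp-↭ (≡.setoid A) (↭⇒↭ₛ perm) uniq
      tail-unique : ∀ {a} {M : List A} → Unique (a ∷ M) → Unique M
      tail-unique (_ ∷ u) = u
      fresh : ∀ {a b} {M : List A} → Unique (a ∷ M) → b ∈ M → a ≢ b
      fresh (a∉M ∷ _) b∈M = All.lookup a∉M b∈M
      embed : ∀ {y} → y ∈ ys ++ zs → y ∈ x ∷ ys ++ f x ∷ zs
      embed y∈ = there (∈-resp-↭ (↭-sym perm) (there y∈))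
      x≢ : ∀ {y} → y ∈ ys ++ zs → x ≢ y
      x≢ y∈ = All.lookup x∉L (∈-resp-↭ (↭-sym perm) (there y∈))
      closed′ : ∀ {y} → y ∈ ys ++ zs → f y ∈ ys ++ zs
      closed′ {y} y∈ with closed (embed y∈)
      -- If f y were x, then y would be f x, which has been removed; if f y were f x, then y would
      -- be x.
      ... | here fy≡x = ⊥-elim (fresh uniq′ y∈ (trans (cong f (sym fy≡x)) (invol (embed y∈))))
      ... | there fy∈ with ∈-resp-↭ perm fy∈
      ...   | here fy≡fx = ⊥-elim (x≢ y∈ (trans (sym (invol (here refl)))
                             (trans (cong f (sym fy≡fx)) (invol (embed y∈)))))
      ...   | there fy∈′ = fy∈′

  involution-even-length : ∀ (L : List A) → Unique L →
    (∀ {x} → x ∈ L → f x ∈ L) → (∀ {x} → x ∈ L → f (f x) ≡ x) → (∀ {x} → x ∈ L → f x ≢ x) →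
    2 ℕD.∣ length L
  involution-even-length L = involution-even-length′ (length L) L ℕₚ.≤-refl

sumℤ-++ : ∀ {A : Set} (L M : List A) f → sumℤ (L ++ M) f ≡ sumℤ L f ℤ.+ sumℤ M f
sumℤ-++ []      M f = sym (ℤₚ.+-identityˡ (sumℤ M f))
sumℤ-++ (x ∷ L) M f = trans (cong (λ t → f x ℤ.+ t) (sumℤ-++ L M f)) (sym (ℤₚ.+-assoc (f x) (sumℤ L f) (sumℤ M f)))

sumℤ-map : ∀ {A B : Set} (g : A → B) L f → sumℤ (map g L) f ≡ sumℤ L (f ∘ g)
sumℤ-map g []      f = refl
sumℤ-map g (x ∷ L) f = cong (λ t → f (g x) ℤ.+ t) (sumℤ-map g L f)

sumℤ-cartesianProduct : ∀ {A B : Set} (L : List A) (M : List B) f →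
  sumℤ (cartesianProduct L M) f ≡ sumℤ L λ x → sumℤ M λ y → f (x , y)
sumℤ-cartesianProduct []      M f = refl
sumℤ-cartesianProduct (x ∷ L) M f = trans (sumℤ-++ (map (x ,_) M) (cartesianProduct L M) f)
  (cong₂ ℤ._+_ (sumℤ-map (x ,_) M f) (sumℤ-cartesianProduct L M f))

sumℤ-ind : ∀ {A : Set} {P : A → Set} (P? : ∀ x → Dec (P x)) L →
  sumℤ L (λ x → ind (P? x)) ≡ + length (filter P? L)
sumℤ-ind P? []      = refl
sumℤ-ind P? (x ∷ L) with P? x
... | yes _ = cong (λ t → + 1 ℤ.+ t) (sumℤ-ind P? L)
... | no _  = trans (ℤₚ.+-identityˡ _) (sumℤ-ind P? L)

infix 4 _≡₂_
_≡₂_ : ℤ → ℤ → Set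
x ≡₂ y = + 2 ℤS.∣ x ℤ.- y

sumℤ-≡₂ : ∀ {A : Set} (L : List A) {f g} → (∀ s → f s ≡₂ g s) → sumℤ L f ≡₂ sumℤ L g
sumℤ-≡₂ []      h = divides (+ 0) refl
sumℤ-≡₂ (s ∷ L) {f} {g} h = subst (+ 2 ℤS.∣_) (regroup (f s) (g s) (sumℤ L f) (sumℤ L g))
  (ℤS.∣m∣n⇒∣m+n (h s) (sumℤ-≡₂ L h))
  where
  regroup : ∀ a b c d → (a ℤ.- b) ℤ.+ (c ℤ.- d) ≡ (a ℤ.+ c) ℤ.- (b ℤ.+ d)
  regroup = solve-∀

signed : Bool → ℕ → ℤ
signed true  w = + w
signed false w = ℤ.- + w

sgn : ℤ → Bool
sgn (+ _)    = true
sgn -[1+ _ ] = false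

-- Signed solutions and the reflection in ℤ[√-2]

Point : Set
Point = ℕ × ℕ × ℕ × Bool

-- (x , w , z , ε) stands for the integral point (x , ±w , z).
Solution : ℕ → Point → Set
Solution N (x , w , z , ε) =
  form x w z ≡ N × ¬ 3 ℕD.∣ z × ¬ 2 ℕD.∣ z × + 3 ℤS.∣ + x ℤ.- signed ε w

solution? : ∀ N p → Dec (Solution N p)
solution? N (x , w , z , ε) =
  form x w z ℕ.≟ N ×-dec 3 ∤? z ×-dec 2 ∤? z ×-dec + 3 ℤS.∣? (+ x ℤ.- signed ε w)

normalise : ℤ → ℤ → ℕ → Point
normalise (+ n)    v z = n , ∣ v ∣ , z , sgn v
normalise -[1+ n ] v z = suc n , ∣ v ∣ , z , sgn (ℤ.- v)

signed-sgn : ∀ v → signed (sgn v) ∣ v ∣ ≡ v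
signed-sgn (+ _)    = refl
signed-sgn -[1+ _ ] = refl

signed-sgn-neg : ∀ v → signed (sgn (ℤ.- v)) ∣ v ∣ ≡ ℤ.- v
signed-sgn-neg v = trans (cong (signed (sgn (ℤ.- v))) (sym (ℤₚ.∣-i∣≡∣i∣ v))) (signed-sgn (ℤ.- v))

-- In ℤ[√-2] this is x + y√-2 ↦ π (x - y√-2) / π̄ with π = 1 + √-2 of norm 3,
-- up to the sign that makes the real part nonnegative.
reflect : Point → Point
reflect (x , w , z , ε) with + 3 ℤS.∣? (+ x ℤ.- signed ε w)
... | yes (divides k _) = normalise (k ℤ.- signed ε w) (ℤ.- signed ε w ℤ.- + 2 ℤ.* k) z
... | no _              = x , w , z , ε

-- Records how `normalise` may answer, so that later proofs only compare (u , v) with (-u , -v) and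
-- never split on integer constructors.
data SameUpToSign (u v : ℤ) (z : ℕ) : Point → Set where
  plus  : ∀ {x w ε} → + x ≡ u → signed ε w ≡ v → SameUpToSign u v z (x , w , z , ε)
  minus : ∀ {x w ε} → + x ≡ ℤ.- u → signed ε w ≡ ℤ.- v → SameUpToSign u v z (x , w , z , ε)

normalise-same : ∀ u v z → SameUpToSign u v z (normalise u v z)
normalise-same (+ n)    v z = plus refl (signed-sgn v)
normalise-same -[1+ n ] v z = minus refl (signed-sgn-neg v)

signed-square : ∀ ε w → signed ε w ℤ.* signed ε w ≡ + w ℤ.* + w
signed-square true  w = refl
signed-square false w = neg-square (+ w)
  where
  neg-square : ∀ a → (ℤ.- a) ℤ.* (ℤ.- a) ≡ a ℤ.* a
  neg-square = solve-∀

formℤ : ℤ → ℤ → ℤ → ℤ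
formℤ x y z = x ℤ.* x ℤ.+ (+ 2 ℤ.* (y ℤ.* y) ℤ.+ + 2 ℤ.* (z ℤ.* z))

form-signed : ∀ x w z ε → + form x w z ≡ formℤ (+ x) (signed ε w) (+ z)
form-signed x w z ε = begin
  + (x ℕ.* x ℕ.+ (2 ℕ.* (w ℕ.* w) ℕ.+ 2 ℕ.* (z ℕ.* z)))
    ≡⟨⟩
  + (x ℕ.* x) ℤ.+ (+ (2 ℕ.* (w ℕ.* w)) ℤ.+ + (2 ℕ.* (z ℕ.* z)))
    ≡⟨ cong₂ ℤ._+_ (ℤₚ.pos-* x x) (cong₂ ℤ._+_ (twice w) (twice z)) ⟩
  formℤ (+ x) (+ w) (+ z)
    ≡⟨ cong (λ t → + x ℤ.* + x ℤ.+ (+ 2 ℤ.* t ℤ.+ + 2 ℤ.* (+ z ℤ.* + z))) (signed-square ε w) ⟨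
  formℤ (+ x) (signed ε w) (+ z) ∎
  where
  open ≡-Reasoning
  twice : ∀ a → + (2 ℕ.* (a ℕ.* a)) ≡ + 2 ℤ.* (+ a ℤ.* + a)
  twice a = trans (ℤₚ.pos-* 2 (a ℕ.* a)) (cong (λ t → + 2 ℤ.* t) (ℤₚ.pos-* a a))

module Parity (N : ℕ) (N₂ : Res 2 1 N) (N₃ : Res 3 2 N) (N₄ : Res 4 3 N)
              (unrepresented : ∀ v z → 9 ℕ.* (v ℕ.* v) ℕ.+ 2 ℕ.* (z ℕ.* z) ≢ N) where

  x-odd : ∀ {x w z} → form x w z ≡ N → ¬ 2 ℕD.∣ x
  x-odd {x} {w} {z} eq 2∣x = 1≢0 (trans (sym N₂) (ℕD.n∣m⇒m%n≡0 N 2 (subst (2 ℕD.∣_) eq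
    (ℕD.∣m∣n⇒∣m+n (ℕD.∣m⇒∣m*n x 2∣x) (ℕD.∣m∣n⇒∣m+n (ℕD.m∣m*n (w ℕ.* w)) (ℕD.m∣m*n (z ℕ.* z)))))))
    where
    1≢0 : 1 ≢ 0
    1≢0 ()

  -- With z odd, an odd w would give 2w² + 2z² ≡ 0 modulo 4 and leave x² ≡ 3. Thus the evenness of w
  -- demanded by `weight` is automatic, and `Solution` omits it.
  w-even : ∀ {x w z} → form x w z ≡ N → ¬ 2 ℕD.∣ z → 2 ℕD.∣ w
  w-even {x} {w} {z} eq 2∤z with 2 ℕD.∣? w
  ... | yes 2∣w = 2∣w
  ... | no  2∤w = ⊥-elim (not-3 (square-mod4 x))
    where
    rest : Res 4 0 (2 ℕ.* (w ℕ.* w) ℕ.+ 2 ℕ.* (z ℕ.* z))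
    rest = Res-+ 4 {2} {2} (2 ℕ.* (w ℕ.* w)) (2 ℕ.* (z ℕ.* z)) (odd-square-mod4 w 2∤w) (odd-square-mod4 z 2∤z)
    form-mod4 : ∀ r → Res 4 r (x ℕ.* x) → Res 4 (r ℕ.+ 0) N
    form-mod4 r p = subst (Res 4 (r ℕ.+ 0)) eq (Res-+ 4 {r} {0} (x ℕ.* x) _ p rest)
    not-3 : ¬ Square4 (x ℕ.* x)
    not-3 (inj₁ p) with trans (sym N₄) (form-mod4 0 p)
    ... | ()
    not-3 (inj₂ p) with trans (sym N₄) (form-mod4 1 p)
    ... | ()

  form-mod3 : ∀ {x w z} r s → form x w z ≡ N → ¬ 3 ℕD.∣ z → Res 3 r x → Res 3 s w →
    Res 3 (r ℕ.* r ℕ.+ (2 ℕ.* (s ℕ.* s) ℕ.+ 2)) N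
  form-mod3 {x} {w} {z} r s eq 3∤z p q = subst (Res 3 (r ℕ.* r ℕ.+ (2 ℕ.* (s ℕ.* s) ℕ.+ 2))) eq
    (Res-+ 3 {r ℕ.* r} {2 ℕ.* (s ℕ.* s) ℕ.+ 2} (x ℕ.* x) _ (Res-* 3 {r} {r} x x p p)
      (Res-+ 3 {2 ℕ.* (s ℕ.* s)} {2} (2 ℕ.* (w ℕ.* w)) (2 ℕ.* (z ℕ.* z))
        (Res-* 3 {2} {s ℕ.* s} 2 (w ℕ.* w) refl (Res-* 3 {s} {s} w w q q))
        (Res-* 3 {2} {1} 2 (z ℕ.* z) refl (square-mod3 z 3∤z))))

  res-difference : ∀ {x w} r → x % 3 ≡ r → w % 3 ≡ r → + 3 ℤS.∣ + x ℤ.- + w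
  res-difference {x} {w} r p q = divides (+ (x ℕ./ 3) ℤ.- + (w ℕ./ 3)) (begin
    + x ℤ.- + w
      ≡⟨ cong₂ (λ a b → + a ℤ.- + b) (division x p) (division w q) ⟩
    (+ r ℤ.+ + (x ℕ./ 3 ℕ.* 3)) ℤ.- (+ r ℤ.+ + (w ℕ./ 3 ℕ.* 3))
      ≡⟨ cong₂ (λ a b → (+ r ℤ.+ a) ℤ.- (+ r ℤ.+ b)) (ℤₚ.pos-* (x ℕ./ 3) 3) (ℤₚ.pos-* (w ℕ./ 3) 3) ⟩
    (+ r ℤ.+ + (x ℕ./ 3) ℤ.* + 3) ℤ.- (+ r ℤ.+ + (w ℕ./ 3) ℤ.* + 3)
      ≡⟨ cancel (+ r) (+ (x ℕ./ 3)) (+ (w ℕ./ 3)) ⟩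
    (+ (x ℕ./ 3) ℤ.- + (w ℕ./ 3)) ℤ.* + 3 ∎)
    where
    open ≡-Reasoning
    division : ∀ a → a % 3 ≡ r → a ≡ r ℕ.+ a ℕ./ 3 ℕ.* 3
    division a h = trans (ℕM.m≡m%n+[m/n]*n a 3) (cong (ℕ._+ a ℕ./ 3 ℕ.* 3) h)
    cancel : ∀ r a b → (r ℤ.+ a ℤ.* + 3) ℤ.- (r ℤ.+ b ℤ.* + 3) ≡ (a ℤ.- b) ℤ.* + 3
    cancel = solve-∀

  res-sum : ∀ {x w} r s → x % 3 ≡ r → w % 3 ≡ s → (r ℕ.+ s) % 3 ≡ 0 → + 3 ℤS.∣ + x ℤ.- signed false w
  res-sum {x} {w} r s p q h = subst (+ 3 ℤS.∣_) (cong (λ t → + x ℤ.+ t) (sym (ℤₚ.neg-involutive (+ w))))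
    (ℤS.∣ᵤ⇒∣ (ℕD.m%n≡0⇒n∣m (x ℕ.+ w) 3
      (trans (ℕM.%-distribˡ-+ x w 3) (trans (cong₂ (λ a b → (a ℕ.+ b) % 3) p q) h))))

  data Mod3Case (x w : ℕ) : Set where
    both    : 3 ℕD.∣ x → 3 ℕD.∣ w → Mod3Case x w
    neither : ∀ ε → ¬ 3 ℕD.∣ x → ¬ 3 ℕD.∣ w → + 3 ℤS.∣ + x ℤ.- signed ε w → Mod3Case x w

  -- Modulo 3 both N and 2z² are 2, which leaves x² ≡ w². Hence 3 divides both of x and w, or
  -- neither of them and w ≡ ±x.
  mod3-case : ∀ {x w z} → form x w z ≡ N → ¬ 3 ℕD.∣ z → Mod3Case x w
  mod3-case {x} {w} {z} eq 3∤z =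
    cases (x % 3) (w % 3) (ℕM.m%n<n x 3) (ℕM.m%n<n w 3) refl refl
    where
    nonzero : ∀ {a r} → a % 3 ≡ suc r → ¬ 3 ℕD.∣ a
    nonzero {a} h 3∣a with trans (sym h) (ℕD.n∣m⇒m%n≡0 a 3 3∣a)
    ... | ()
    impossible : ∀ r s → Res 3 r x → Res 3 s w → (r ℕ.* r ℕ.+ (2 ℕ.* (s ℕ.* s) ℕ.+ 2)) % 3 ≢ 2 → Mod3Case x w
    impossible r s p q ≢2 = ⊥-elim (≢2 (trans (sym (form-mod3 {x} {w} {z} r s eq 3∤z p q)) N₃))
    cases : ∀ r s → r ℕ.< 3 → s ℕ.< 3 → x % 3 ≡ r → w % 3 ≡ s → Mod3Case x w
    cases 0 0 _ _ p q = both (ℕD.m%n≡0⇒n∣m x 3 p) (ℕD.m%n≡0⇒n∣m w 3 q)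
    cases 0 1 _ _ p q = impossible 0 1 p q λ ()
    cases 0 2 _ _ p q = impossible 0 2 p q λ ()
    cases 1 0 _ _ p q = impossible 1 0 p q λ ()
    cases 2 0 _ _ p q = impossible 2 0 p q λ ()
    cases 1 1 _ _ p q = neither true (nonzero p) (nonzero q) (res-difference {x} {w} 1 p q)
    cases 2 2 _ _ p q = neither true (nonzero p) (nonzero q) (res-difference {x} {w} 2 p q)
    cases 1 2 _ _ p q = neither false (nonzero p) (nonzero q) (res-sum {x} {w} 1 2 p q refl)
    cases 2 1 _ _ p q = neither false (nonzero p) (nonzero q) (res-sum {x} {w} 2 1 p q refl)
    cases (suc (suc (suc _))) _ (s≤s (s≤s (s≤s ()))) _ _ _
    cases 0 (suc (suc (suc _))) _ (s≤s (s≤s (s≤s ()))) _ _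
    cases 1 (suc (suc (suc _))) _ (s≤s (s≤s (s≤s ()))) _ _
    cases 2 (suc (suc (suc _))) _ (s≤s (s≤s (s≤s ()))) _ _

  -- The one place where `unrepresented` enters. With w = 0 the bit ε would not be determined by the
  -- integral point, and `normalise` could not restore it; such points would also fall outside the
  -- box of positive coordinates.
  w≢0 : ∀ {x w z} → form x w z ≡ N → ¬ 3 ℕD.∣ z → w ≢ 0
  w≢0 {x} {w} {z} eq 3∤z refl with mod3-case {x} {w} {z} eq 3∤z
  ... | neither _ _ 3∤0 _ = 3∤0 (3 ℕD.∣0)
  ... | both (ℕD.divides v refl) _ = unrepresented v z (trans (identity v z) eq)
    where
    identity : ∀ v z → 9 ℕ.* (v ℕ.* v) ℕ.+ 2 ℕ.* (z ℕ.* z) ≡ v ℕ.* 3 ℕ.* (v ℕ.* 3) ℕ.+ (2 ℕ.* (0 ℕ.* 0) ℕ.+ 2 ℕ.* (z ℕ.* z))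
    identity = ℕ-solve-∀

  -- When 3 divides neither x nor w, both signs at once would give 3 | x by adding x - w and x + w,
  -- so exactly one sign is admissible, against weight 1. When 3 divides both, weight 0 faces two
  -- admissible signs.
  weight-parity : ∀ x w z → weight x w z ℤ.* mono (form x w z) N ≡₂
    sumℤ (true ∷ false ∷ []) λ ε → ind (solution? N (x , w , z , ε))
  weight-parity x w z = by-cases (form x w z ℕ.≟ N) (3 ℕD.∣? z) (2 ℕD.∣? z)
    where
    s₁ s₀ : ℤ
    s₁ = ind (solution? N (x , w , z , true))
    s₀ = ind (solution? N (x , w , z , false))
    conclude : ∀ {t a b} → weight x w z ℤ.* mono (form x w z) N ≡ t → s₁ ≡ a → s₀ ≡ b →
      + 2 ℤS.∣ t ℤ.- (a ℤ.+ (b ℤ.+ + 0)) →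
      weight x w z ℤ.* mono (form x w z) N ≡₂ s₁ ℤ.+ (s₀ ℤ.+ + 0)
    conclude refl refl refl h = h
    no-solution : (∀ ε → ¬ Solution N (x , w , z , ε)) → weight x w z ℤ.* mono (form x w z) N ≡ + 0 →
      weight x w z ℤ.* mono (form x w z) N ≡₂ s₁ ℤ.+ (s₀ ℤ.+ + 0)
    no-solution ¬s eq = conclude eq (ind-no (solution? N (x , w , z , true)) (¬s true))
      (ind-no (solution? N (x , w , z , false)) (¬s false)) (divides (+ 0) refl)
    zero-weight : weight x w z ≡ + 0 → weight x w z ℤ.* mono (form x w z) N ≡ + 0
    zero-weight h = trans (cong (ℤ._* mono (form x w z) N) h) (ℤₚ.*-zeroˡ (mono (form x w z) N))
    z-weight : ¬ (¬ 3 ℕD.∣ z × ¬ 2 ℕD.∣ z) → weight x w z ≡ + 0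
    z-weight h = trans (cong (λ t → ind (3 ∤? x) ℤ.* (ind (3 ∤? w ×-dec 2 ℕD.∣? w) ℤ.* t))
                         (ind-no (3 ∤? z ×-dec 2 ∤? z) h))
      (trans (cong (λ t → ind (3 ∤? x) ℤ.* t) (ℤₚ.*-zeroʳ (ind (3 ∤? w ×-dec 2 ℕD.∣? w))))
             (ℤₚ.*-zeroʳ (ind (3 ∤? x))))
    x-divisible : ∀ ε ε′ → ε ≢ ε′ → + 3 ℤS.∣ + x ℤ.- signed ε w → + 3 ℤS.∣ + x ℤ.- signed ε′ w → 3 ℕD.∣ x
    x-divisible true true ne _ _ = ⊥-elim (ne refl)
    x-divisible false false ne _ _ = ⊥-elim (ne refl)
    x-divisible false true _ p q = x-divisible true false (λ ()) q p
    x-divisible true false _ (divides k p) (divides l q) = ℤS.∣⇒∣ᵤ {+ 3} {+ x} (divides (+ x ℤ.- k ℤ.- l) (begin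
      + x
        ≡⟨ spread (+ x) (+ w) ⟩
      + x ℤ.* + 3 ℤ.- (+ x ℤ.- + w) ℤ.- (+ x ℤ.- (ℤ.- + w))
        ≡⟨ cong₂ (λ a b → + x ℤ.* + 3 ℤ.- a ℤ.- b) p q ⟩
      + x ℤ.* + 3 ℤ.- k ℤ.* + 3 ℤ.- l ℤ.* + 3
        ≡⟨ collect (+ x) k l ⟩
      (+ x ℤ.- k ℤ.- l) ℤ.* + 3 ∎))
      where
      open ≡-Reasoning
      spread : ∀ x w → x ≡ x ℤ.* + 3 ℤ.- (x ℤ.- w) ℤ.- (x ℤ.- (ℤ.- w))
      spread = solve-∀
      collect : ∀ x k l → x ℤ.* + 3 ℤ.- k ℤ.* + 3 ℤ.- l ℤ.* + 3 ≡ (x ℤ.- k ℤ.- l) ℤ.* + 3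
      collect = solve-∀
    3∣signed : ∀ ε → 3 ℕD.∣ w → + 3 ℤS.∣ signed ε w
    3∣signed true  3∣w = ℤS.∣ᵤ⇒∣ 3∣w
    3∣signed false 3∣w = ℤS.∣m⇒∣-m (ℤS.∣ᵤ⇒∣ {+ 3} {+ w} 3∣w)
    by-cases : Dec (form x w z ≡ N) → Dec (3 ℕD.∣ z) → Dec (2 ℕD.∣ z) →
      weight x w z ℤ.* mono (form x w z) N ≡₂ s₁ ℤ.+ (s₀ ℤ.+ + 0)
    by-cases (no ≢N) _ _ = no-solution (λ { _ (eq , _) → ≢N eq })
      (trans (cong (λ t → weight x w z ℤ.* t) (mono-diff (form x w z) N (≢N ∘ sym))) (ℤₚ.*-zeroʳ (weight x w z)))
    by-cases (yes _) (yes 3∣z) _ = no-solution (λ { _ (_ , 3∤z , _) → 3∤z 3∣z }) (zero-weight (z-weight (λ { (3∤z , _) → 3∤z 3∣z })))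
    by-cases (yes _) (no _) (yes 2∣z) = no-solution (λ { _ (_ , _ , 2∤z , _) → 2∤z 2∣z }) (zero-weight (z-weight (λ { (_ , 2∤z) → 2∤z 2∣z })))
    by-cases (yes eq) (no 3∤z) (no 2∤z) with mod3-case {x} {w} {z} eq 3∤z
    ... | both 3∣x 3∣w = conclude
      (zero-weight (trans (cong (ℤ._* (ind (3 ∤? w ×-dec 2 ℕD.∣? w) ℤ.* ind (3 ∤? z ×-dec 2 ∤? z)))
        (ind-no (3 ∤? x) (λ 3∤x → 3∤x 3∣x)))
        (ℤₚ.*-zeroˡ (ind (3 ∤? w ×-dec 2 ℕD.∣? w) ℤ.* ind (3 ∤? z ×-dec 2 ∤? z)))))
      (ind-yes (solution? N (x , w , z , true)) (solution true))
      (ind-yes (solution? N (x , w , z , false)) (solution false))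
      (divides (ℤ.- + 1) refl)
      where
      solution : ∀ ε → Solution N (x , w , z , ε)
      solution ε = eq , 3∤z , 2∤z , ℤS.∣m∣n⇒∣m-n {m = + x} (ℤS.∣ᵤ⇒∣ 3∣x) (3∣signed ε 3∣w)
    ... | neither ε 3∤x 3∤w d = exactly-one ε d
      where
      full-weight : weight x w z ℤ.* mono (form x w z) N ≡ + 1
      full-weight = cong₂ ℤ._*_
        (cong₂ ℤ._*_ (ind-yes (3 ∤? x) 3∤x) (cong₂ ℤ._*_
          (ind-yes (3 ∤? w ×-dec 2 ℕD.∣? w) (3∤w , w-even {x} {w} {z} eq 2∤z))
          (ind-yes (3 ∤? z ×-dec 2 ∤? z) (3∤z , 2∤z))))
        (trans (cong (mono (form x w z)) (sym eq)) (mono-same (form x w z)))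
      exactly-one : ∀ ε → + 3 ℤS.∣ + x ℤ.- signed ε w → weight x w z ℤ.* mono (form x w z) N ≡₂ s₁ ℤ.+ (s₀ ℤ.+ + 0)
      exactly-one true d = conclude full-weight
        (ind-yes (solution? N (x , w , z , true)) (eq , 3∤z , 2∤z , d))
        (ind-no (solution? N (x , w , z , false)) λ { (_ , _ , _ , d′) → 3∤x (x-divisible true false (λ ()) d d′) })
        (divides (+ 0) refl)
      exactly-one false d = conclude full-weight
        (ind-no (solution? N (x , w , z , true)) λ { (_ , _ , _ , d′) → 3∤x (x-divisible true false (λ ()) d′ d) })
        (ind-yes (solution? N (x , w , z , false)) (eq , 3∤z , 2∤z , d))
        (divides (+ 0) refl)

  reflect-spec : ∀ {x w z ε} → + 3 ℤS.∣ + x ℤ.- signed ε w →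
    ∃ λ k → + x ℤ.- signed ε w ≡ k ℤ.* + 3 ×
      reflect (x , w , z , ε) ≡ normalise (k ℤ.- signed ε w) (ℤ.- signed ε w ℤ.- + 2 ℤ.* k) z
  reflect-spec {x} {w} {z} {ε} d with + 3 ℤS.∣? (+ x ℤ.- signed ε w)
  ... | yes (divides k eq) = k , eq , refl
  ... | no ¬d = ⊥-elim (¬d d)

  solve-x : ∀ x y k → x ℤ.- y ≡ k ℤ.* + 3 → x ≡ k ℤ.* + 3 ℤ.+ y
  solve-x x y k h = trans (add-back x y) (cong (ℤ._+ y) h)
    where
    add-back : ∀ x y → x ≡ x ℤ.- y ℤ.+ y
    add-back = solve-∀

  -- With y = ±w, the condition 3 | x - y says that π = 1 + √-2 divides α = x + y√-2. So π̄ divides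
  -- ᾱ, and π(ᾱ/π̄) is integral, has the norm of α and is again divisible by π. In coordinates with
  -- x = 3k + y these facts are `isometry` and u - v = 3k.
  reflect-solution : ∀ {p} → Solution N p → Solution N (reflect p)
  reflect-solution {x , w , z , ε} (eq , 3∤z , 2∤z , d) with reflect-spec {x} {w} {z} {ε} d
  ... | k , x-y≡3k , q = subst (Solution N) (sym q) (from-same (normalise-same u v z))
    where
    open ≡-Reasoning
    y u v : ℤ
    y = signed ε w
    u = k ℤ.- y
    v = ℤ.- y ℤ.- + 2 ℤ.* k
    isometry : ∀ k y z →
      (k ℤ.- y) ℤ.* (k ℤ.- y) ℤ.+ (+ 2 ℤ.* ((ℤ.- y ℤ.- + 2 ℤ.* k) ℤ.* (ℤ.- y ℤ.- + 2 ℤ.* k)) ℤ.+ + 2 ℤ.* (z ℤ.* z))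
      ≡ (k ℤ.* + 3 ℤ.+ y) ℤ.* (k ℤ.* + 3 ℤ.+ y) ℤ.+ (+ 2 ℤ.* (y ℤ.* y) ℤ.+ + 2 ℤ.* (z ℤ.* z))
    isometry = solve-∀
    negate : ∀ u v z →
      (ℤ.- u) ℤ.* (ℤ.- u) ℤ.+ (+ 2 ℤ.* ((ℤ.- v) ℤ.* (ℤ.- v)) ℤ.+ + 2 ℤ.* (z ℤ.* z))
      ≡ u ℤ.* u ℤ.+ (+ 2 ℤ.* (v ℤ.* v) ℤ.+ + 2 ℤ.* (z ℤ.* z))
    negate = solve-∀
    preserved : formℤ u v (+ z) ≡ + N
    preserved = begin
      formℤ u v (+ z)                         ≡⟨ isometry k y (+ z) ⟩
      formℤ (k ℤ.* + 3 ℤ.+ y) y (+ z)         ≡⟨ cong (λ t → formℤ t y (+ z)) (sym (solve-x (+ x) y k x-y≡3k)) ⟩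
      formℤ (+ x) y (+ z)                     ≡⟨ form-signed x w z ε ⟨
      + form x w z                            ≡⟨ cong +_ eq ⟩
      + N                                     ∎
    u-v : ∀ k y → (k ℤ.- y) ℤ.- (ℤ.- y ℤ.- + 2 ℤ.* k) ≡ k ℤ.* + 3
    u-v = solve-∀
    v-u : ∀ k y → ℤ.- (k ℤ.- y) ℤ.- ℤ.- (ℤ.- y ℤ.- + 2 ℤ.* k) ≡ (ℤ.- k) ℤ.* + 3
    v-u = solve-∀
    from-same : ∀ {p} → SameUpToSign u v z p → Solution N p
    from-same {x′ , w′ , _ , ε′} (plus hx hy) =
      ℤₚ.+-injective (trans (form-signed x′ w′ z ε′) (trans (cong₂ (λ a b → formℤ a b (+ z)) hx hy) preserved)) ,
      3∤z , 2∤z , divides k (trans (cong₂ ℤ._-_ hx hy) (u-v k y))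
    from-same {x′ , w′ , _ , ε′} (minus hx hy) =
      ℤₚ.+-injective (trans (form-signed x′ w′ z ε′) (trans (cong₂ (λ a b → formℤ a b (+ z)) hx hy)
        (trans (negate u v (+ z)) preserved))) ,
      3∤z , 2∤z , divides (ℤ.- k) (trans (cong₂ ℤ._-_ hx hy) (v-u k y))

  normalise-point : ∀ x w z ε → w ≢ 0 → normalise (+ x) (signed ε w) z ≡ (x , w , z , ε)
  normalise-point x zero    z ε     w≢0 = ⊥-elim (w≢0 refl)
  normalise-point x (suc w) z true  _   = refl
  normalise-point x (suc w) z false _   = refl

  normalise-neg-point : ∀ x w z ε → x ≢ 0 → w ≢ 0 →
    normalise (ℤ.- + x) (ℤ.- signed ε w) z ≡ (x , w , z , ε)
  normalise-neg-point zero    w       z ε     x≢0 _   = ⊥-elim (x≢0 refl)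
  normalise-neg-point (suc x) zero    z ε     _   w≢0 = ⊥-elim (w≢0 refl)
  normalise-neg-point (suc x) (suc w) z true  _   _   = refl
  normalise-neg-point (suc x) (suc w) z false _   _   = refl

  -- Since u - v = 3k, the image has the quotient k again, or -k if `normalise` flipped the sign.
  -- The second reflection then yields ±(x , y), and as x and w are nonzero, normalising restores
  -- the original point.
  reflect-involutive : ∀ {p} → Solution N p → reflect (reflect p) ≡ p
  reflect-involutive {x , w , z , ε} s@(eq , 3∤z , 2∤z , d) with reflect-spec {x} {w} {z} {ε} d
  ... | k , x-y≡3k , q = trans (cong reflect q)
      (from-same (normalise-same u v z) (subst (Solution N) q (reflect-solution {x , w , z , ε} s)))
    where
    y u v : ℤ
    y = signed ε w
    u = k ℤ.- y
    v = ℤ.- y ℤ.- + 2 ℤ.* k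
    x≢0 : x ≢ 0
    x≢0 refl = x-odd {0} {w} {z} eq (2 ℕD.∣0)
    plus-k : ∀ k y → (k ℤ.- y) ℤ.- (ℤ.- y ℤ.- + 2 ℤ.* k) ≡ k ℤ.* + 3
    plus-k = solve-∀
    minus-k : ∀ k y → ℤ.- (k ℤ.- y) ℤ.- ℤ.- (ℤ.- y ℤ.- + 2 ℤ.* k) ≡ (ℤ.- k) ℤ.* + 3
    minus-k = solve-∀
    plus-u : ∀ k y → k ℤ.- (ℤ.- y ℤ.- + 2 ℤ.* k) ≡ k ℤ.* + 3 ℤ.+ y
    plus-u = solve-∀
    plus-v : ∀ k y → ℤ.- (ℤ.- y ℤ.- + 2 ℤ.* k) ℤ.- + 2 ℤ.* k ≡ y
    plus-v = solve-∀
    minus-u : ∀ k y → ℤ.- k ℤ.- ℤ.- (ℤ.- y ℤ.- + 2 ℤ.* k) ≡ ℤ.- (k ℤ.* + 3 ℤ.+ y)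
    minus-u = solve-∀
    minus-v : ∀ k y → ℤ.- (ℤ.- (ℤ.- y ℤ.- + 2 ℤ.* k)) ℤ.- + 2 ℤ.* (ℤ.- k) ≡ ℤ.- y
    minus-v = solve-∀
    from-same : ∀ {p} → SameUpToSign u v z p → Solution N p → reflect p ≡ (x , w , z , ε)
    from-same {x′ , w′ , _ , ε′} (plus hx hy) (_ , _ , _ , d′) with reflect-spec {x′} {w′} {z} {ε′} d′
    ... | k′ , h , r with ℤₚ.*-cancelʳ-≡ k′ k (+ 3) (trans (sym h) (trans (cong₂ ℤ._-_ hx hy) (plus-k k y)))
    ...   | refl = trans r (trans
      (cong₂ (λ a b → normalise a b z)
        (trans (cong (λ t → k ℤ.- t) hy) (trans (plus-u k y) (sym (solve-x (+ x) y k x-y≡3k))))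
        (trans (cong (λ t → ℤ.- t ℤ.- + 2 ℤ.* k) hy) (plus-v k y)))
      (normalise-point x w z ε (w≢0 {x} {w} {z} eq 3∤z)))
    from-same {x′ , w′ , _ , ε′} (minus hx hy) (_ , _ , _ , d′) with reflect-spec {x′} {w′} {z} {ε′} d′
    ... | k′ , h , r with ℤₚ.*-cancelʳ-≡ k′ (ℤ.- k) (+ 3) (trans (sym h) (trans (cong₂ ℤ._-_ hx hy) (minus-k k y)))
    ...   | refl = trans r (trans
      (cong₂ (λ a b → normalise a b z)
        (trans (cong (λ t → ℤ.- k ℤ.- t) hy) (trans (minus-u k y) (cong ℤ.-_ (sym (solve-x (+ x) y k x-y≡3k)))))
        (trans (cong (λ t → ℤ.- t ℤ.- + 2 ℤ.* (ℤ.- k)) hy) (minus-v k y)))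
      (normalise-neg-point x w z ε x≢0 (w≢0 {x} {w} {z} eq 3∤z)))

  -- The first coordinate suffices. Without a flip, x = k - y and x = 3k + y add up to x = 2k. With
  -- a flip, three times x = y - k plus x = 3k + y gives 4x = 4y, so x = y, which is even by
  -- `w-even`. Both contradict that x is odd.
  reflect-free : ∀ {p} → Solution N p → reflect p ≢ p
  reflect-free {x , w , z , ε} (eq , 3∤z , 2∤z , d) fixed with reflect-spec {x} {w} {z} {ε} d
  ... | k , x-y≡3k , q = from-same (subst (SameUpToSign u v z) (trans (sym q) fixed) (normalise-same u v z))
    where
    open ≡-Reasoning
    y u v : ℤ
    y = signed ε w
    u = k ℤ.- y
    v = ℤ.- y ℤ.- + 2 ℤ.* k
    odd : ∀ t → + x ≡ t ℤ.* + 2 → ⊥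
    odd t h = x-odd {x} {w} {z} eq (ℤS.∣⇒∣ᵤ {+ 2} {+ x} (divides t h))
    2∣y : ∀ ε → + 2 ℤS.∣ signed ε w
    2∣y true  = ℤS.∣ᵤ⇒∣ (w-even {x} {w} {z} eq 2∤z)
    2∣y false = ℤS.∣m⇒∣-m (ℤS.∣ᵤ⇒∣ {+ 2} {+ w} (w-even {x} {w} {z} eq 2∤z))
    double : ∀ x → x ℤ.* + 2 ≡ x ℤ.+ x
    double = solve-∀
    sum₊ : ∀ k y → (k ℤ.- y) ℤ.+ (k ℤ.* + 3 ℤ.+ y) ≡ k ℤ.* + 2 ℤ.* + 2
    sum₊ = solve-∀
    quadruple : ∀ x → x ℤ.* + 4 ≡ + 3 ℤ.* x ℤ.+ x
    quadruple = solve-∀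
    sum₋ : ∀ k y → + 3 ℤ.* (ℤ.- (k ℤ.- y)) ℤ.+ (k ℤ.* + 3 ℤ.+ y) ≡ y ℤ.* + 4
    sum₋ = solve-∀
    from-same : SameUpToSign u v z (x , w , z , ε) → ⊥
    from-same (plus hx _) = odd k (ℤₚ.*-cancelʳ-≡ (+ x) (k ℤ.* + 2) (+ 2) (begin
      + x ℤ.* + 2                        ≡⟨ double (+ x) ⟩
      + x ℤ.+ + x                        ≡⟨ cong₂ ℤ._+_ hx (solve-x (+ x) y k x-y≡3k) ⟩
      (k ℤ.- y) ℤ.+ (k ℤ.* + 3 ℤ.+ y)    ≡⟨ sum₊ k y ⟩
      k ℤ.* + 2 ℤ.* + 2                  ∎))
    from-same (minus hx _) with 2∣y ε
    ... | divides t y≡2t = odd t (trans (ℤₚ.*-cancelʳ-≡ (+ x) y (+ 4) (begin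
      + x ℤ.* + 4                                         ≡⟨ quadruple (+ x) ⟩
      + 3 ℤ.* + x ℤ.+ + x                                 ≡⟨ cong₂ (λ a b → + 3 ℤ.* a ℤ.+ b) hx (solve-x (+ x) y k x-y≡3k) ⟩
      + 3 ℤ.* (ℤ.- (k ℤ.- y)) ℤ.+ (k ℤ.* + 3 ℤ.+ y)       ≡⟨ sum₋ k y ⟩
      y ℤ.* + 4                                           ∎)) y≡2t)

  private
    R : List ℕ
    R = range (N ℕ.* 3)
    signs : List Bool
    signs = true ∷ false ∷ []
    box : List Point
    box = cartesianProduct R (cartesianProduct R (cartesianProduct R signs))
    solutions : List Point
    solutions = filter (solution? N) box

    ∈-R : ∀ {s} → s ≢ 0 → s ℕ.* s ℕ.≤ N → s ∈ R
    ∈-R {zero}  s≢0 _  = ⊥-elim (s≢0 refl)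
    ∈-R {suc s} _   s²≤N = ∈-applyDownFrom⁺ suc
      (ℕₚ.≤-trans (ℕₚ.m≤m*n (suc s) (suc s)) (ℕₚ.≤-trans s²≤N (ℕₚ.m≤m*n N 3)))

    ∈-signs : ∀ ε → ε ∈ signs
    ∈-signs true  = here refl
    ∈-signs false = there (here refl)

    solution-∈ : ∀ {p} → Solution N p → p ∈ solutions
    solution-∈ {x , w , z , ε} s@(eq , 3∤z , 2∤z , d) = ∈-filter⁺ (solution? N)
      (∈-cartesianProduct⁺ (∈-R x≢0 x²≤N) (∈-cartesianProduct⁺ (∈-R (w≢0 {x} {w} {z} eq 3∤z) w²≤N)
        (∈-cartesianProduct⁺ (∈-R z≢0 z²≤N) (∈-signs ε)))) s
      where
      x≢0 : x ≢ 0
      x≢0 refl = x-odd {0} {w} {z} eq (2 ℕD.∣0)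
      z≢0 : z ≢ 0
      z≢0 refl = 2∤z (2 ℕD.∣0)
      x²≤N : x ℕ.* x ℕ.≤ N
      x²≤N = subst (x ℕ.* x ℕ.≤_) eq (ℕₚ.m≤m+n (x ℕ.* x) _)
      2w²+2z²≤N : 2 ℕ.* (w ℕ.* w) ℕ.+ 2 ℕ.* (z ℕ.* z) ℕ.≤ N
      2w²+2z²≤N = subst (2 ℕ.* (w ℕ.* w) ℕ.+ 2 ℕ.* (z ℕ.* z) ℕ.≤_) eq (ℕₚ.m≤n+m _ (x ℕ.* x))
      w²≤N : w ℕ.* w ℕ.≤ N
      w²≤N = ℕₚ.≤-trans (ℕₚ.m≤n*m (w ℕ.* w) 2) (ℕₚ.≤-trans (ℕₚ.m≤m+n (2 ℕ.* (w ℕ.* w)) _) 2w²+2z²≤N)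
      z²≤N : z ℕ.* z ℕ.≤ N
      z²≤N = ℕₚ.≤-trans (ℕₚ.m≤n*m (z ℕ.* z) 2) (ℕₚ.≤-trans (ℕₚ.m≤n+m _ (2 ℕ.* (w ℕ.* w))) 2w²+2z²≤N)

    is-solution : ∀ {p} → p ∈ solutions → Solution N p
    is-solution p∈ = proj₂ (∈-filter⁻ (solution? N) {xs = box} p∈)

    R-unique : Unique R
    R-unique = Uniqueₚ.applyDownFrom⁺₁ suc (N ℕ.* 3) λ j<i _ eq → ℕₚ.<⇒≢ j<i (sym (ℕₚ.suc-injective eq))

    solutions-unique : Unique solutions
    solutions-unique = Uniqueₚ.filter⁺ (solution? N) (Uniqueₚ.cartesianProduct⁺ R-unique
      (Uniqueₚ.cartesianProduct⁺ R-unique (Uniqueₚ.cartesianProduct⁺ R-unique (((λ ()) ∷ []) ∷ ([] ∷ [])))))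

  even-solutions : 2 ℕD.∣ length solutions
  even-solutions = involution-even-length reflect solutions solutions-unique
    (λ {p} p∈ → solution-∈ {reflect p} (reflect-solution {p} (is-solution {p} p∈)))
    (λ {p} p∈ → reflect-involutive {p} (is-solution {p} p∈))
    (λ {p} p∈ → reflect-free {p} (is-solution {p} p∈))

  even-representations : + 2 ℤS.∣ representations N
  even-representations = ℤS.∣m+n∣n⇒∣m {m = representations N}
    (sumℤ-≡₂ R λ x → sumℤ-≡₂ R λ w → sumℤ-≡₂ R λ z → weight-parity x w z)
    (ℤS.∣m⇒∣-m (subst (+ 2 ℤS.∣_) (sym counted) (ℤS.∣ᵤ⇒∣ even-solutions)))
    where
    counted : (sumℤ R λ x → sumℤ R λ w → sumℤ R λ z → sumℤ signs λ ε → ind (solution? N (x , w , z , ε)))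
              ≡ + length solutions
    counted = trans (sumℤ-cong R λ x → trans (sumℤ-cong R λ w →
        sym (sumℤ-cartesianProduct R signs (λ { (z , ε) → ind (solution? N (x , w , z , ε)) })))
        (sym (sumℤ-cartesianProduct R (cartesianProduct R signs) (λ { (w , zε) → ind (solution? N (x , w , zε)) }))))
      (trans (sym (sumℤ-cartesianProduct R (cartesianProduct R (cartesianProduct R signs)) (λ p → ind (solution? N p))))
        (sumℤ-ind (solution? N) box))

-- The quadratic form 9v² + 2z² and primes with (-18/p) = -1

any-∈ : ∀ {A : Set} (f : A → Bool) {x} {L : List A} → x ∈ L → f x ≡ true → any f L ≡ true
any-∈ f (here refl) fx rewrite fx = refl
any-∈ f {L = y ∷ L} (there x∈L) fx = trans (cong (f y ∨_) (any-∈ f x∈L fx)) (𝔹ₚ.∨-zeroʳ (f y))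

⌊⌋-true : ∀ {P : Set} (P? : Dec P) → P → ⌊ P? ⌋ ≡ true
⌊⌋-true (yes _) _ = refl
⌊⌋-true (no ¬p) p = ⊥-elim (¬p p)

legendre-nonresidue : ∀ a p → legendre a p ≡ -[1+ 0 ] →
  ∀ x → x < p → ¬ p ℕD.∣ ∣ + x ℤ.* + x ℤ.- a ∣
legendre-nonresidue a p h x x<p p∣ with ⌊ p ℕD.∣? ∣ a ∣ ⌋
... | true with h
...   | ()
legendre-nonresidue a p h x x<p p∣ | false
  with any (λ x → ⌊ p ℕD.∣? ∣ + x ℤ.* + x ℤ.- a ∣ ⌋) (upTo p)
     | any-∈ (λ x → ⌊ p ℕD.∣? ∣ + x ℤ.* + x ℤ.- a ∣ ⌋) (∈-upTo⁺ x<p) (⌊⌋-true (p ℕD.∣? _) p∣)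
legendre-nonresidue a p () x x<p p∣ | false | _ | refl

-- `legendre` only tries the residues below p, so x is first replaced by x mod p.
nonresidue-18 : ∀ p .{{_ : NonZero p}} → legendre (- (+ 18)) p ≡ -[1+ 0 ] →
  ∀ x → ¬ p ℕD.∣ x * x + 18
nonresidue-18 p h x p∣ = legendre-nonresidue (- (+ 18)) p h (x % p) (ℕM.m%n<n x p)
  (subst (p ℕD.∣_) (sym absolute) (ℕD.m%n≡0⇒n∣m _ p (trans reduced (ℕD.n∣m⇒m%n≡0 _ p p∣))))
  where
  r : ℕ
  r = x % p
  absolute : ∣ + r ℤ.* + r ℤ.- (- (+ 18)) ∣ ≡ r * r + 18
  absolute = cong (λ t → ∣ t ℤ.+ + 18 ∣) (sym (ℤₚ.pos-* r r))
  r≡x : Res p x r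
  r≡x = ℕM.m%n%n≡m%n x p
  reduced : (r * r + 18) % p ≡ (x * x + 18) % p
  reduced = Res-+ p {x * x} {18} (r * r) 18 (Res-* p {x} {x} r r r≡x r≡x) refl

prime-∤⇒coprime : ∀ {p v} → Prime p → ¬ p ℕD.∣ v → Coprime p v
prime-∤⇒coprime pp p∤v (d∣p , d∣v) with prime⇒irreducible pp d∣p
... | inj₁ d≡1  = d≡1
... | inj₂ refl = ⊥-elim (p∤v d∣v)

module NonResidue (p : ℕ) (pp : Prime p) (5≤p : 5 ≤ p) (h : legendre (- (+ 18)) p ≡ -[1+ 0 ]) where

  private
    instance
      p≢0 : NonZero p
      p≢0 = prime⇒nonZero pp

  -- If c v ≡ ±1 mod p then (2cz)² + 18 ≡ 2c²(9v² + 2z²) mod p.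
  divides-v : ∀ v z → p ℕD.∣ 9 * (v * v) + 2 * (z * z) → p ℕD.∣ v
  divides-v v z p∣ with p ℕD.∣? v
  ... | yes p∣v = p∣v
  ... | no p∤v = ⊥-elim (contradiction (coprime-Bézout (prime-∤⇒coprime pp p∤v)))
    where
    square : ∀ c q e → + c ℤ.* + v ≡ q ℤ.* + p ℤ.+ e → e ℤ.* e ≡ + 1 → ⊥
    square c q e cv≡ e²≡1 = nonresidue-18 p h (2 * (c * z)) (ℤS.∣⇒∣ᵤ {+ p} {+ (X * X + 18)}
      (subst (+ p ℤS.∣_) (sym total) (ℤS.∣m∣n⇒∣m-n {m = + 2 ℤ.* (+ c ℤ.* + c) ℤ.* + Q}
        (ℤS.∣n⇒∣m*n (+ 2 ℤ.* (+ c ℤ.* + c)) (ℤS.∣ᵤ⇒∣ {+ p} {+ Q} p∣))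
        (divides (+ 18 ℤ.* (q ℤ.* q ℤ.* + p ℤ.+ + 2 ℤ.* q ℤ.* e)) refl))))
      where
      open ≡-Reasoning
      X Q : ℕ
      X = 2 * (c * z)
      Q = 9 * (v * v) + 2 * (z * z)
      X-ℤ : + X ≡ + 2 ℤ.* (+ c ℤ.* + z)
      X-ℤ = trans (ℤₚ.pos-* 2 (c * z)) (cong (λ t → + 2 ℤ.* t) (ℤₚ.pos-* c z))
      Q-ℤ : + Q ≡ + 9 ℤ.* (+ v ℤ.* + v) ℤ.+ + 2 ℤ.* (+ z ℤ.* + z)
      Q-ℤ = cong₂ ℤ._+_ (trans (ℤₚ.pos-* 9 (v * v)) (cong (λ t → + 9 ℤ.* t) (ℤₚ.pos-* v v)))
                        (trans (ℤₚ.pos-* 2 (z * z)) (cong (λ t → + 2 ℤ.* t) (ℤₚ.pos-* z z)))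
      expand : ∀ c v z → + 2 ℤ.* (c ℤ.* z) ℤ.* (+ 2 ℤ.* (c ℤ.* z)) ℤ.+ + 18 ≡
        + 2 ℤ.* (c ℤ.* c) ℤ.* (+ 9 ℤ.* (v ℤ.* v) ℤ.+ + 2 ℤ.* (z ℤ.* z)) ℤ.- + 18 ℤ.* (c ℤ.* v ℤ.* (c ℤ.* v) ℤ.- + 1)
      expand = solve-∀
      collect : ∀ q p e → + 18 ℤ.* ((q ℤ.* p ℤ.+ e) ℤ.* (q ℤ.* p ℤ.+ e) ℤ.- e ℤ.* e) ≡
        + 18 ℤ.* (q ℤ.* q ℤ.* p ℤ.+ + 2 ℤ.* q ℤ.* e) ℤ.* p
      collect = solve-∀
      total : + (X * X + 18) ≡ + 2 ℤ.* (+ c ℤ.* + c) ℤ.* + Q ℤ.- + 18 ℤ.* (q ℤ.* q ℤ.* + p ℤ.+ + 2 ℤ.* q ℤ.* e) ℤ.* + p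
      total = begin
        + (X * X) ℤ.+ + 18
          ≡⟨ cong (λ t → t ℤ.+ + 18) (ℤₚ.pos-* X X) ⟩
        + X ℤ.* + X ℤ.+ + 18
          ≡⟨ cong (λ t → t ℤ.* t ℤ.+ + 18) X-ℤ ⟩
        + 2 ℤ.* (+ c ℤ.* + z) ℤ.* (+ 2 ℤ.* (+ c ℤ.* + z)) ℤ.+ + 18
          ≡⟨ expand (+ c) (+ v) (+ z) ⟩
        + 2 ℤ.* (+ c ℤ.* + c) ℤ.* (+ 9 ℤ.* (+ v ℤ.* + v) ℤ.+ + 2 ℤ.* (+ z ℤ.* + z))
          ℤ.- + 18 ℤ.* (+ c ℤ.* + v ℤ.* (+ c ℤ.* + v) ℤ.- + 1)
          ≡⟨ cong₂ (λ a b → + 2 ℤ.* (+ c ℤ.* + c) ℤ.* a ℤ.- + 18 ℤ.* b) (sym Q-ℤ)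
               (cong₂ (λ a b → a ℤ.* a ℤ.- b) cv≡ (sym e²≡1)) ⟩
        + 2 ℤ.* (+ c ℤ.* + c) ℤ.* + Q ℤ.- + 18 ℤ.* ((q ℤ.* + p ℤ.+ e) ℤ.* (q ℤ.* + p ℤ.+ e) ℤ.- e ℤ.* e)
          ≡⟨ cong (λ t → + 2 ℤ.* (+ c ℤ.* + c) ℤ.* + Q ℤ.- t) (collect q (+ p) e) ⟩
        + 2 ℤ.* (+ c ℤ.* + c) ℤ.* + Q ℤ.- + 18 ℤ.* (q ℤ.* q ℤ.* + p ℤ.+ + 2 ℤ.* q ℤ.* e) ℤ.* + p ∎
    cast : ∀ {a b c d} → 1 + a * b ≡ c * d → + 1 ℤ.+ + a ℤ.* + b ≡ + c ℤ.* + d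
    cast {a} {b} {c} {d} eq = trans (cong (λ t → + 1 ℤ.+ t) (sym (ℤₚ.pos-* a b))) (trans (cong +_ eq) (ℤₚ.pos-* c d))
    isolate : ∀ t → t ≡ + 1 ℤ.+ t ℤ.+ (- (+ 1))
    isolate = solve-∀
    contradiction : Bézout.Identity 1 p v → ⊥
    contradiction (Bézout.+- x y eq) = square y (+ x) (- (+ 1))
      (trans (isolate (+ y ℤ.* + v)) (cong (λ t → t ℤ.+ (- (+ 1))) (cast {y} {v} {x} {p} eq))) refl
    contradiction (Bézout.-+ x y eq) = square y (+ x) (+ 1)
      (trans (sym (cast {x} {p} {y} {v} eq)) (ℤₚ.+-comm (+ 1) (+ x ℤ.* + p))) refl

  divides-z : ∀ v z → p ℕD.∣ 9 * (v * v) + 2 * (z * z) → p ℕD.∣ z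
  divides-z v z p∣ with euclidsLemma 2 (z * z) pp
    (ℕD.∣m+n∣m⇒∣n p∣ (ℕD.∣n⇒∣m*n 9 (ℕD.∣m⇒∣m*n v (divides-v v z p∣))))
  ... | inj₁ p∣2 = ⊥-elim (ℕD.>⇒∤ (ℕₚ.<-≤-trans (s≤s (s≤s (s≤s z≤n))) 5≤p) p∣2)
  ... | inj₂ p∣z² = [ id , id ]′ (euclidsLemma z z pp p∣z²)

  -- Descent: p divides v and z, so p² cancels and the odd exponent drops by two. At exponent 1 the
  -- equation p²Q = pK would force p to divide K.
  unrepresented : ∀ α K → ¬ p ℕD.∣ K → ∀ v z → 9 * (v * v) + 2 * (z * z) ≢ p ^ (2 * α + 1) * K
  unrepresented α K p∤K v z eq
    with divides-v v z p∣form | divides-z v z p∣form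
    where
    p∣form : p ℕD.∣ 9 * (v * v) + 2 * (z * z)
    p∣form = subst (p ℕD.∣_) (sym (trans eq (cong (λ k → p ^ k * K) (ℕₚ.+-comm (2 * α) 1))))
      (ℕD.∣m⇒∣m*n K (ℕD.m∣m*n (p ^ (2 * α))))
  ... | ℕD.divides v′ refl | ℕD.divides z′ refl = descend α eq
    where
    Q : ℕ
    Q = 9 * (v′ * v′) + 2 * (z′ * z′)
    extract : ∀ v′ z′ p → p * (p * (9 * (v′ * v′) + 2 * (z′ * z′))) ≡ 9 * (v′ * p * (v′ * p)) + 2 * (z′ * p * (z′ * p))
    extract = ℕ-solve-∀
    descend : ∀ α → 9 * (v′ * p * (v′ * p)) + 2 * (z′ * p * (z′ * p)) ≡ p ^ (2 * α + 1) * K → ⊥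
    descend zero eq = p∤K (ℕD.divides Q (trans (sym (ℕₚ.*-cancelˡ-≡ (p * Q) K p
      (trans (extract v′ z′ p) (trans eq (cong (_* K) (ℕₚ.*-identityʳ p)))))) (ℕₚ.*-comm p Q)))
    descend (suc α) eq = unrepresented α K p∤K v′ z′
      (ℕₚ.*-cancelˡ-≡ Q _ p (ℕₚ.*-cancelˡ-≡ (p * Q) _ p
        (trans (extract v′ z′ p) (trans eq (trans (cong (λ k → p ^ k * K) (exponent α)) (regroup p (p ^ (2 * α + 1)) K))))))
      where
      exponent : ∀ α → 2 * suc α + 1 ≡ suc (suc (2 * α + 1))
      exponent = ℕ-solve-∀
      regroup : ∀ p P K → p * (p * P) * K ≡ p * (p * (P * K))
      regroup = ℕ-solve-∀

  prime-not-multiple : ∀ {k} → Prime k → k < p → ¬ k ℕD.∣ p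
  prime-not-multiple {k} pk k<p k∣p with prime⇒irreducible pp k∣p
  ... | inj₁ refl = ¬prime[1] pk
  ... | inj₂ refl = ℕₚ.<-irrefl refl k<p

  p²-mod3 : Res 3 1 (p * p)
  p²-mod3 = square-mod3 p (prime-not-multiple prime[3] (ℕₚ.<-≤-trans (s≤s (s≤s (s≤s (s≤s z≤n)))) 5≤p))
    where
    prime[3] : Prime 3
    prime[3] = from-yes (prime? 3)

  p-odd : ¬ 2 ℕD.∣ p
  p-odd = prime-not-multiple prime[2] (ℕₚ.<-≤-trans (s≤s (s≤s (s≤s z≤n))) 5≤p)

  p²-mod4 : Res 4 1 (p * p)
  p²-mod4 with square-mod4 p
  ... | inj₂ r = r
  ... | inj₁ r with euclidsLemma p p prime[2] (ℕD.∣-trans (ℕD.divides 2 refl) (ℕD.m%n≡0⇒n∣m (p * p) 4 r))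
  ...   | inj₁ 2∣p = ⊥-elim (p-odd 2∣p)
  ...   | inj₂ 2∣p = ⊥-elim (p-odd 2∣p)

  -- The exponents of the theorem: power of p and residue classes

  argument : ℕ → ℕ → ℕ → ℕ
  argument α n i = 24 * p ^ (2 * α + 2) * n + (24 * i + 11 * p) * p ^ (2 * α + 1)

  argument-factor : ∀ α n i → argument α n i ≡ p ^ (2 * α + 1) * (24 * p * n + (24 * i + 11 * p))
  argument-factor α n i = trans
    (cong (λ k → 24 * p ^ k * n + (24 * i + 11 * p) * p ^ (2 * α + 1)) (ℕₚ.+-suc (2 * α) 1))
    (identity p (p ^ (2 * α + 1)) n i)
    where
    identity : ∀ p P n i → 24 * (p * P) * n + (24 * i + 11 * p) * P ≡ P * (24 * p * n + (24 * i + 11 * p))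
    identity = ℕ-solve-∀

  -- Modulo p only 24i survives. Here 24 = 2 · 3 · 4 is prime to p because p ≥ 5, and 0 < i < p.
  argument-exact : ∀ n i → 1 ≤ i → i < p → ¬ p ℕD.∣ 24 * p * n + (24 * i + 11 * p)
  argument-exact n i@(suc _) _ i<p p∣ with euclidsLemma 24 i pp p∣24i
    where
    p∣24i : p ℕD.∣ 24 * i
    p∣24i = ℕD.∣m+n∣m⇒∣n
      (subst (p ℕD.∣_) (ℕₚ.+-comm (24 * i) (11 * p)) (ℕD.∣m+n∣m⇒∣n p∣ (ℕD.∣m⇒∣m*n n (ℕD.n∣m*n 24))))
      (ℕD.n∣m*n 11)
  ... | inj₂ p∣i = ℕD.>⇒∤ i<p p∣i
  ... | inj₁ p∣24 with euclidsLemma 2 12 pp p∣24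
  ...   | inj₁ p∣2 = ℕD.>⇒∤ (ℕₚ.<-≤-trans (s≤s (s≤s (s≤s z≤n))) 5≤p) p∣2
  ...   | inj₂ p∣12 with euclidsLemma 3 4 pp p∣12
  ...     | inj₁ p∣3 = ℕD.>⇒∤ (ℕₚ.<-≤-trans (s≤s (s≤s (s≤s (s≤s z≤n)))) 5≤p) p∣3
  ...     | inj₂ p∣4 = ℕD.>⇒∤ 5≤p p∣4

  -- The argument is a multiple of 24 plus 11p^(2α+2), and p² ≡ 1 removes the power of p. For m = 2,
  -- 3, 4 the class 11 is 1, 2, 3, as `S9bar-divisible` demands.
  argument-residue : ∀ m .{{_ : NonZero m}} α n i → Res m 0 24 → Res m 1 (p * p) → Res m 11 (argument α n i)
  argument-residue m α n i 24≡0 p²≡1 = subst (Res m 11) (sym argument≡)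
    (Res-+ m {0} {11} (24 * (p * P * n + i * P)) (11 * (p * p) ^ suc α)
      (Res-* m {0} {p * P * n + i * P} 24 _ 24≡0 refl)
      (Res-* m {11} {1} 11 ((p * p) ^ suc α) refl (power (suc α))))
    where
    open ≡-Reasoning
    P : ℕ
    P = p ^ (2 * α + 1)
    power : ∀ k → Res m 1 ((p * p) ^ k)
    power zero    = refl
    power (suc k) = Res-* m {1} {1} (p * p) ((p * p) ^ k) p²≡1 (power k)
    exponent : ∀ α → suc (2 * α + 1) ≡ 2 * suc α
    exponent = ℕ-solve-∀
    p*P : p * P ≡ (p * p) ^ suc α
    p*P = begin
      p ^ suc (2 * α + 1)   ≡⟨ cong (p ^_) (exponent α) ⟩
      p ^ (2 * suc α)       ≡⟨ ℕₚ.^-*-assoc p 2 (suc α) ⟨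
      (p ^ 2) ^ suc α       ≡⟨ cong (λ t → (p * t) ^ suc α) (ℕₚ.*-identityʳ p) ⟩
      (p * p) ^ suc α       ∎
    collect : ∀ p P n i → P * (24 * p * n + (24 * i + 11 * p)) ≡ 24 * (p * P * n + i * P) + 11 * (p * P)
    collect = ℕ-solve-∀
    argument≡ : argument α n i ≡ 24 * (p * P * n + i * P) + 11 * (p * p) ^ suc α
    argument≡ = begin
      argument α n i                                     ≡⟨ argument-factor α n i ⟩
      P * (24 * p * n + (24 * i + 11 * p))               ≡⟨ collect p P n i ⟩
      24 * (p * P * n + i * P) + 11 * (p * P)            ≡⟨ cong (λ t → 24 * (p * P * n + i * P) + 11 * t) p*P ⟩
      24 * (p * P * n + i * P) + 11 * (p * p) ^ suc α    ∎

theorem3p6 : ∀ (p m α n i : ℕ) → Prime p → 5 ≤ p →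
    legendre (- (+ 18)) p ≡ -[1+ 0 ] →
    1 ≤ i → i < p →
    (+ 32) ∣ S9bar (16 * m + 1)
    (24 * p ^ (2 * α + 2) * n + (24 * i + 11 * p) * p ^ (2 * α + 1))
theorem3p6 p m α n i pp 5≤p h 1≤i i<p = ℤS.∣⇒∣ᵤ
  (Extraction.S9bar-divisible N m N₂ N₃ N₄ (Parity.even-representations N N₂ N₃ N₄ no-representation))
  where
  open NonResidue p pp 5≤p h
  N : ℕ
  N = argument α n i
  N₄ : Res 4 3 N
  N₄ = argument-residue 4 α n i refl p²-mod4
  N₃ : Res 3 2 N
  N₃ = argument-residue 3 α n i refl p²-mod3
  N₂ : Res 2 1 N
  N₂ = argument-residue 2 α n i refl (Res-* 2 {1} {1} p p p-mod2 p-mod2)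
    where
    p-mod2 : p % 2 ≡ 1
    p-mod2 = trans (cong (_% 2) (odd-form p p-odd)) (ℕM.[m+kn]%n≡m%n 1 (p ℕ./ 2) 2)
  no-representation : ∀ v z → 9 * (v * v) + 2 * (z * z) ≢ N
  no-representation v z eq = unrepresented α _ (argument-exact n i 1≤i i<p) v z
    (trans eq (argument-factor α n i))
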